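{- Let $W$ be the affine Weyl group of type $\tilde B_2$ and let $u,w\in c_2$ with $u\le w$, $u\sim_R w$ and $u\not\sim_L w$. (i) If $\mathcal{R}(w)\not\subseteq\mathcal{R}(u)$, then $\mu(u,w)=1$ if $l(w)-l(u)=1$ and $0$ otherwise. (ii) If $\mathcal{R}(w)\subseteq\mathcal{R}(u)$, then $\mu(u,w)=1$ if $l(w)-l(u)=5$ and $0$ otherwise.
   Context: $W$ is the Coxeter group with simple reflections $S=\{r,s,t\}$ and relations $r^2=s^2=t^2=e$, $rt=tr$, $(rs)^4=(st)^4=e$; $l$ is the length and $\le$ the Bruhat order. $\mathcal{L}(w)=\{s'\in S\mid s'w<w\}$, $\mathcal{R}(w)=\{s'\in S\mid ws'<w\}$. $\sim_L,\sim_R$ are the Kazhdan–Lusztig left and right cell equivalences. $c_2=\{w\in W\mid a(w)=2\}$ for Lusztig's $a$-function; explicitly $c_2=\{u\,rt(srt)^m\,v\mid u\in\{e,s,ts,rs\},\ v\in\{e,s,st,sr\},\ m\in\mathbb{N}\}$. $P_{u,w}$ are the Kazhdan–Lusztig polynomials and, for $u\le w$, $\mu(u,w)$ is the coefficient of $q^{\frac12(l(w)-l(u)-1)}$ in $P_{u,w}$ (zero if the exponent is not an integer). -}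

module Defs where

open import Data.Nat using (ℕ; zero; suc; _≤_; _<_; _∸_; ⌊_/2⌋; _≡ᵇ_)
open import Data.Integer using (ℤ; 0ℤ; 1ℤ; _+_; _-_; _*_)
open import Data.List using (List; []; _∷_; _++_; length; reverse)
open import Data.List.Relation.Unary.Any using (Any)
open import Data.List.Relation.Unary.All using (All)
open import Data.List.Relation.Unary.AllPairs using (AllPairs)
open import Data.Product using (Σ; _×_; _,_)
open import Data.Sum using (_⊎_)
open import Data.Bool using (Bool; true; false; if_then_else_)
open import Relation.Nullary using (¬_)
open import Relation.Binary.PropositionalEquality using (_≡_; _≢_)
open import Relation.Binary.Construct.Closure.ReflexiveTransitive using (Star)

-- The Coxeter group W of type B̃₂, by its presentation.
-- Elements are words in the generators modulo the congruence generated
-- by the defining relations.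

data Gen : Set where
  r s t : Gen

Word : Set
Word = List Gen

infix 4 _≈_
data _≈_ : Word → Word → Set where
  ≈-refl  : ∀ {a} → a ≈ a
  ≈-sym   : ∀ {a b} → a ≈ b → b ≈ a
  ≈-trans : ∀ {a b c} → a ≈ b → b ≈ c → a ≈ c
  ≈-cong  : ∀ {a b c d} → a ≈ b → c ≈ d → a ++ c ≈ b ++ d
  rel-sq  : ∀ x → x ∷ x ∷ [] ≈ []
  rel-rt  : r ∷ t ∷ [] ≈ t ∷ r ∷ []
  rel-rs  : r ∷ s ∷ r ∷ s ∷ r ∷ s ∷ r ∷ s ∷ [] ≈ []
  rel-st  : s ∷ t ∷ s ∷ t ∷ s ∷ t ∷ s ∷ t ∷ [] ≈ []

IsReduced : Word → Set
IsReduced v = ∀ v' → v' ≈ v → length v ≤ length v'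

_<ℓ_ : Word → Word → Set
u <ℓ w = Σ Word λ u' → Σ Word λ w' →
  IsReduced u' × IsReduced w' × u' ≈ u × w' ≈ w × length u' < length w'

-- Bruhat order (Humphreys 5.9): generated by u → u τ with τ a reflection
-- (a conjugate x a x⁻¹ of a simple reflection) and l(u) < l(u τ).
BStep : Word → Word → Set
BStep u w = (u ≈ w) ⊎
  (Σ Word λ x → Σ Gen λ a → (w ≈ u ++ (x ++ a ∷ reverse x)) × (u <ℓ w))

infix 4 _≤B_ _<B_
_≤B_ : Word → Word → Set
_≤B_ = Star BStep

_<B_ : Word → Word → Set
u <B w = u ≤B w × ¬ (u ≈ w)

LDesc : Gen → Word → Set
LDesc a w = (a ∷ w) <B w

RDesc : Gen → Word → Set
RDesc a w = (w ++ a ∷ []) <B w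

-- Polynomials in ℤ[q], represented by coefficient sequences.

Poly : Set
Poly = ℕ → ℤ

shift : ℕ → Poly → Poly
shift zero    f k       = f k
shift (suc m) f zero    = 0ℤ
shift (suc m) f (suc k) = shift m f k

isOdd : ℕ → Bool
isOdd zero          = false
isOdd (suc zero)    = true
isOdd (suc (suc n)) = isOdd n

-- μ(z,v) for reduced words z, v: coefficient of q^{(l(v)-l(z)-1)/2} in
-- P_{z,v}, zero if that exponent is not an integer.
mu : (Word → Word → Poly) → Word → Word → ℤ
mu P z v with length v ∸ length z
... | d = if isOdd d then P z v ⌊ d /2⌋ else 0ℤ

sumL : List Word → (Word → ℤ) → ℤ
sumL []       f = 0ℤ
sumL (z ∷ zs) f = f z + sumL zs f

Enumerates : Gen → Word → List Word → Set
Enumerates a v zs =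
  All (λ z → IsReduced z × z <B v × LDesc a z) zs ×
  (∀ z → z <B v → LDesc a z → Any (λ z' → z ≈ z') zs) ×
  AllPairs (λ z z' → ¬ (z ≈ z')) zs

CVal : Gen → Word → ℕ → Set
CVal a x c = (LDesc a x × c ≡ 1) ⊎ (¬ LDesc a x × c ≡ 0)

-- P is the family of Kazhdan–Lusztig polynomials: it is well defined on
-- W, P_{e,e} = 1, P_{x,w} = 0 unless x ≤ w, and it satisfies the
-- Kazhdan–Lusztig recursion (KL 1979, (2.2.c)) for w = a v > v:
--   P_{x,w} = q^{1-c} P_{ax,v} + q^c P_{x,v}
--             - Σ_{z<v, az<z} μ(z,v) q^{(l(w)-l(z))/2} P_{x,z}.
-- These conditions determine P uniquely (induction on l(w)).
record IsKL (P : Word → Word → Poly) : Set where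
  field
    invariant : ∀ {x x' w w'} → x ≈ x' → w ≈ w' → ∀ k → P x w k ≡ P x' w' k
    vanish    : ∀ x w → ¬ (x ≤B w) → ∀ k → P x w k ≡ 0ℤ
    base      : ∀ k → P [] [] k ≡ (if k ≡ᵇ 0 then 1ℤ else 0ℤ)
    recursion : ∀ a v x zs c → IsReduced (a ∷ v) → IsReduced x →
      Enumerates a v zs → CVal a x c → ∀ k →
      P x (a ∷ v) k ≡
        (shift (1 ∸ c) (P (a ∷ x) v) k + shift c (P x v) k)
        - sumL zs (λ z → mu P z v * shift ⌊ length (a ∷ v) ∸ length z /2⌋ (P x z) k)

Edge : (Word → Word → Poly) → Word → Word → Set
Edge P x y = (x <B y × mu P x y ≢ 0ℤ) ⊎ (y <B x × mu P y x ≢ 0ℤ)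

LStep : (Word → Word → Poly) → Word → Word → Set
LStep P x y = (x ≈ y) ⊎
  (IsReduced x × IsReduced y × Edge P x y × Σ Gen λ a → LDesc a x × ¬ LDesc a y)

LeqL : (Word → Word → Poly) → Word → Word → Set
LeqL P = Star (LStep P)

-- x ≤_R y iff x⁻¹ ≤_L y⁻¹ (the inverse of a word is its reverse)
LeqR : (Word → Word → Poly) → Word → Word → Set
LeqR P x y = LeqL P (reverse x) (reverse y)

SimL SimR : (Word → Word → Poly) → Word → Word → Set
SimL P x y = LeqL P x y × LeqL P y x
SimR P x y = LeqR P x y × LeqR P y x

rep : ℕ → Word → Word
rep zero    w = []
rep (suc m) w = w ++ rep m w

data Pre : Word → Set where
  pe : Pre []
  ps : Pre (s ∷ [])
  pts : Pre (t ∷ s ∷ [])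
  prs : Pre (r ∷ s ∷ [])

data Suf : Word → Set where
  se : Suf []
  ss : Suf (s ∷ [])
  sst : Suf (s ∷ t ∷ [])
  ssr : Suf (s ∷ r ∷ [])

InC2 : Word → Set
InC2 w = Σ Word λ p → Σ Word λ q → Σ ℕ λ m →
  Pre p × Suf q × (w ≈ p ++ (r ∷ t ∷ rep m (s ∷ r ∷ t ∷ [])) ++ q)

RSub : Word → Word → Set
RSub w u = ∀ a → RDesc a w → RDesc a u

{-# OPTIONS --safe #-}

-- Let u = p rt(srt)ⁿ q and w = p′ rt(srt)ᵐ q′.  An order relation of cells moves right descents in one direction only,
-- so u ∼R w forces equal left descents, hence p = p′; and elements with equal suffixes are ∼L, hence q ≠ q′.
--
-- (i) For b ∈ R(w) \ R(u) one has P_{u,w} = P_{ub,w}, so by the degree bound μ(u,w) = 0 unless ub = w; and u ≤ w with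
-- l(w) − l(u) = 1 forces ub = w by the lifting property.
--
-- (ii) The descents leave only q = e and q′ = st or sr.  Lusztig's string relation for {s,t} on the right turns
-- μ(p x_n, p x_m st), x_m = rt(srt)ᵐ, into μ(p x_n st, p x_m), where case (i) applies with b = r: it is 1 exactly when
-- p x_n st · r = p x_{n+1} equals p x_m.
--
-- The string relation is read off the Kazhdan–Lusztig recursion on the right, whereas P is only given the recursion on
-- the left.  For w = a v b, both recursions expand C_a C_v C_b, and their difference is a combination of the C_y with
-- bar-invariant coefficients satisfying the degree bound, hence zero.
--
-- W is realised on the alcoves of type B̃₂, in the coordinates counting the walls of each direction that separate an
-- alcove from the fundamental one.

module Submission where

open import Defs
open import Data.Nat using (_∸_; _≡ᵇ_)
open import Data.Integer using (0ℤ; 1ℤ)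
open import Data.List using (length)
open import Data.Product using (_×_)
open import Data.Bool using (if_then_else_)
open import Relation.Nullary using (¬_)
open import Relation.Binary.PropositionalEquality using (_≡_)

open import Data.Bool as Bool using (Bool; true; false; not; _xor_)
import Data.Bool.Properties as Boolₚ
open import Data.Empty using (⊥; ⊥-elim)
open import Data.Integer as ℤ using (ℤ; _+_; _-_; _*_; -_)
import Data.Integer.Properties as ℤₚ
open import Data.Integer.Tactic.RingSolver using (solve-∀)
open import Data.List using (List; []; _∷_; _++_; reverse; foldr; map; filter; deduplicate)
open import Data.List.Membership.Propositional using (_∈_)
open import Data.List.Membership.Propositional.Properties
  using (∈-map⁺; ∈-map⁻; ∈-++⁺ˡ; ∈-++⁺ʳ; ∈-++⁻; ∈-filter⁺; ∈-deduplicate⁺; ∈-deduplicate⁻)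
import Data.List.Properties as Listₚ
open import Data.List.Relation.Unary.All as All using (All; []; _∷_)
import Data.List.Relation.Unary.All.Properties as Allₚ
import Data.List.Relation.Unary.AllPairs as AllPairs
import Data.List.Relation.Unary.AllPairs.Properties as AllPairsₚ
open import Data.List.Relation.Unary.Any as Any using (here; there)
open import Data.List.Relation.Unary.Unique.DecPropositional.Properties using (deduplicate-!)
open import Data.List.Relation.Unary.Unique.Propositional using (Unique; []; _∷_)
import Data.List.Relation.Unary.Unique.Propositional.Properties as Uniqueₚ
open import Data.Nat as ℕ using (ℕ; zero; suc; _≤_; _<_; ⌊_/2⌋; z≤n; s≤s)
import Data.Nat.Properties as ℕₚ
import Data.Nat.Tactic.RingSolver as ℕSolver
open import Data.Product using (Σ; _,_; proj₁; proj₂; ∃)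
open import Data.Sum using (_⊎_; inj₁; inj₂; [_,_]′)
open import Function using (mk⇔)
open import Relation.Binary.Construct.Closure.ReflexiveTransitive using (Star; ε; _◅_; _◅◅_)
open import Relation.Binary.PropositionalEquality
  using (_≢_; refl; sym; trans; cong; cong₂; subst; subst₂)
open import Relation.Nullary using (Dec; yes; no; does)
open import Relation.Nullary.Decidable using (map′; _×-dec_; ¬?; dec-true; does-⇔)

-- The recursion for `P` applies only to an explicit list of the elements below v with a given
-- descent. So the Bruhat order has to be decided, which calls for strong exchange and lifting, and
-- equality in W, known only by a presentation, has to be decided in a faithful model.
--
-- The bar involution itself is never defined. In comparing the two expansions of C_a C_v C_b the
-- only coefficients that occur are integers and integer multiples of q^(1/2) + q^(-1/2), the latter
-- from C_a C_y = (q^(1/2) + q^(-1/2)) C_y for a y < y. The parity of the length difference decides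
-- which of the two factors stands before C_y, so integer coefficients describe the whole span.
--
-- The constant 5 is 3 + 2: from x_n to x_(n+1) there are the three letters of srt, and the suffix
-- st or sr adds two more.

∷-cong : ∀ a {u v} → u ≈ v → a ∷ u ≈ a ∷ v
∷-cong a p = ≈-cong (≈-refl {a ∷ []}) p

≡⇒≈ : ∀ {u v} → u ≡ v → u ≈ v
≡⇒≈ refl = ≈-refl

cancel : ∀ a u → a ∷ a ∷ u ≈ u
cancel a u = ≈-cong (rel-sq a) ≈-refl

module _ {u : Word} where
  swap-rt : r ∷ t ∷ u ≈ t ∷ r ∷ u
  swap-rt = ≈-cong rel-rt (≈-refl {u})

  -- Inserting `a b a b b a b a` in front of `u` completes the relator, and what remains is the
  -- other side.
  braid : ∀ a b → a ∷ b ∷ a ∷ b ∷ a ∷ b ∷ a ∷ b ∷ [] ≈ [] → a ∷ b ∷ a ∷ b ∷ u ≈ b ∷ a ∷ b ∷ a ∷ u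
  braid a b rel = ≈-trans
    (∷-cong a (∷-cong b (∷-cong a (∷-cong b
      (≈-trans (≈-sym (cancel a u)) (∷-cong a
      (≈-trans (≈-sym (cancel b (a ∷ u))) (∷-cong b
      (≈-trans (≈-sym (cancel a (b ∷ a ∷ u))) (∷-cong a
      (≈-sym (cancel b (a ∷ b ∷ a ∷ u))))))))))))) (≈-cong rel ≈-refl)

-- An abstract faithful model of W.

-- W acting simply transitively on G by left multiplication, with its length function and a choice of reduced words.
record Model : Set₁ where
  infix  4 _≟_
  infixr 6 _·_
  field
    G      : Set
    _≟_    : (x y : G) → Dec (x ≡ y)
    _·_    : Gen → G → G
    e      : G
    len    : G → ℕ
    word   : G → Word

  infixr 6 _··_
  _··_ : Word → G → G
  w ·· x = foldr _·_ x w

  field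
    len-e    : len e ≡ 0
    invol    : ∀ a x → a · a · x ≡ x
    up-down  : ∀ a x → len (a · x) ≡ suc (len x) ⊎ len x ≡ suc (len (a · x))
    ··-≈     : ∀ {u v} → u ≈ v → ∀ x → u ·· x ≡ v ·· x
    word-·   : ∀ a x → word (a · x) ≈ a ∷ word x
    word-e   : word e ≡ []
    ··-word  : ∀ x → word x ·· e ≡ x
    len-word : ∀ x → length (word x) ≡ len x

  Desc Asc : Gen → G → Set
  Desc a x = len x ≡ suc (len (a · x))
  Asc  a x = len (a · x) ≡ suc (len x)

-- Group structure, reduced words and strong exchange.

module Group (M : Model) where
  open Model M

  infixl 7 _∙_

  eval : Word → G
  eval w = w ·· e

  -- A point of `G` stands for the group element carrying `e` to it, so the left factor acts through
  -- any of its words.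
  _∙_ : G → G → G
  x ∙ y = word x ·· y

  inv : G → G
  inv x = eval (reverse (word x))

  gen : Gen → G
  gen a = a · e

  ++-·· : ∀ u v x → (u ++ v) ·· x ≡ u ·· v ·· x
  ++-·· u v x = Listₚ.foldr-++ _·_ x u v

  word-·· : ∀ w x → word (w ·· x) ≈ w ++ word x
  word-·· []      x = ≈-refl
  word-·· (a ∷ w) x = ≈-trans (word-· a (w ·· x)) (∷-cong a (word-·· w x))

  word-eval : ∀ w → word (eval w) ≈ w
  word-eval w = ≈-trans (word-·· w e) (≡⇒≈ (trans (cong (w ++_) word-e) (Listₚ.++-identityʳ w)))

  eval-injective : ∀ {u v} → eval u ≡ eval v → u ≈ v
  eval-injective {u} {v} p = ≈-trans (≈-sym (word-eval u)) (≈-trans (≡⇒≈ (cong word p)) (word-eval v))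

  eval-≈ : ∀ {u v} → u ≈ v → eval u ≡ eval v
  eval-≈ p = ··-≈ p e

  ·-∙ : ∀ a x y → (a · x) ∙ y ≡ a · (x ∙ y)
  ·-∙ a x y = ··-≈ (word-· a x) y

  ··-∙ : ∀ w x y → (w ·· x) ∙ y ≡ w ·· (x ∙ y)
  ··-∙ []      x y = refl
  ··-∙ (a ∷ w) x y = trans (·-∙ a (w ·· x) y) (cong (a ·_) (··-∙ w x y))

  ∙-assoc : ∀ x y z → (x ∙ y) ∙ z ≡ x ∙ (y ∙ z)
  ∙-assoc x y z = ··-∙ (word x) y z

  e∙ : ∀ x → e ∙ x ≡ x
  e∙ x = cong (_·· x) word-e

  ∙e : ∀ x → x ∙ e ≡ x
  ∙e = ··-word

  eval-∙ : ∀ w y → eval w ∙ y ≡ w ·· y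
  eval-∙ w y = trans (··-∙ w e y) (cong (w ··_) (e∙ y))

  gen-∙ : ∀ a y → gen a ∙ y ≡ a · y
  gen-∙ a y = eval-∙ (a ∷ []) y

  ·-injective : ∀ a {x y} → a · x ≡ a · y → x ≡ y
  ·-injective a {x} {y} p = trans (sym (invol a x)) (trans (cong (a ·_) p) (invol a y))

  ··-injective : ∀ w {x y} → w ·· x ≡ w ·· y → x ≡ y
  ··-injective []      p = p
  ··-injective (a ∷ w) p = ··-injective w (·-injective a p)

  ··-reverse : ∀ w x → w ·· reverse w ·· x ≡ x
  ··-reverse []      x = refl
  ··-reverse (a ∷ w) x rewrite Listₚ.unfold-reverse a w | ++-·· (reverse w) (a ∷ []) x =
    trans (cong (a ·_) (··-reverse w (a · x))) (invol a x)

  reverse-·· : ∀ w x → reverse w ·· w ·· x ≡ x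
  reverse-·· w x = trans (cong (λ v → reverse w ·· v ·· x) (sym (Listₚ.reverse-involutive w)))
                         (··-reverse (reverse w) x)

  -- Reversal is inversion in the model, where inverses are unique; this replaces an induction on
  -- `≈`.
  reverse-cong : ∀ {u v} → u ≈ v → reverse u ≈ reverse v
  reverse-cong {u} {v} p = eval-injective
    (trans (cong (reverse u ··_) (sym (··-reverse v e)))
    (trans (cong (reverse u ··_) (sym (··-≈ p (reverse v ·· e)))) (reverse-·· u (reverse v ·· e))))

  eval-reverse : ∀ w → eval (reverse w) ≡ inv (eval w)
  eval-reverse w = eval-≈ (reverse-cong (≈-sym (word-eval w)))

  inv-invol : ∀ x → inv (inv x) ≡ x
  inv-invol x = trans (sym (eval-reverse (reverse (word x))))
    (trans (cong eval (Listₚ.reverse-involutive (word x))) (··-word x))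

  inv-· : ∀ a x → inv (a · x) ≡ inv x ∙ gen a
  inv-· a x = trans (eval-≈ (reverse-cong (word-· a x)))
    (trans (cong eval (Listₚ.unfold-reverse a (word x)))
    (trans (++-·· (reverse (word x)) (a ∷ []) e) (sym (eval-∙ (reverse (word x)) (gen a)))))

  inv-∙gen : ∀ a x → inv (x ∙ gen a) ≡ a · inv x
  inv-∙gen a x = trans (cong inv (trans (cong (_∙ gen a) (sym (inv-invol x))) (sym (inv-· a (inv x)))))
                       (inv-invol (a · inv x))

  len-eval : ∀ w → len (eval w) ≤ length w
  len-eval [] = ℕₚ.≤-reflexive len-e
  len-eval (a ∷ w) with up-down a (eval w)
  ... | inj₁ up   = ℕₚ.≤-trans (ℕₚ.≤-reflexive up) (s≤s (len-eval w))
  ... | inj₂ down = ℕₚ.≤-trans (ℕₚ.m≤n⇒m≤1+n ℕₚ.≤-refl)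
                      (ℕₚ.≤-trans (ℕₚ.≤-reflexive (sym down)) (ℕₚ.m≤n⇒m≤1+n (len-eval w)))

  len-inv : ∀ x → len (inv x) ≡ len x
  len-inv x = ℕₚ.≤-antisym (bound x) (ℕₚ.≤-trans (ℕₚ.≤-reflexive (cong len (sym (inv-invol x)))) (bound (inv x)))
    where
    bound : ∀ x → len (inv x) ≤ len x
    bound x = ℕₚ.≤-trans (len-eval (reverse (word x)))
                (ℕₚ.≤-reflexive (trans (Listₚ.length-reverse (word x)) (len-word x)))

  reduced⇒len : ∀ {v} → IsReduced v → length v ≡ len (eval v)
  reduced⇒len {v} red = ℕₚ.≤-antisym
    (ℕₚ.≤-trans (red (word (eval v)) (word-eval v)) (ℕₚ.≤-reflexive (len-word (eval v)))) (len-eval v)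

  len⇒reduced : ∀ {v} → length v ≡ len (eval v) → IsReduced v
  len⇒reduced p v′ q = ℕₚ.≤-trans (ℕₚ.≤-reflexive (trans p (cong len (sym (eval-≈ q))))) (len-eval v′)

  word-reduced : ∀ x → IsReduced (word x)
  word-reduced x = len⇒reduced (trans (len-word x) (cong len (sym (··-word x))))

  -- Multiplication by a generator, on either side, reduced to what the Kazhdan-Lusztig arguments
  -- use: each of them is written once and serves for left and right.
  record Mirror : Set where
    field
      σ       : G → G
      σ-invol : ∀ x → σ (σ x) ≡ x
      σ-len   : ∀ x → len (σ x) ≡ suc (len x) ⊎ len x ≡ suc (len (σ x))

  open Mirror public

  left : Gen → Mirror
  left a = record { σ = a ·_ ; σ-invol = invol a ; σ-len = up-down a }

  right : Gen → Mirror
  right a = record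
    { σ = _∙ gen a
    ; σ-invol = λ x → trans (∙-assoc x (gen a) (gen a))
        (trans (cong (x ∙_) (trans (gen-∙ a (gen a)) (invol a e))) (∙e x))
    ; σ-len = λ x → subst₂ (λ p q → p ≡ suc q ⊎ q ≡ suc p)
        (trans (cong len (sym (inv-∙gen a x))) (len-inv (x ∙ gen a))) (len-inv x) (up-down a (inv x)) }

  -- inversions w x T counts mod 2 the letters of w which, applied along the way from x,
  -- amount to the right multiplication by T.
  inversions : Word → G → G → Bool
  inversions []      x T = false
  inversions (a ∷ w) x T = does ((w ·· x) ∙ T ≟ a · w ·· x) xor inversions w x T

  inversions-++ : ∀ u v x T → inversions (u ++ v) x T ≡ inversions u (v ·· x) T xor inversions v x T
  inversions-++ []      v x T = refl
  inversions-++ (a ∷ u) v x T rewrite ++-·· u v x | inversions-++ u v x T =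
    sym (Boolₚ.xor-assoc (does ((u ·· v ·· x) ∙ T ≟ a · u ·· v ·· x)) _ _)

  does-≟ : ∀ {p q p′ q′ : G} → (p ≡ q → p′ ≡ q′) → (p′ ≡ q′ → p ≡ q) → does (p ≟ q) ≡ does (p′ ≟ q′)
  does-≟ f g = does-⇔ (mk⇔ f g) (_ ≟ _) (_ ≟ _)

  -- Meant for `w` the longest element of a dihedral subgroup of order 8, which is central there.
  inversions-commuting : ∀ u w x T → All (λ a → ∀ y → w ·· a · y ≡ a · w ·· y) u →
    inversions u (w ·· x) T ≡ inversions u x T × u ·· w ·· x ≡ w ·· u ·· x
  inversions-commuting []      w x T [] = refl , refl
  inversions-commuting (a ∷ u) w x T (c ∷ cs) with inversions-commuting u w x T cs
  ... | p , q = cong₂ _xor_ (does-≟ (λ h → ··-injective w (trans (sym lhs) (trans h rhs)))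
                                    (λ h → trans lhs (trans (cong (w ··_) h) (sym rhs)))) p
              , rhs
    where
    lhs : (u ·· w ·· x) ∙ T ≡ w ·· ((u ·· x) ∙ T)
    lhs = trans (cong (_∙ T) q) (··-∙ w (u ·· x) T)
    rhs : a · u ·· w ·· x ≡ w ·· a · u ·· x
    rhs = trans (cong (a ·_) q) (sym (c (u ·· x)))

  -- The relator is the square of the central word `a b a b`; its two halves contribute equal
  -- counts, which cancel mod 2.
  inversions-relator : ∀ a b → (∀ x → a · b · a · b · x ≡ b · a · b · a · x) → ∀ x T →
    inversions (a ∷ b ∷ a ∷ b ∷ a ∷ b ∷ a ∷ b ∷ []) x T ≡ false
  inversions-relator a b br x T = trans (inversions-++ w w x T)
    (trans (cong (_xor inversions w x T) (proj₁ (inversions-commuting w w x T (ca ∷ cb ∷ ca ∷ cb ∷ []))))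
           (Boolₚ.xor-same (inversions w x T)))
    where
    w : Word
    w = a ∷ b ∷ a ∷ b ∷ []
    ca : ∀ y → w ·· a · y ≡ a · w ·· y
    ca y = cong (a ·_) (sym (br y))
    cb : ∀ y → w ·· b · y ≡ b · w ·· y
    cb y = br (b · y)

  -- The count depends only on the group element, so it may be computed from any factorisation;
  -- strong exchange rests on this cocycle.
  inversions-≈ : ∀ {u v} → u ≈ v → ∀ x T → inversions u x T ≡ inversions v x T
  inversions-≈ ≈-refl x T = refl
  inversions-≈ (≈-sym p) x T = sym (inversions-≈ p x T)
  inversions-≈ (≈-trans p q) x T = trans (inversions-≈ p x T) (inversions-≈ q x T)
  inversions-≈ (≈-cong {a} {b} {c} {d} p q) x T
    rewrite inversions-++ a c x T | inversions-++ b d x T | ··-≈ q x =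
    cong₂ _xor_ (inversions-≈ p (d ·· x) T) (inversions-≈ q x T)
  inversions-≈ (rel-sq a) x T = trans
    (cong (_xor (does (x ∙ T ≟ a · x) xor false)) (trans
      (does-≟ {p′ = x ∙ T} {q′ = a · x} (λ h → ·-injective a (trans (sym (·-∙ a x T)) h)) (λ h → trans (·-∙ a x T) (cong (a ·_) h)))
      (sym (Boolₚ.xor-identityʳ _))))
    (Boolₚ.xor-same (does (x ∙ T ≟ a · x) xor false))
  inversions-≈ rel-rt x T = trans
    (cong₂ (λ b c → b xor (c xor false))
      (does-≟ {p′ = x ∙ T} {q′ = r · x}
        (λ h → ·-injective t (trans (sym (·-∙ t x T)) (trans h rt)))
        (λ h → trans (·-∙ t x T) (trans (cong (t ·_) h) (sym rt))))
      (does-≟ {p′ = (r · x) ∙ T} {q′ = t · r · x}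
        (λ h → trans (·-∙ r x T) (trans (cong (r ·_) h) rt))
        (λ h → ·-injective r (trans (sym (·-∙ r x T)) (trans h (sym rt))))))
    (swap (does (x ∙ T ≟ r · x)) (does ((r · x) ∙ T ≟ t · r · x)))
    where
    rt : r · t · x ≡ t · r · x
    rt = ··-≈ rel-rt x
    swap : ∀ b c → b xor (c xor false) ≡ c xor (b xor false)
    swap true  true  = refl
    swap true  false = refl
    swap false true  = refl
    swap false false = refl
  inversions-≈ rel-rs x T = inversions-relator r s (λ x → ··-≈ (braid {[]} r s rel-rs) x) x T
  inversions-≈ rel-st x T = inversions-relator s t (λ x → ··-≈ (braid {[]} s t rel-st) x) x T

  -- Right translation by `y` conjugates `T`: the second hypothesis says `T′` = y⁻¹ T y without
  -- mentioning inverses.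
  inversions-right : ∀ u x y {T T′} → (∀ {p q} → p ∙ y ≡ q ∙ y → p ≡ q) → (x ∙ y) ∙ T′ ≡ (x ∙ T) ∙ y →
    inversions u (x ∙ y) T′ ≡ inversions u x T
  inversions-right [] x y inj h = refl
  inversions-right (a ∷ u) x y {T} {T′} inj h = cong₂ _xor_
    (does-≟ (λ k → inj (trans (sym lhs) (trans k rhs))) (λ k → trans lhs (trans (cong (_∙ y) k) (sym rhs))))
    (inversions-right u x y inj h)
    where
    lhs : (u ·· (x ∙ y)) ∙ T′ ≡ ((u ·· x) ∙ T) ∙ y
    lhs = trans (··-∙ u (x ∙ y) T′) (trans (cong (u ··_) h)
            (trans (sym (··-∙ u (x ∙ T) y)) (cong (_∙ y) (sym (··-∙ u x T)))))
    rhs : a · u ·· (x ∙ y) ≡ (a · u ·· x) ∙ y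
    rhs = sym (··-∙ (a ∷ u) x y)

  reflWord : Word → Gen → Word
  reflWord x a = x ++ a ∷ reverse x

  reflWord-∷ : ∀ b x a → reflWord (b ∷ x) a ≡ b ∷ (reflWord x a ++ b ∷ [])
  reflWord-∷ b x a = cong (b ∷_) (trans (cong (λ v → x ++ a ∷ v) (Listₚ.unfold-reverse b x))
    (sym (Listₚ.++-assoc x (a ∷ reverse x) (b ∷ []))))

  reflection-invol : ∀ x a → eval (reflWord x a) ∙ eval (reflWord x a) ≡ e
  reflection-invol x a rewrite eval-∙ (reflWord x a) (eval (reflWord x a))
    | ++-·· x (a ∷ reverse x) e | ++-·· x (a ∷ reverse x) (x ·· a · reverse x ·· e)
    | reverse-·· x (a · reverse x ·· e) | invol a (reverse x ·· e) = ··-reverse x e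

  involution-cancelʳ : ∀ {y} → y ∙ y ≡ e → ∀ {p q} → p ∙ y ≡ q ∙ y → p ≡ q
  involution-cancelʳ {y} yy {p} {q} h = trans (sym (undo p)) (trans (cong (_∙ y) h) (undo q))
    where
    undo : ∀ p → (p ∙ y) ∙ y ≡ p
    undo p = trans (∙-assoc p y y) (trans (cong (p ∙_) yy) (∙e p))

  gen∙gen : ∀ b → gen b ∙ gen b ≡ e
  gen∙gen b = trans (gen-∙ b (gen b)) (invol b e)

  -- The word is a palindrome. Its two outermost letters `b` test the same equation `T′` = b and
  -- cancel; the inside is a shorter reflection translated by `b`, down to the middle letter, which
  -- counts once.
  reflection-inverts-itself : ∀ x a → inversions (reflWord x a) e (eval (reflWord x a)) ≡ true
  reflection-inverts-itself [] a = trans (Boolₚ.xor-identityʳ _) (dec-true (e ∙ gen a ≟ gen a) (e∙ (gen a)))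
  reflection-inverts-itself (b ∷ x) a = subst (λ v → inversions v e (eval v) ≡ true) (sym (reflWord-∷ b x a))
    (trans (cong (does (U ∙ T′ ≟ b · U) xor_) (inversions-++ W (b ∷ []) e T′))
    (trans (cong₂ (λ p q → p xor (q xor (does (e ∙ T′ ≟ gen b) xor false))) outer inner)
    (cancel-ends (does (e ∙ T′ ≟ gen b)))))
    where
    W : Word
    W = reflWord x a
    T U T′ : G
    T = eval W
    U = (W ++ b ∷ []) ·· e
    T′ = b · U
    U≡ : U ≡ T ∙ gen b
    U≡ = trans (++-·· W (b ∷ []) e) (sym (eval-∙ W (gen b)))
    UT′ : U ∙ T′ ≡ gen b
    UT′ = trans (cong (_∙ T′) U≡) (trans (∙-assoc T (gen b) T′)
      (trans (cong (T ∙_) (trans (gen-∙ b T′) (trans (invol b U) U≡)))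
      (trans (sym (∙-assoc T T (gen b))) (trans (cong (_∙ gen b) (reflection-invol x a)) (e∙ (gen b))))))
    outer : does (U ∙ T′ ≟ b · U) ≡ does (e ∙ T′ ≟ gen b)
    outer = does-≟ (λ h → trans (e∙ T′) (trans (sym h) UT′)) (λ h → trans UT′ (trans (sym h) (e∙ T′)))
    inner : inversions W (gen b) T′ ≡ true
    inner = trans (cong (λ g → inversions W g T′) (sym (e∙ (gen b))))
      (trans (inversions-right W e (gen b) (involution-cancelʳ (gen∙gen b))
        (trans (cong (_∙ T′) (e∙ (gen b))) (trans (gen-∙ b T′) (trans (invol b U)
          (trans U≡ (cong (_∙ gen b) (sym (e∙ T))))))))
        (reflection-inverts-itself x a))
    cancel-ends : ∀ c → c xor (true xor (c xor false)) ≡ true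
    cancel-ends true  = refl
    cancel-ends false = refl

  -- An odd count means that some letter amounts to right multiplication by `T`; omitting that
  -- letter realises the product.
  deletion : ∀ w T → inversions w e T ≡ true → Σ Word λ w′ → suc (length w′) ≡ length w × eval w′ ≡ eval w ∙ T
  exchange : ∀ a w T → inversions (a ∷ w) e T ≡ true →
    eval w ∙ T ≡ a · eval w ⊎ Σ Word λ w′ → suc (length w′) ≡ length w × eval w′ ≡ eval w ∙ T

  exchange a w T h with eval w ∙ T ≟ a · eval w
  ... | yes p = inj₁ p
  ... | no ¬p = inj₂ (deletion w T h)

  deletion (a ∷ w) T h with exchange a w T h
  ... | inj₁ p = w , refl , sym (trans (·-∙ a (eval w) T) (trans (cong (a ·_) p) (invol a (eval w))))
  ... | inj₂ (w′ , p , q) = a ∷ w′ , cong suc p , trans (cong (a ·_) q) (sym (·-∙ a (eval w) T))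

  IsReflection : G → Set
  IsReflection T = Σ Word λ x → Σ Gen λ a → T ≡ eval (reflWord x a)

  -- Since `T` inverts itself, the cocycle makes `T` an inversion of w T when it is none of w.
  -- Deleting a letter from a reduced word of w T then yields a shorter word for w T T = w.
  not-inverted : ∀ w T → IsReflection T → inversions w e T ≡ false → len (eval w) < len (eval w ∙ T)
  not-inverted w _ (x , a , refl) h with deletion (word (eval w ∙ T)) T inverted
    where
    T = eval (reflWord x a)
    inverted : inversions (word (eval w ∙ T)) e T ≡ true
    inverted = trans (inversions-≈ (≈-trans (≡⇒≈ (cong word (trans (eval-∙ w T) (sym (++-·· w (reflWord x a) e)))))
                                            (word-eval (w ++ reflWord x a))) e T)
      (trans (inversions-++ w (reflWord x a) e T)
      (trans (cong₂ _xor_ (trans (cong (λ g → inversions w g T) (sym (e∙ T)))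
               (trans (inversions-right w e T (involution-cancelʳ (reflection-invol x a)) refl) h))
               (reflection-inverts-itself x a)) refl))
  ... | w′ , p , q = ℕₚ.≤-trans (s≤s (ℕₚ.≤-trans (ℕₚ.≤-reflexive (cong len (sym (trans q undo)))) (len-eval w′)))
                       (ℕₚ.≤-reflexive (trans p (len-word _)))
    where
    T = eval (reflWord x a)
    undo : eval (word (eval w ∙ T)) ∙ T ≡ eval w
    undo = trans (cong (_∙ T) (··-word _)) (trans (∙-assoc (eval w) T T)
             (trans (cong (eval w ∙_) (reflection-invol x a)) (∙e (eval w))))

-- Bruhat order: lifting, decidability, stability of descents, balls.

module Bruhat (M : Model) where
  open Model M
  open Group M

  infix 4 _≼_

  Step : G → G → Set
  Step x y = Σ G λ T → IsReflection T × y ≡ x ∙ T × len x < len y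

  _≼_ : G → G → Set
  _≼_ = Star Step

  asc∧desc : ∀ {m n} → m ≡ suc n → n ≡ suc m → ⊥
  asc∧desc refl ()

  asc-· : ∀ {a x} → Desc a x → Asc a (a · x)
  asc-· {a} {x} d = trans (cong len (invol a x)) d

  desc-· : ∀ {a x} → Asc a x → Desc a (a · x)
  desc-· {a} {x} u = trans u (cong (λ y → suc (len y)) (sym (invol a x)))

  -- If the word a x inverts `T`, exchange can only strike the letter `a`, giving a x = y: striking
  -- a letter of x would make x T shorter than x.
  step-lift : ∀ {x y} → Step x y → ∀ a → a · x ≡ y ⊎ Step (a · x) (a · y)
  step-lift {x} {y} (T , T-refl , y≡xT , x<y) a with inversions (a ∷ word x) e T in h
  ... | false = inj₂ (T , T-refl , trans (cong (a ·_) y≡xT) (sym (·-∙ a x T)) ,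
          subst₂ (λ p q → len p < len q) (cong (a ·_) (··-word x))
            (trans (cong (λ p → (a · p) ∙ T) (··-word x)) (trans (·-∙ a x T) (cong (a ·_) (sym y≡xT))))
            (not-inverted (a ∷ word x) T T-refl h))
  ... | true with exchange a (word x) T h
  ...   | inj₁ p = inj₁ (sym (trans y≡xT (trans (cong (_∙ T) (sym (··-word x))) (trans p (cong (a ·_) (··-word x))))))
  ...   | inj₂ (w , p , q) = ⊥-elim (ℕₚ.<-irrefl refl (ℕₚ.<-trans x<y
            (ℕₚ.≤-<-trans (ℕₚ.≤-reflexive (cong len (trans y≡xT (trans (cong (_∙ T) (sym (··-word x))) (sym q)))))
            (ℕₚ.≤-<-trans (len-eval w) (ℕₚ.≤-reflexive (trans p (len-word x)))))))

  -- The reflection is w⁻¹ a w, because (a w)(w⁻¹ a w) = w.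
  down-step : ∀ {a w} → Desc a w → Step (a · w) w
  down-step {a} {w} d = T , (reverse (word w) , a , refl) , sym product , ℕₚ.≤-reflexive (sym d)
    where
    T = eval (reflWord (reverse (word w)) a)
    product : (a · w) ∙ T ≡ w
    product = trans (·-∙ a w T) (trans (cong (a ·_) (trans (cong (word w ··_) (++-·· (reverse (word w)) _ e))
      (trans (··-reverse (word w) _) (cong (λ v → a · v ·· e) (Listₚ.reverse-involutive (word w))))))
      (trans (cong (λ v → a · a · v) (··-word w)) (invol a w)))

  ≼-len : ∀ {x w} → x ≼ w → len x ≤ len w
  ≼-len ε = ℕₚ.≤-refl
  ≼-len ((_ , _ , _ , lt) ◅ p) = ℕₚ.≤-trans (ℕₚ.<⇒≤ lt) (≼-len p)

  ≼-len-≡ : ∀ {x w} → x ≼ w → len w ≤ len x → x ≡ w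
  ≼-len-≡ ε _ = refl
  ≼-len-≡ ((_ , _ , _ , lt) ◅ p) h = ⊥-elim (ℕₚ.<-irrefl refl (ℕₚ.<-≤-trans lt (ℕₚ.≤-trans (≼-len p) h)))

  ≼-down : ∀ {a x w} → x ≼ w → Desc a w → a · x ≼ w
  ≼-down ε d = down-step d ◅ ε
  ≼-down {a} (st ◅ p) d with step-lift st a
  ... | inj₁ refl = p
  ... | inj₂ st′  = st′ ◅ ≼-down p d

  -- The lifting property. The two halves follow a chain from `x` to `w` and pass into each other
  -- according to whether `a` is a descent of its next element.
  lift-asc : ∀ {a x w} → x ≼ w → Asc a x → Desc a w → x ≼ a · w
  lift-desc : ∀ {a x w} → x ≼ w → Desc a x → Desc a w → a · x ≼ a · w

  lift-asc ε u d = ⊥-elim (asc∧desc u d)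
  lift-asc {a} {x} (_◅_ {j = y} st p) u d with up-down a y
  ... | inj₁ uy = st ◅ lift-asc p uy d
  ... | inj₂ dy with step-lift st a
  ...   | inj₁ ax≡y = subst (_≼ _) (trans (cong (a ·_) (sym ax≡y)) (invol a x)) (lift-desc p dy d)
  ...   | inj₂ st′  = subst (λ v → Step v (a · x)) (invol a x) (down-step (desc-· u)) ◅ st′ ◅ lift-desc p dy d

  lift-desc ε dx d = ε
  lift-desc {a} {x} (_◅_ {j = y} st@(_ , _ , _ , x<y) p) dx d with up-down a y
  ... | inj₁ uy = down-step dx ◅ st ◅ lift-asc p uy d
  ... | inj₂ dy with step-lift st a
  ...   | inj₁ ax≡y = ⊥-elim (ℕₚ.<-asym x<y (ℕₚ.≤-reflexive (trans (cong (λ v → suc (len v)) (sym ax≡y)) (sym dx))))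
  ...   | inj₂ st′  = st′ ◅ lift-desc p dy d

  has-descent : ∀ w {n} → len w ≡ suc n → ∃ λ a → Desc a w
  has-descent w h with word w | len-word w | ··-word w
  ... | [] | p | q with trans p h
  ...   | ()
  has-descent w h | a ∷ u | p | q with up-down a w
  ... | inj₂ d  = a , d
  ... | inj₁ up = ⊥-elim (ℕₚ.<-irrefl refl (ℕₚ.<-trans (ℕₚ.≤-reflexive (sym up))
      (ℕₚ.≤-<-trans (ℕₚ.≤-reflexive (cong len (trans (cong (a ·_) (sym q)) (invol a (eval u)))))
      (ℕₚ.≤-<-trans (len-eval u) (ℕₚ.≤-reflexive p)))))

  len-0 : ∀ {w} → len w ≡ 0 → w ≡ e
  len-0 {w} h with word w | len-word w | ··-word w
  ... | []    | _ | q = sym q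
  ... | _ ∷ _ | p | _ with trans p h
  ...   | ()

  private
    -- By lifting, the question for w reduces to one for a w, asked of the shorter of x and a x.
    ≼-dec : ∀ n x w → len w ≡ n → Dec (x ≼ w)
    ≼-dec zero x w h = map′ (λ { refl → ε }) (λ p → ≼-len-≡ p (ℕₚ.≤-trans (ℕₚ.≤-reflexive h) z≤n)) (x ≟ w)
    ≼-dec (suc n) x w h with has-descent w h
    ... | a , d with up-down a x | ℕₚ.suc-injective (trans (sym d) h)
    ...   | inj₁ u  | h′ = map′ (λ p → p ◅◅ (down-step d ◅ ε)) (λ p → lift-asc p u d) (≼-dec n x (a · w) h′)
    ...   | inj₂ dx | h′ = map′ (λ p → subst (_≼ w) (invol a x) (≼-down (p ◅◅ (down-step d ◅ ε)) d))
                              (λ p → lift-desc p dx d) (≼-dec n (a · x) (a · w) h′)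

  _≼?_ : ∀ x w → Dec (x ≼ w)
  x ≼? w = ≼-dec (len w) x w refl

  ≼⇒≤B : ∀ {x w u v} → eval u ≡ x → eval v ≡ w → x ≼ w → u ≤B v
  ≼⇒≤B p q ε = inj₁ (eval-injective (trans p (sym q))) ◅ ε
  ≼⇒≤B {x} {w} {u} p q (_◅_ {j = y} (_ , (z , a , refl) , y≡ , lt) st) =
    inj₂ (z , a , eval-injective (trans (··-word y) (trans y≡ (trans (cong (_∙ eval (reflWord z a)) (sym p))
          (trans (eval-∙ u _) (sym (++-·· u (reflWord z a) e)))))) ,
         (word x , word y , word-reduced x , word-reduced y , eval-injective (trans (··-word x) (sym p)) , ≈-refl ,
          subst₂ _<_ (sym (len-word x)) (sym (len-word y)) lt))
    ◅ ≼⇒≤B (··-word y) q st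

  <ℓ⇒len< : ∀ {u v} → u <ℓ v → len (eval u) < len (eval v)
  <ℓ⇒len< (u′ , v′ , ru , rv , pu , pv , lt) =
    subst₂ _<_ (trans (reduced⇒len ru) (cong len (eval-≈ pu))) (trans (reduced⇒len rv) (cong len (eval-≈ pv))) lt

  ≤B⇒≼ : ∀ {u v} → u ≤B v → eval u ≼ eval v
  ≤B⇒≼ ε = ε
  ≤B⇒≼ {v = v} (inj₁ p ◅ q) = subst (_≼ eval v) (sym (eval-≈ p)) (≤B⇒≼ q)
  ≤B⇒≼ {u} (inj₂ (z , a , p , lt) ◅ q) =
    (eval (reflWord z a) , (z , a , refl) ,
     trans (eval-≈ p) (trans (++-·· u (reflWord z a) e) (sym (eval-∙ u _))) , <ℓ⇒len< lt) ◅ ≤B⇒≼ q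

  LDesc⇒Desc : ∀ {a v} → LDesc a v → Desc a (eval v)
  LDesc⇒Desc {a} {v} (le , ne) with up-down a (eval v)
  ... | inj₂ d = d
  ... | inj₁ u = ⊥-elim (ne (eval-injective (≼-len-≡ (≤B⇒≼ le) (ℕₚ.≤-trans (ℕₚ.n≤1+n _) (ℕₚ.≤-reflexive (sym u))))))

  Desc⇒LDesc : ∀ {a v} → Desc a (eval v) → LDesc a v
  Desc⇒LDesc {a} {v} d = ≼⇒≤B refl refl (down-step d ◅ ε) ,
    λ p → ℕₚ.1+n≢n (trans (sym d) (cong len (sym (eval-≈ p))))

  -- If a x > x and x b > x but a x b < x b, then exchanging a letter of the reduced word of a x against b can only remove a.
  square : ∀ {a b x} → Asc a x → len (x ∙ gen b) ≡ suc (len x) → Desc a (x ∙ gen b) → a · x ≡ x ∙ gen b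
  square {a} {b} {x} ua ub d with inversions (a ∷ word x) e (gen b) in h
  ... | false = ⊥-elim (ℕₚ.<-irrefl refl (ℕₚ.<-trans
          (ℕₚ.<-≤-trans (ℕₚ.n<1+n _) (ℕₚ.≤-reflexive (trans (sym ua) (cong (λ v → len (a · v)) (sym (··-word x))))))
          (ℕₚ.<-≤-trans (not-inverted (a ∷ word x) (gen b) ([] , b , refl) h)
            (ℕₚ.≤-reflexive (trans (cong len (trans (cong (λ v → (a · v) ∙ gen b) (··-word x)) (·-∙ a x (gen b))))
              (ℕₚ.suc-injective (trans (sym d) ub)))))))
  ... | true with exchange a (word x) (gen b) h
  ...   | inj₁ p = sym (trans (cong (_∙ gen b) (sym (··-word x))) (trans p (cong (a ·_) (··-word x))))
  ...   | inj₂ (w , p , q) = ⊥-elim (ℕₚ.<-irrefl refl (ℕₚ.<-trans (ℕₚ.≤-reflexive (sym ub))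
            (ℕₚ.≤-<-trans (ℕₚ.≤-reflexive (cong len (trans (cong (_∙ gen b) (sym (··-word x))) (sym q))))
            (ℕₚ.≤-<-trans (len-eval w) (ℕₚ.≤-reflexive (trans p (len-word x)))))))

  ·-right : ∀ a b x → a · (x ∙ gen b) ≡ (a · x) ∙ gen b
  ·-right a b x = sym (·-∙ a x (gen b))

  right-invol : ∀ b x → (x ∙ gen b) ∙ gen b ≡ x
  right-invol b x = σ-invol (right b) x

  -- If x b is longer than x this is `square`. If it is shorter, a lost ascent would make the
  -- lengths of a x and a x b differ by three, although these elements differ by a generator.
  left-asc-stable : ∀ {a b x} → a · x ≢ x ∙ gen b → Asc a x → Asc a (x ∙ gen b)
  left-asc-stable {a} {b} {x} ne u with up-down a (x ∙ gen b)
  ... | inj₁ u′ = u′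
  ... | inj₂ d with σ-len (right b) x
  ...   | inj₁ ub = ⊥-elim (ne (square u ub d))
  ...   | inj₂ db with σ-len (right b) (a · x)
  ...     | inj₁ p = ⊥-elim (far p)
    where
    far : len ((a · x) ∙ gen b) ≡ suc (len (a · x)) → ⊥
    far p rewrite sym (·-right a b x) | u | db | d = ℕₚ.<-irrefl p (ℕₚ.m≤n⇒m≤1+n (ℕₚ.m≤n⇒m≤1+n (ℕₚ.m≤n⇒m≤1+n ℕₚ.≤-refl)))
  ...     | inj₂ p = ⊥-elim (far p)
    where
    far : len (a · x) ≡ suc (len ((a · x) ∙ gen b)) → ⊥
    far p rewrite sym (·-right a b x) | u | db | d = ℕₚ.<-irrefl (sym p) (ℕₚ.m≤n⇒m≤1+n ℕₚ.≤-refl)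

  left-desc-stable : ∀ {a b x} → a · x ≢ x ∙ gen b → Desc a x → Desc a (x ∙ gen b)
  left-desc-stable {a} {b} {x} ne d with up-down a (x ∙ gen b)
  ... | inj₂ d′ = d′
  ... | inj₁ u  = ⊥-elim (asc∧desc (subst (Asc a) (right-invol b x) (left-asc-stable ne′ u)) d)
    where
    ne′ : a · (x ∙ gen b) ≢ (x ∙ gen b) ∙ gen b
    ne′ p = ne (trans (sym (right-invol b (a · x))) (cong (_∙ gen b) (trans (sym (·-right a b x)) (trans p (right-invol b x)))))

  ball : ℕ → List G
  ball zero    = e ∷ []
  ball (suc n) = deduplicate _≟_ (ball n ++ map (r ·_) (ball n) ++ map (s ·_) (ball n) ++ map (t ·_) (ball n))

  ball-unique : ∀ n → Unique (ball n)
  ball-unique zero    = [] ∷ []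
  ball-unique (suc n) = deduplicate-! _≟_ _

  neighbour-∈ : ∀ {x} B a → x ∈ B → a · x ∈ B ++ map (r ·_) B ++ map (s ·_) B ++ map (t ·_) B
  neighbour-∈ B r p = ∈-++⁺ʳ B (∈-++⁺ˡ (∈-map⁺ (r ·_) p))
  neighbour-∈ B s p = ∈-++⁺ʳ B (∈-++⁺ʳ (map (r ·_) B) (∈-++⁺ˡ (∈-map⁺ (s ·_) p)))
  neighbour-∈ B t p = ∈-++⁺ʳ B (∈-++⁺ʳ (map (r ·_) B) (∈-++⁺ʳ (map (s ·_) B) (∈-map⁺ (t ·_) p)))

  ball-complete : ∀ n {x} → len x ≤ n → x ∈ ball n
  ball-complete zero h = here (len-0 (ℕₚ.n≤0⇒n≡0 h))
  ball-complete (suc n) {x} h with ℕₚ.m≤n⇒m<n∨m≡n h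
  ... | inj₁ lt = ∈-deduplicate⁺ _≟_ (∈-++⁺ˡ (ball-complete n (ℕₚ.≤-pred lt)))
  ... | inj₂ eq with has-descent x eq
  ...   | a , d = ∈-deduplicate⁺ _≟_ (subst (_∈ _) (invol a x)
            (neighbour-∈ (ball n) a (ball-complete n (ℕₚ.≤-reflexive (ℕₚ.suc-injective (trans (sym d) eq))))))

  len-· : ∀ a x → len (a · x) ≤ suc (len x)
  len-· a x with up-down a x
  ... | inj₁ u = ℕₚ.≤-reflexive u
  ... | inj₂ d = ℕₚ.≤-trans (ℕₚ.n≤1+n _) (ℕₚ.≤-trans (ℕₚ.≤-reflexive (sym d)) (ℕₚ.n≤1+n _))

  ball-sound : ∀ n {x} → x ∈ ball n → len x ≤ n
  ball-sound zero (here refl) = ℕₚ.≤-reflexive len-e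
  ball-sound (suc n) {x} p with ∈-++⁻ (ball n) (∈-deduplicate⁻ _≟_ (ball n ++ _) p)
  ... | inj₁ q = ℕₚ.m≤n⇒m≤1+n (ball-sound n q)
  ... | inj₂ q = [ image r , (λ q′ → [ image s , image t ]′ (∈-++⁻ (map (s ·_) (ball n)) q′)) ]′ (∈-++⁻ (map (r ·_) (ball n)) q)
    where
    image : ∀ a → x ∈ map (a ·_) (ball n) → len x ≤ suc n
    image a m with ∈-map⁻ (a ·_) m
    ... | y , y∈ , refl = ℕₚ.≤-trans (len-· a y) (s≤s (ball-sound n y∈))

-- Coefficient sequences, parity of length differences, finite sums.

δ : Poly
δ k = if k ≡ᵇ 0 then 1ℤ else 0ℤ

shift-cong : ∀ m {f g : Poly} → (∀ k → f k ≡ g k) → ∀ k → shift m f k ≡ shift m g k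
shift-cong zero    h k       = h k
shift-cong (suc m) h zero    = refl
shift-cong (suc m) h (suc k) = shift-cong m h k

shift-zero : ∀ m {f : Poly} → (∀ k → f k ≡ 0ℤ) → ∀ k → shift m f k ≡ 0ℤ
shift-zero zero    h k       = h k
shift-zero (suc m) h zero    = refl
shift-zero (suc m) h (suc k) = shift-zero m h k

shift-+ : ∀ m (f g : Poly) k → shift m (λ k → f k + g k) k ≡ shift m f k + shift m g k
shift-+ zero    f g k       = refl
shift-+ (suc m) f g zero    = refl
shift-+ (suc m) f g (suc k) = shift-+ m f g k

shift-minus : ∀ m (f g : Poly) k → shift m (λ k → f k - g k) k ≡ shift m f k - shift m g k
shift-minus zero    f g k       = refl
shift-minus (suc m) f g zero    = refl
shift-minus (suc m) f g (suc k) = shift-minus m f g k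

shift-* : ∀ m c (f : Poly) k → shift m (λ k → c * f k) k ≡ c * shift m f k
shift-* zero    c f k       = refl
shift-* (suc m) c f zero    = sym (ℤₚ.*-zeroʳ c)
shift-* (suc m) c f (suc k) = shift-* m c f k

shift-shift : ∀ m n (f : Poly) k → shift m (shift n f) k ≡ shift (m ℕ.+ n) f k
shift-shift zero    n f k       = refl
shift-shift (suc m) n f zero    = refl
shift-shift (suc m) n f (suc k) = shift-shift m n f k

shift-≥ : ∀ m (f : Poly) k → shift m f (m ℕ.+ k) ≡ f k
shift-≥ zero    f k = refl
shift-≥ (suc m) f k = shift-≥ m f k

shift-swap : ∀ c d (f : Poly) k → shift 1 (λ k → c * shift d f k) k ≡ c * shift d (shift 1 f) k
shift-swap c d f k = trans (shift-* 1 c (shift d f) k) (cong (c *_) (trans (shift-shift 1 d f k)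
  (trans (cong (λ n → shift n f k) (ℕₚ.+-comm 1 d)) (sym (shift-shift d 1 f k)))))

shift-elim : ∀ {P : ℤ → Set} m (f : Poly) k → P 0ℤ → (∀ k′ → k ≡ m ℕ.+ k′ → P (f k′)) → P (shift m f k)
shift-elim zero    f k       z h = h k refl
shift-elim (suc m) f zero    z h = z
shift-elim {P} (suc m) f (suc k) z h = shift-elim {P} m f k z (λ k′ e → h k′ (cong suc e))

data Parity : ℕ → Set where
  even : ∀ d → Parity (d ℕ.+ d)
  odd  : ∀ d → Parity (suc (d ℕ.+ d))

parity : ∀ n → Parity n
parity zero = even 0
parity (suc n) with parity n
... | even d = odd d
... | odd d  = subst Parity (cong suc (ℕₚ.+-suc d d)) (even (suc d))

isOdd-double : ∀ d → isOdd (d ℕ.+ d) ≡ false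
isOdd-double zero = refl
isOdd-double (suc d) rewrite ℕₚ.+-suc d d = isOdd-double d

isOdd-suc-double : ∀ d → isOdd (suc (d ℕ.+ d)) ≡ true
isOdd-suc-double zero = refl
isOdd-suc-double (suc d) rewrite ℕₚ.+-suc d d = isOdd-suc-double d

half-odd : ∀ d → ⌊ suc (d ℕ.+ d) /2⌋ ≡ d
half-odd d = sym (ℕₚ.n≡⌈n+n/2⌉ d)

∸-odd : ∀ {v z} d → v ≡ suc (d ℕ.+ d) ℕ.+ z → v ∸ z ≡ suc (d ℕ.+ d)
∸-odd {z = z} d refl = ℕₚ.m+n∸n≡m (suc (d ℕ.+ d)) z

-- The exponent (l(w) - l(z))/2 of the recursion has l(w) = l(v) + 1, so it exceeds by one the
-- degree that defines μ(z,v).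
half-correction : ∀ {v z} d → v ≡ suc (d ℕ.+ d) ℕ.+ z → ⌊ suc v ∸ z /2⌋ ≡ suc d
half-correction {z = z} d refl = trans (cong ⌊_/2⌋ (ℕₚ.m+n∸n≡m (suc (suc (d ℕ.+ d))) z))
  (cong suc (sym (ℕₚ.n≡⌊n+n/2⌋ d)))

module _ {A : Set} where
  sum : List A → (A → ℤ) → ℤ
  sum []       f = 0ℤ
  sum (z ∷ zs) f = f z + sum zs f

  sum-cong : ∀ zs {f g : A → ℤ} → (∀ z → f z ≡ g z) → sum zs f ≡ sum zs g
  sum-cong []       h = refl
  sum-cong (z ∷ zs) h = cong₂ _+_ (h z) (sum-cong zs h)

  sum-zero : ∀ zs {f : A → ℤ} → (∀ z → z ∈ zs → f z ≡ 0ℤ) → sum zs f ≡ 0ℤ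
  sum-zero []       h = refl
  sum-zero (z ∷ zs) h = cong₂ _+_ (h z (here refl)) (sum-zero zs (λ y m → h y (there m)))

  sum-+ : ∀ zs (f g : A → ℤ) → sum zs (λ z → f z + g z) ≡ sum zs f + sum zs g
  sum-+ []       f g = refl
  sum-+ (z ∷ zs) f g = trans (cong (f z + g z +_) (sum-+ zs f g)) (lem (f z) (g z) (sum zs f) (sum zs g))
    where
    lem : ∀ a b c d → a + b + (c + d) ≡ a + c + (b + d)
    lem = solve-∀

  sum-* : ∀ zs c (f : A → ℤ) → sum zs (λ z → c * f z) ≡ c * sum zs f
  sum-* []       c f = sym (ℤₚ.*-zeroʳ c)
  sum-* (z ∷ zs) c f = trans (cong (c * f z +_) (sum-* zs c f)) (sym (ℤₚ.*-distribˡ-+ c (f z) (sum zs f)))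

  sum-single : ∀ {zs} → Unique zs → ∀ {f : A → ℤ} x → (∀ z → z ∈ zs → z ≢ x → f z ≡ 0ℤ) →
    x ∈ zs ⊎ (f x ≡ 0ℤ × ¬ x ∈ zs) → sum zs f ≡ f x
  sum-single {zs} u {f} x h (inj₂ (p , x∉)) = trans (sum-zero zs (λ z m → h z m (λ { refl → x∉ m }))) (sym p)
  sum-single (px ∷ u) {f} x h (inj₁ (here refl)) =
    trans (cong (f x +_) (sum-zero _ (λ z m → h z (there m) (λ { refl → All.lookup px m refl })))) (ℤₚ.+-identityʳ (f x))
  sum-single (px ∷ u) {f} x h (inj₁ (there m)) =
    trans (cong₂ _+_ (h _ (here refl) (λ { refl → All.lookup px m refl }))
      (sum-single u x (λ z m′ → h z (there m′)) (inj₁ m))) (ℤₚ.+-identityˡ (f x))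

  shift-sum : ∀ m zs (f : A → Poly) k → shift m (λ k → sum zs (λ z → f z k)) k ≡ sum zs (λ z → shift m (f z) k)
  shift-sum m []       f k = shift-zero m (λ _ → refl) k
  shift-sum m (z ∷ zs) f k = trans (shift-+ m (f z) (λ k → sum zs (λ y → f y k)) k)
    (cong (shift m (f z) k +_) (shift-sum m zs f k))

-- Kazhdan-Lusztig theory on the left: recursion, invariance, degree bound.

module KL (M : Model) (P : Word → Word → Poly) (K : IsKL P) where
  open Model M
  open Group M
  open Bruhat M
  open IsKL K

  -- `F w` is C_w, up to a power of q, as a function of x; its indices stand in the opposite order
  -- to those of `P`.
  F : G → G → Poly
  F w x = P (word x) (word w)

  F-vanish : ∀ {x w} → ¬ x ≼ w → ∀ k → F w x k ≡ 0ℤ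
  F-vanish {x} {w} h = vanish (word x) (word w) (λ le → h (subst₂ _≼_ (··-word x) (··-word w) (≤B⇒≼ le)))

  F-short : ∀ {x w} → len w ≤ len x → x ≢ w → ∀ k → F w x k ≡ 0ℤ
  F-short h ne = F-vanish (λ le → ne (≼-len-≡ le h))

  μ : G → G → ℤ
  μ z v = mu P (word z) (word v)

  μ-def : ∀ z v → μ z v ≡ (if isOdd (len v ∸ len z) then F v z ⌊ len v ∸ len z /2⌋ else 0ℤ)
  μ-def z v = cong₂ (λ m n → if isOdd (m ∸ n) then F v z ⌊ m ∸ n /2⌋ else 0ℤ) (len-word v) (len-word z)

  -- Here `d` is the degree whose coefficient is μ(z,v); an equation between lengths avoids
  -- truncated subtraction.
  OddGap : G → G → ℕ → Set
  OddGap z v d = len v ≡ suc (d ℕ.+ d) ℕ.+ len z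

  μ-odd : ∀ {z v} d → OddGap z v d → μ z v ≡ F v z d
  μ-odd {z} {v} d h = trans (μ-def z v) (trans
    (cong (λ n → if isOdd n then F v z ⌊ n /2⌋ else 0ℤ) (∸-odd d h))
    (cong₂ (λ b m → if b then F v z m else 0ℤ) (isOdd-suc-double d) (half-odd d)))

  μ-view : ∀ z v → μ z v ≡ 0ℤ ⊎ ∃ (OddGap z v)
  μ-view z v = go _ refl (parity _)
    where
    go : ∀ n → len v ∸ len z ≡ n → Parity n → μ z v ≡ 0ℤ ⊎ ∃ (OddGap z v)
    go _ eq (even d) = inj₁ (trans (μ-def z v) (trans
      (cong (λ n → if isOdd n then F v z ⌊ n /2⌋ else 0ℤ) eq)
      (cong (λ b → if b then F v z ⌊ d ℕ.+ d /2⌋ else 0ℤ) (isOdd-double d))))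
    go _ eq (odd d) = inj₂ (d , trans (sym (ℕₚ.m∸n+n≡m {len v} {len z}
      (ℕₚ.<⇒≤ (ℕₚ.m∸n≢0⇒n<m (λ p → ℕₚ.0≢1+n (trans (sym p) eq)))))) (cong (ℕ._+ len z) eq))

  μ-gap : ∀ {z v} d → OddGap z v d → len z < len v
  μ-gap {z} {v} d h = ℕₚ.≤-trans (s≤s (ℕₚ.m≤n+m (len z) (d ℕ.+ d))) (ℕₚ.≤-reflexive (sym h))

  Down Up : Mirror → G → Set
  Down m x = len x ≡ suc (len (σ m x))
  Up   m x = len (σ m x) ≡ suc (len x)

  pick : {A : Set} → Mirror → G → A → A → A
  pick m x d u = [ (λ _ → u) , (λ _ → d) ]′ (σ-len m x)

  pick-down : ∀ {A : Set} {m x} {d u : A} → Down m x → pick m x d u ≡ d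
  pick-down {m = m} {x} h with σ-len m x
  ... | inj₁ h′ = ⊥-elim (asc∧desc h′ h)
  ... | inj₂ _  = refl

  pick-up : ∀ {A : Set} {m x} {d u : A} → Up m x → pick m x d u ≡ u
  pick-up {m = m} {x} h with σ-len m x
  ... | inj₂ h′ = ⊥-elim (asc∧desc h h′)
  ... | inj₁ _  = refl

  pick-elim : ∀ {A : Set} (Q : A → Set) m x {d u : A} → (Down m x → Q d) → (Up m x → Q u) → Q (pick m x d u)
  pick-elim Q m x hd hu with σ-len m x
  ... | inj₁ h = hu h
  ... | inj₂ h = hd h

  down-σ : ∀ m {x} → Up m x → Down m (σ m x)
  down-σ m {x} u = trans u (cong (λ y → suc (len y)) (sym (σ-invol m x)))

  up-σ : ∀ m {x} → Down m x → Up m (σ m x)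
  up-σ m {x} d = trans (cong len (σ-invol m x)) d

  σ-swap : ∀ m {x y} → σ m x ≡ y → x ≡ σ m y
  σ-swap m {x} p = trans (sym (σ-invol m x)) (cong (σ m) p)

  -- The product of the sum of all f(x) T_x with T_a + 1 in the Hecke algebra, on the side of the
  -- mirror: the two branches are the coefficients of T_x when the mirror shortens x and when it
  -- lengthens x.
  op : Mirror → (G → Poly) → G → Poly
  op m f x k = pick m x (f (σ m x) k + shift 1 (f x) k) (shift 1 (f (σ m x)) k + f x k)

  op-down : ∀ m f {x} k → Down m x → op m f x k ≡ f (σ m x) k + shift 1 (f x) k
  op-down m f k d = pick-down {m = m} d

  op-up : ∀ m f {x} k → Up m x → op m f x k ≡ shift 1 (f (σ m x)) k + f x k
  op-up m f k u = pick-up {m = m} u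

  op-invariant : ∀ m f x k → op m f (σ m x) k ≡ op m f x k
  op-invariant m f x k with σ-len m x
  ... | inj₁ u = trans (op-down m f k (down-σ m u))
        (trans (cong (λ y → f y k + shift 1 (f (σ m x)) k) (σ-invol m x)) (ℤₚ.+-comm (f x k) _))
  ... | inj₂ d = trans (op-up m f k (up-σ m d))
        (trans (cong (λ y → shift 1 (f y) k + f (σ m x) k) (σ-invol m x)) (ℤₚ.+-comm (shift 1 (f x) k) _))

  term : Mirror → G → G → G → Poly
  term m v z x k = pick m z (μ z v * shift ⌊ suc (len v) ∸ len z /2⌋ (F z x) k) 0ℤ

  -- `E m v` is the right side of the recursion for `σ m v`. Summing over a ball does no harm, as
  -- `term` vanishes unless the mirror shortens z and μ(z,v) is nonzero.
  corr E : Mirror → G → G → Poly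
  corr m v x k = sum (ball (len v)) (λ z → term m v z x k)
  E m v x k = op m (F v) x k - corr m v x k

  term-elim : ∀ (Q : ℤ → Set) m v z x k → Q 0ℤ →
    (∀ d → OddGap z v d → Down m z → Q (μ z v * shift (suc d) (F z x) k)) → Q (term m v z x k)
  term-elim Q m v z x k q0 q = pick-elim Q m z
    (λ dz → [ (λ p → subst Q (sym (cong (_* shift ⌊ suc (len v) ∸ len z /2⌋ (F z x) k) p)) q0)
            , (λ { (d , gap) → subst (λ n → Q (μ z v * shift n (F z x) k)) (sym (half-correction d gap)) (q d gap dz) })
            ]′ (μ-view z v))
    (λ _ → q0)

  sumL-filter : ∀ {Q : G → Set} (Q? : ∀ z → Dec (Q z)) (f : Word → ℤ) (h : G → ℤ) zs →
    (∀ z → Q z → f (word z) ≡ h z) → (∀ z → ¬ Q z → h z ≡ 0ℤ) →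
    sumL (map word (filter Q? zs)) f ≡ sum zs h
  sumL-filter Q? f h []       p q = refl
  sumL-filter Q? f h (z ∷ zs) p q with Q? z
  ... | yes y = cong₂ _+_ (p z y) (sumL-filter Q? f h zs p q)
  ... | no ¬y = trans (sumL-filter Q? f h zs p q)
        (trans (sym (ℤₚ.+-identityˡ _)) (cong (_+ sum zs h) (sym (q z ¬y))))

  module _ (a : Gen) (v : G) (u : Asc a v) where
    private
      Below : G → Set
      Below z = (z ≼ v × z ≢ v) × Desc a z

      desc-dec : ∀ z → Dec (Desc a z)
      desc-dec z = len z ℕₚ.≟ suc (len (a · z))

      below? : ∀ z → Dec (Below z)
      below? z = ((z ≼? v) ×-dec ¬? (z ≟ v)) ×-dec desc-dec z

      zs : List G
      zs = filter below? (ball (len v))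

      enumerates : Enumerates a (word v) (map word zs)
      enumerates =
        Allₚ.map⁺ (All.map (λ {z} → member z) (Allₚ.all-filter below? (ball (len v)))) ,
        (λ z lt la → complete z lt la) ,
        AllPairsₚ.map⁺ (AllPairs.map (λ ne p → ne (trans (sym (··-word _)) (trans (eval-≈ p) (··-word _))))
          (Uniqueₚ.filter⁺ below? (ball-unique (len v))))
        where
        member : ∀ z → Below z → IsReduced (word z) × word z <B word v × LDesc a (word z)
        member z ((le , ne) , d) = word-reduced z ,
          (≼⇒≤B (··-word z) (··-word v) le , λ p → ne (trans (sym (··-word z)) (trans (eval-≈ p) (··-word v)))) ,
          Desc⇒LDesc (subst (Desc a) (sym (··-word z)) d)
        complete : ∀ z → z <B word v → LDesc a z → Any.Any (λ z′ → z ≈ z′) (map word zs)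
        complete z (le , ne) la = Any.map (λ q → ≈-trans (≈-sym (word-eval z)) (≡⇒≈ q))
          (∈-map⁺ word (∈-filter⁺ below? (ball-complete (len v) (≼-len le′))
            ((le′ , λ p → ne (eval-injective (trans p (sym (··-word v))))) , LDesc⇒Desc la)))
          where
          le′ : eval z ≼ v
          le′ = subst (eval z ≼_) (··-word v) (≤B⇒≼ le)

      reduced : IsReduced (a ∷ word v)
      reduced = len⇒reduced (trans (cong suc (len-word v)) (trans (sym u) (cong (λ x → len (a · x)) (sym (··-word v)))))

    module _ (x : G) where
      private
        cval : ∃ λ c → CVal a (word x) c × ∀ k →
          shift (1 ∸ c) (P (a ∷ word x) (word v)) k + shift c (P (word x) (word v)) k ≡ op (left a) (F v) x k
        cval with up-down a x
        ... | inj₁ up = 0 , inj₂ ((λ la → asc∧desc up (subst (Desc a) (··-word x) (LDesc⇒Desc la))) , refl) ,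
              λ k → cong (_+ F v x k) (shift-cong 1 (invariant (≈-sym (word-· a x)) ≈-refl) k)
        ... | inj₂ d = 1 , inj₁ (Desc⇒LDesc (subst (Desc a) (sym (··-word x)) d) , refl) ,
              λ k → cong (_+ shift 1 (F v x) k) (invariant (≈-sym (word-· a x)) ≈-refl k)

        corr-sum : ∀ k → sumL (map word zs) (λ z → mu P z (word v) *
            shift ⌊ length (a ∷ word v) ∸ length z /2⌋ (P (word x) z) k) ≡ corr (left a) v x k
        corr-sum k = sumL-filter below? _ (λ z → term (left a) v z x k) (ball (len v))
          (λ { z (_ , d) → trans (cong (λ n → μ z v * shift ⌊ n /2⌋ (F z x) k)
                  (cong₂ (λ m n → suc m ∸ n) (len-word v) (len-word z)))
                (sym (pick-down {m = left a} d)) })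
          (λ z nb → pick-elim (_≡ 0ℤ) (left a) z
            (λ d → cong (_* shift ⌊ suc (len v) ∸ len z /2⌋ (F z x) k) (not-below z d nb)) (λ _ → refl))
          where
          not-below : ∀ z → Desc a z → ¬ Below z → μ z v ≡ 0ℤ
          not-below z d nb with μ-view z v
          ... | inj₁ p = p
          ... | inj₂ (c , gap) = trans (μ-odd c gap) (F-vanish (λ le → nb ((le , λ { refl → asc∧desc u d }) , d)) c)

      left-recursion : ∀ k → F (a · v) x k ≡ E (left a) v x k
      left-recursion k with cval
      ... | c , cv , h = trans (invariant ≈-refl (word-· a v) k)
        (trans (recursion a (word v) (word x) (map word zs) c reduced (word-reduced x) enumerates cv k)
               (cong₂ _-_ (h k) (corr-sum k)))

  Invariant : Mirror → G → Set
  Invariant m w = ∀ x k → F w (σ m x) k ≡ F w x k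

  -- The second half is the bound of (l(w) - l(x) - 1)/2 on the degree of P_{x,w}, written without
  -- division.
  Normalised : G → Set
  Normalised w = (∀ k → F w w k ≡ δ k) × (∀ x k → x ≢ w → len w ≤ k ℕ.+ k ℕ.+ len x → F w x k ≡ 0ℤ)

  -- The operator is symmetric by its very form, and the correction involves only shorter `z` with
  -- the same descent, where symmetry is assumed.
  E-invariant : ∀ m v → (∀ z → len z < len v → Down m z → Invariant m z) → ∀ x k → E m v (σ m x) k ≡ E m v x k
  E-invariant m v inv x k = cong₂ _-_ (op-invariant m (F v) x k) (sum-cong (ball (len v)) same)
    where
    same : ∀ z → term m v z (σ m x) k ≡ term m v z x k
    same z with σ-len m z
    ... | inj₁ _ = refl
    ... | inj₂ dz with μ-view z v
    ...   | inj₁ p rewrite p = refl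
    ...   | inj₂ (d , gap) = cong (μ z v *_) (shift-cong ⌊ suc (len v) ∸ len z /2⌋ (inv z (μ-gap d gap) dz x) k)

  δ-pos : ∀ {k} → 1 ≤ k → δ k ≡ 0ℤ
  δ-pos (s≤s _) = refl

  *-0 : ∀ {c z} → z ≡ 0ℤ → c * z ≡ 0ℤ
  *-0 {c} refl = ℤₚ.*-zeroʳ c

  module _ (m : Mirror) (v : G) (up : Up m v)
    (norm : ∀ w → len w ≤ len v → Normalised w)
    (inv : ∀ z → len z < len v → Down m z → Invariant m z) where

    private
      E-top : ∀ k → E m v (σ m v) k ≡ δ k
      E-top k = trans (cong₂ _-_ op≡ corr≡) (ℤₚ.+-identityʳ (δ k))
        where
        long : ∀ {w} → len w ≤ len v → ∀ k → F w (σ m v) k ≡ 0ℤ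
        long {w} le = F-short (ℕₚ.≤-trans le (ℕₚ.≤-trans (ℕₚ.n≤1+n _) (ℕₚ.≤-reflexive (sym up))))
          λ { refl → ℕₚ.1+n≰n (ℕₚ.≤-trans (ℕₚ.≤-reflexive (sym up)) le) }
        op≡ : op m (F v) (σ m v) k ≡ δ k
        op≡ = trans (op-down m (F v) k (down-σ m up)) (trans (cong₂ _+_
          (trans (cong (λ y → F v y k) (σ-invol m v)) (proj₁ (norm v ℕₚ.≤-refl) k))
          (shift-zero 1 (long ℕₚ.≤-refl) k)) (ℤₚ.+-identityʳ (δ k)))
        corr≡ : corr m v (σ m v) k ≡ 0ℤ
        corr≡ = sum-zero (ball (len v)) (λ z _ → term-elim (_≡ 0ℤ) m v z (σ m v) k refl
          (λ d gap _ → *-0 {μ z v} (shift-zero (suc d) (long (ℕₚ.<⇒≤ (μ-gap d gap))) k)))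

      -- The summand q P_{x,v} is the one part of the operator that can reach a forbidden degree,
      -- and it does so through the coefficient μ(x,v) alone. The correction term at z = x is μ(x,v)
      -- times a power of q and cancels it.
      E-down : ∀ x k → Down m x → x ≢ σ m v → suc (len v) ≤ k ℕ.+ k ℕ.+ len x → E m v x k ≡ 0ℤ
      E-down x k dx x≢ bound = trans (cong₂ _-_ op≡ corr≡) (ℤₚ.+-inverseʳ (shift 1 (F v x) k))
        where
        x≢v : x ≢ v
        x≢v refl = asc∧desc up dx

        op≡ : op m (F v) x k ≡ shift 1 (F v x) k
        op≡ = trans (op-down m (F v) k dx) (trans (cong (_+ shift 1 (F v x) k)
          (proj₂ (norm v ℕₚ.≤-refl) (σ m x) k (λ p → x≢ (σ-swap m p))
            (ℕₚ.≤-pred (ℕₚ.≤-trans bound (ℕₚ.≤-reflexive (trans (cong (k ℕ.+ k ℕ.+_) dx) (ℕₚ.+-suc (k ℕ.+ k) _)))))))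
          (ℤₚ.+-identityˡ _))

        others : ∀ z → z ∈ ball (len v) → z ≢ x → term m v z x k ≡ 0ℤ
        others z _ z≢x = term-elim (_≡ 0ℤ) m v z x k refl λ d gap dz →
          *-0 {μ z v} (shift-elim {_≡ 0ℤ} (suc d) (F z x) k refl λ { k′ refl →
            proj₂ (norm z (ℕₚ.<⇒≤ (μ-gap d gap))) x k′ (λ p → z≢x (sym p))
              (ℕₚ.+-cancelˡ-≤ (suc (suc (d ℕ.+ d))) _ _ (ℕₚ.≤-trans (ℕₚ.≤-reflexive (cong suc (sym gap)))
                (ℕₚ.≤-trans bound (ℕₚ.≤-reflexive (arith d k′ (len x)))))) })
          where
          arith : ∀ d k l → (suc d ℕ.+ k) ℕ.+ (suc d ℕ.+ k) ℕ.+ l ≡ suc (suc (d ℕ.+ d)) ℕ.+ (k ℕ.+ k ℕ.+ l)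
          arith = ℕSolver.solve-∀

        cases : term m v x x k ≡ shift 1 (F v x) k
        cases with σ-len m x
        ... | inj₁ u = ⊥-elim (asc∧desc u dx)
        ... | inj₂ _ = go (μ-view x v) k bound
          where
          low : ∀ k′ → suc (len v) ≤ suc k′ ℕ.+ suc k′ ℕ.+ len x → len v ≤ suc (k′ ℕ.+ k′ ℕ.+ len x)
          low k′ b = ℕₚ.≤-pred (ℕₚ.≤-trans b (ℕₚ.≤-reflexive (cong (λ n → suc (n ℕ.+ len x)) (ℕₚ.+-suc k′ k′))))
          go : μ x v ≡ 0ℤ ⊎ ∃ (OddGap x v) → ∀ k → suc (len v) ≤ k ℕ.+ k ℕ.+ len x →
            μ x v * shift ⌊ suc (len v) ∸ len x /2⌋ (F x x) k ≡ shift 1 (F v x) k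
          go (inj₁ p) zero b = cong (_* shift ⌊ suc (len v) ∸ len x /2⌋ (F x x) 0) p
          go (inj₁ p) (suc k′) b = trans (cong (_* shift ⌊ suc (len v) ∸ len x /2⌋ (F x x) (suc k′)) p) (sym vanishing)
            where
            vanishing : F v x k′ ≡ 0ℤ
            vanishing with ℕₚ.m≤n⇒m<n∨m≡n (low k′ b)
            ... | inj₁ lt = proj₂ (norm v ℕₚ.≤-refl) x k′ x≢v (ℕₚ.≤-pred lt)
            ... | inj₂ eq = trans (sym (μ-odd k′ eq)) p
          go (inj₂ (d , gap)) zero b rewrite half-correction d gap = ℤₚ.*-zeroʳ (μ x v)
          go (inj₂ (d , gap)) (suc k′) b rewrite half-correction d gap with ℕₚ.m≤n⇒m<n∨m≡n (low k′ b)
          -- Equality in the bound: `k′` is the degree that defines μ(x,v), and P_{x,x} = 1 makes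
          -- the correction equal to the same coefficient.
          ... | inj₂ eq = trans (cong₂ _*_ (μ-odd k′ eq) (unit k′ d≡k′)) (ℤₚ.*-identityʳ _)
            where
            d≡k′ : d ≡ k′
            d≡k′ = trans (sym (half-odd d)) (trans (cong ⌊_/2⌋
              (ℕₚ.+-cancelʳ-≡ (len x) (suc (d ℕ.+ d)) (suc (k′ ℕ.+ k′)) (trans (sym gap) eq))) (half-odd k′))
            unit : ∀ k → d ≡ k → shift d (F x x) k ≡ 1ℤ
            unit k refl = trans (cong (shift d (F x x)) (sym (ℕₚ.+-identityʳ d)))
              (trans (shift-≥ d (F x x) 0) (proj₁ (norm x (ℕₚ.<⇒≤ (μ-gap d gap))) 0))
          ... | inj₁ lt = trans (*-0 {μ x v} (shift-elim {_≡ 0ℤ} d (F x x) k′ refl λ { j refl →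
                trans (proj₁ (norm x (ℕₚ.<⇒≤ (μ-gap d gap))) j) (δ-pos (positive j lt)) }))
              (sym (proj₂ (norm v ℕₚ.≤-refl) x k′ x≢v (ℕₚ.≤-pred lt)))
            where
            positive : ∀ j → len v < suc ((d ℕ.+ j) ℕ.+ (d ℕ.+ j) ℕ.+ len x) → 1 ≤ j
            positive zero h = ⊥-elim (ℕₚ.<-irrefl (trans gap (cong (λ n → suc (n ℕ.+ n ℕ.+ len x)) (sym (ℕₚ.+-identityʳ d)))) h)
            positive (suc j) h = s≤s z≤n

        here-or-zero : x ∈ ball (len v) ⊎ (term m v x x k ≡ 0ℤ × ¬ x ∈ ball (len v))
        here-or-zero with len x ℕₚ.≤? len v
        ... | yes p = inj₁ (ball-complete (len v) p)
        ... | no ¬p = inj₂ (term-elim (_≡ 0ℤ) m v x x k refl (λ d gap _ → ⊥-elim (¬p (ℕₚ.<⇒≤ (μ-gap d gap)))) ,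
                            λ x∈ → ¬p (ball-sound (len v) x∈))

        corr≡ : corr m v x k ≡ shift 1 (F v x) k
        corr≡ = trans (sum-single (ball-unique (len v)) x others here-or-zero) cases

    E-normalised : (∀ k → E m v (σ m v) k ≡ δ k) ×
      (∀ x k → x ≢ σ m v → suc (len v) ≤ k ℕ.+ k ℕ.+ len x → E m v x k ≡ 0ℤ)
    E-normalised = E-top , λ x k ne b → bound x k ne b (σ-len m x)
      where
      bound : ∀ x k → x ≢ σ m v → suc (len v) ≤ k ℕ.+ k ℕ.+ len x → Up m x ⊎ Down m x → E m v x k ≡ 0ℤ
      bound x k ne b (inj₂ dx) = E-down x k dx ne b
      bound x k ne b (inj₁ ux) with σ m x ≟ σ m v
      ... | no ne′ = trans (sym (E-invariant m v inv x k)) (E-down (σ m x) k (down-σ m ux) ne′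
              (ℕₚ.≤-trans b (ℕₚ.+-monoʳ-≤ (k ℕ.+ k) (ℕₚ.≤-trans (ℕₚ.n≤1+n _) (ℕₚ.≤-reflexive (sym ux))))))
      -- Here x = v, and E at σ v is the constant 1, while the bound forces k to be positive.
      ... | yes p = trans (sym (E-invariant m v inv x k)) (trans (cong (λ y → E m v y k) p)
              (trans (E-top k) (δ-pos (positive k b))))
        where
        x≡v : x ≡ v
        x≡v = trans (σ-swap m p) (σ-invol m v)
        positive : ∀ k → suc (len v) ≤ k ℕ.+ k ℕ.+ len x → 1 ≤ k
        positive zero h = ⊥-elim (ℕₚ.1+n≰n (ℕₚ.≤-trans h (ℕₚ.≤-reflexive (cong len x≡v))))
        positive (suc k) h = s≤s z≤n

  private
    LeftInvariant : G → Set
    LeftInvariant w = ∀ a → Desc a w → Invariant (left a) w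

    -- One induction for both properties: the degree bound of `w` uses the invariance of shorter
    -- elements, and invariance is read off the recursion for each descent of `w` separately.
    basics : ∀ n w {l} → len w ≡ l → l ≤ n → LeftInvariant w × Normalised w
    basics n w {zero} eq h with len-0 eq
    ... | refl = (λ a d → ⊥-elim (ℕₚ.0≢1+n (trans (sym len-e) d))) ,
                 (λ k → trans (cong₂ (λ p q → P p q k) word-e word-e) (base k)) ,
                 λ x k ne _ → F-vanish (λ le → ne (≼-len-≡ le (ℕₚ.≤-trans (ℕₚ.≤-reflexive len-e) z≤n))) k
    basics (suc n) w {suc l} eq (s≤s h) = invariance , normalisation
      where
      shorter : ∀ z → len z ≤ l → LeftInvariant z × Normalised z
      shorter z le = basics n z refl (ℕₚ.≤-trans le h)

      module _ {a} (d : Desc a w) where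
        l≡ : len (a · w) ≡ l
        l≡ = ℕₚ.suc-injective (trans (sym d) eq)
        inv′ : ∀ z → len z < len (a · w) → Down (left a) z → Invariant (left a) z
        inv′ z lt dz = proj₁ (shorter z (ℕₚ.≤-trans (ℕₚ.<⇒≤ lt) (ℕₚ.≤-reflexive l≡))) a dz
        norm′ : ∀ z → len z ≤ len (a · w) → Normalised z
        norm′ z le = proj₂ (shorter z (ℕₚ.≤-trans le (ℕₚ.≤-reflexive l≡)))
        rec : ∀ x k → F w x k ≡ E (left a) (a · w) x k
        rec x k = trans (cong (λ v → F v x k) (sym (invol a w))) (left-recursion a (a · w) (asc-· d) x k)

      invariance : LeftInvariant w
      invariance a d x k = trans (rec d (a · x) k) (trans (E-invariant (left a) (a · w) (inv′ d) x k) (sym (rec d x k)))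

      normalisation : Normalised w
      normalisation with has-descent w eq
      ... | a , d with E-normalised (left a) (a · w) (asc-· d) (norm′ d) (inv′ d)
      ...   | top , deg = (λ k → trans (rec d w k) (trans (cong (λ y → E (left a) (a · w) y k) (sym (invol a w))) (top k))) ,
              λ x k ne b → trans (rec d x k) (deg x k (λ p → ne (trans p (invol a w))) (ℕₚ.≤-trans (ℕₚ.≤-reflexive (sym d)) b))

  left-invariant : ∀ {a w} → Desc a w → Invariant (left a) w
  left-invariant {a} {w} = proj₁ (basics _ w refl ℕₚ.≤-refl) a

  normalised : ∀ w → Normalised w
  normalised w = proj₂ (basics _ w refl ℕₚ.≤-refl)

add-correction : ∀ o c {f} → f ≡ o - c → o ≡ f + c
add-correction o c refl = sym (cancelled o c)
  where
  cancelled : ∀ o c → o - c + c ≡ o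
  cancelled = solve-∀

interchange : ∀ a b c d → (a + b) + (c + d) ≡ (a + c) + (b + d)
interchange = solve-∀

interchange-minus : ∀ a b c d → (a - b) + (c - d) ≡ (a + c) - (b + d)
interchange-minus = solve-∀

-- Hecke operators of the two sides and their commutation.

module RightKL (M : Model) (P : Word → Word → Poly) (K : IsKL P) where
  open Model M
  open Group M
  open Bruhat M
  open KL M P K

  op-cong : ∀ m {f g : G → Poly} → (∀ x k → f x k ≡ g x k) → ∀ x k → op m f x k ≡ op m g x k
  op-cong m h x k with σ-len m x
  ... | inj₁ _ = cong₂ _+_ (shift-cong 1 (h (σ m x)) k) (h x k)
  ... | inj₂ _ = cong₂ _+_ (h (σ m x) k) (shift-cong 1 (h x) k)

  op-+ : ∀ m (f g : G → Poly) x k → op m (λ x k → f x k + g x k) x k ≡ op m f x k + op m g x k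
  op-+ m f g x k with σ-len m x
  ... | inj₁ _ = trans (cong (_+ (f x k + g x k)) (shift-+ 1 (f (σ m x)) (g (σ m x)) k)) (interchange (shift 1 (f (σ m x)) k) (shift 1 (g (σ m x)) k) (f x k) (g x k))
  ... | inj₂ _ = trans (cong ((f (σ m x) k + g (σ m x) k) +_) (shift-+ 1 (f x) (g x) k)) (interchange (f (σ m x) k) (g (σ m x) k) (shift 1 (f x) k) (shift 1 (g x) k))

  op-minus : ∀ m (f g : G → Poly) x k → op m (λ x k → f x k - g x k) x k ≡ op m f x k - op m g x k
  op-minus m f g x k with σ-len m x
  ... | inj₁ _ = trans (cong (_+ (f x k - g x k)) (shift-minus 1 (f (σ m x)) (g (σ m x)) k)) (interchange-minus (shift 1 (f (σ m x)) k) (shift 1 (g (σ m x)) k) (f x k) (g x k))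
  ... | inj₂ _ = trans (cong ((f (σ m x) k - g (σ m x) k) +_) (shift-minus 1 (f x) (g x) k)) (interchange-minus (f (σ m x) k) (g (σ m x) k) (shift 1 (f x) k) (shift 1 (g x) k))

  op-zero : ∀ m (f : G → Poly) x → (∀ k → f x k ≡ 0ℤ) → (∀ k → f (σ m x) k ≡ 0ℤ) → ∀ k → op m f x k ≡ 0ℤ
  op-zero m f x h h′ k with σ-len m x
  ... | inj₁ _ = cong₂ _+_ (shift-zero 1 h′ k) (h k)
  ... | inj₂ _ = cong₂ _+_ (h′ k) (shift-zero 1 h k)

  op-*shift : ∀ m c d (f : G → Poly) x k →
    op m (λ x k → c * shift d (f x) k) x k ≡ c * shift d (op m f x) k
  op-*shift m c d f x k with σ-len m x
  ... | inj₁ _ = trans (cong (_+ c * shift d (f x) k) (shift-swap c d (f (σ m x)) k))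
        (trans (sym (ℤₚ.*-distribˡ-+ c _ _)) (cong (c *_) (sym (shift-+ d _ (f x) k))))
  ... | inj₂ _ = trans (cong (c * shift d (f (σ m x)) k +_) (shift-swap c d (f x) k))
        (trans (sym (ℤₚ.*-distribˡ-+ c _ _)) (cong (c *_) (sym (shift-+ d (f (σ m x)) _ k))))

  op-sum : ∀ m zs (f : G → G → Poly) x k →
    op m (λ x k → sum zs (λ z → f z x k)) x k ≡ sum zs (λ z → op m (f z) x k)
  op-sum m []       f x k = op-zero m _ x (λ _ → refl) (λ _ → refl) k
  op-sum m (z ∷ zs) f x k = trans (op-+ m (f z) (λ x k → sum zs (λ y → f y x k)) x k)
    (cong (op m (f z) x k +_) (op-sum m zs f x k))

  -- Left and right operators commute: the square x, a x, x b, a x b either collapses or has parallel sides.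

  module _ {a b : Gen} {x : G} where
    right-up-stable : a · x ≢ x ∙ gen b → Up (right b) x → Up (right b) (a · x)
    right-up-stable ne ub with σ-len (right b) (a · x)
    ... | inj₁ p = p
    ... | inj₂ p with up-down a x
    ...   | inj₁ ua = ⊥-elim (contra (left-asc-stable ne ua))
      where
      contra : len (a · (x ∙ gen b)) ≡ suc (len (x ∙ gen b)) → ⊥
      contra q rewrite sym (·-right a b x) | q | ub | ua = ℕₚ.<-irrefl p (ℕₚ.m≤n⇒m≤1+n ℕₚ.≤-refl)
    ...   | inj₂ da = ⊥-elim (contra (left-desc-stable ne da))
      where
      contra : len (x ∙ gen b) ≡ suc (len (a · (x ∙ gen b))) → ⊥
      contra q rewrite sym (·-right a b x) | p | da | q =
        ℕₚ.<-irrefl ub (ℕₚ.m≤n⇒m≤1+n ℕₚ.≤-refl)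

    right-down-stable : a · x ≢ x ∙ gen b → Down (right b) x → Down (right b) (a · x)
    right-down-stable ne db with σ-len (right b) (a · x)
    ... | inj₂ p = p
    ... | inj₁ p with up-down a x
    ...   | inj₁ ua = ⊥-elim (contra (left-asc-stable ne ua))
      where
      contra : len (a · (x ∙ gen b)) ≡ suc (len (x ∙ gen b)) → ⊥
      contra q rewrite sym (·-right a b x) | p | ua | db =
        ℕₚ.<-irrefl (sym q) (ℕₚ.m≤n⇒m≤1+n ℕₚ.≤-refl)
    ...   | inj₂ da = ⊥-elim (contra (left-desc-stable ne da))
      where
      contra : len (x ∙ gen b) ≡ suc (len (a · (x ∙ gen b))) → ⊥
      contra q rewrite sym (·-right a b x) | q | p =
        ℕₚ.<-irrefl (trans (sym da) db) (ℕₚ.m≤n⇒m≤1+n ℕₚ.≤-refl)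

    op-agree : a · x ≡ x ∙ gen b → ∀ f k → op (left a) f x k ≡ op (right b) f x k
    op-agree p f k with σ-len (left a) x
    ... | inj₁ u = trans (cong (λ y → shift 1 (f y) k + f x k) p)
            (sym (op-up (right b) f k (trans (cong len (sym p)) u)))
    ... | inj₂ d = trans (cong (λ y → f y k + shift 1 (f x) k) p)
            (sym (op-down (right b) f k (trans d (cong (λ y → suc (len y)) p))))

  -- With `op-invariant` this is the Hecke relation (T_a + 1)² = (q + 1)(T_a + 1), available at a
  -- single point.
  op-fixed : ∀ m f x k → (∀ k → f (σ m x) k ≡ f x k) → op m f x k ≡ f x k + shift 1 (f x) k
  op-fixed m f x k h with σ-len m x
  ... | inj₁ _ = trans (cong (_+ f x k) (shift-cong 1 h k)) (ℤₚ.+-comm _ (f x k))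
  ... | inj₂ _ = cong (_+ shift 1 (f x) k) (h k)

  op-comm : ∀ a b f x k → op (left a) (op (right b) f) x k ≡ op (right b) (op (left a) f) x k
  op-comm a b f x k with a · x ≟ x ∙ gen b
  -- On a collapsed square the two operators agree at x, and each is applied to a function that its
  -- mirror fixes there, so each multiplies by 1 + q.
  ... | yes p = trans (op-fixed (left a) ρf x k (λ j → trans (cong (λ y → ρf y j) p) (op-invariant (right b) f x j)))
      (trans (cong₂ _+_ (sym (op-agree p f k)) (shift-cong 1 (λ j → sym (op-agree p f j)) k))
      (sym (op-fixed (right b) λf x k (λ j → trans (cong (λ y → λf y j) (sym p)) (op-invariant (left a) f x j)))))
    where
    ρf = op (right b) f
    λf = op (left a) f
  ... | no ne = go (up-down a x) (σ-len (right b) x)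
    where
    ρf = op (right b) f
    λf = op (left a) f
    go : Asc a x ⊎ Desc a x → Up (right b) x ⊎ Down (right b) x → op (left a) ρf x k ≡ op (right b) λf x k
    W = f ((a · x) ∙ gen b)
    A = f (a · x)
    B = f (x ∙ gen b)
    X = f x
    S = shift 1
    same : ∀ k → f (a · (x ∙ gen b)) k ≡ W k
    same k = cong (λ y → f y k) (·-right a b x)
    go (inj₁ ua) (inj₁ ub) = trans (op-up (left a) ρf k ua) (trans
      (cong₂ _+_ (trans (shift-cong 1 (λ j → op-up (right b) f {a · x} j (right-up-stable ne ub)) k) (shift-+ 1 (S W) A k))
        (op-up (right b) f {x} k ub)) (trans
      (interchange (S (S W) k) (S A k) ((S B) k) (X k)) (sym
      (trans (op-up (right b) λf k ub) (cong₂ _+_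
        (trans (shift-cong 1 (λ j → trans (op-up (left a) f {x ∙ gen b} j (left-asc-stable ne ua)) (cong (_+ B j) (shift-cong 1 same j))) k) (shift-+ 1 (S W) B k))
        (op-up (left a) f {x} k ua))))))
    go (inj₁ ua) (inj₂ db) = trans (op-up (left a) ρf k ua) (trans
      (cong₂ _+_ (trans (shift-cong 1 (λ j → op-down (right b) f {a · x} j (right-down-stable ne db)) k) (shift-+ 1 W (S A) k))
        (op-down (right b) f {x} k db)) (trans
      (interchange (S W k) (S (S A) k) (B k) ((S X) k)) (sym
      (trans (op-down (right b) λf k db) (cong₂ _+_
        (trans (op-up (left a) f {x ∙ gen b} k (left-asc-stable ne ua)) (cong (_+ B k) (shift-cong 1 same k)))
        (trans (shift-cong 1 (λ j → op-up (left a) f {x} j ua) k) (shift-+ 1 (S A) X k)))))))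
    go (inj₂ da) (inj₁ ub) = trans (op-down (left a) ρf k da) (trans
      (cong₂ _+_ (op-up (right b) f {a · x} k (right-up-stable ne ub))
        (trans (shift-cong 1 (λ j → op-up (right b) f {x} j ub) k) (shift-+ 1 (S B) X k))) (trans
      (interchange ((S W) k) (A k) (S (S B) k) (S X k)) (sym
      (trans (op-up (right b) λf k ub) (cong₂ _+_
        (trans (shift-cong 1 (λ j → trans (op-down (left a) f {x ∙ gen b} j (left-desc-stable ne da)) (cong (_+ (S B) j) (same j))) k) (shift-+ 1 W (S B) k))
        (op-down (left a) f {x} k da))))))
    go (inj₂ da) (inj₂ db) = trans (op-down (left a) ρf k da) (trans
      (cong₂ _+_ (op-down (right b) f {a · x} k (right-down-stable ne db))
        (trans (shift-cong 1 (λ j → op-down (right b) f {x} j db) k) (shift-+ 1 B (S X) k))) (trans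
      (interchange (W k) ((S A) k) (S B k) (S (S X) k)) (sym
      (trans (op-down (right b) λf k db) (cong₂ _+_
        (trans (op-down (left a) f {x ∙ gen b} k (left-desc-stable ne da)) (cong (_+ (S B) k) (same k)))
        (trans (shift-cong 1 (λ j → op-down (left a) f {x} j da) k) (shift-+ 1 A (S X) k)))))))

-- Bar-invariant combinations and the recursion on the right.

-- q-analogues invariant under q^j ↦ q^(n - j): the symmetric Laurent polynomials 1 and q^(1/2) + q^(-1/2), times q^(n/2).
symmetric : ℕ → Poly → Poly
symmetric 0             f = f
symmetric 1             f = λ k → f k + shift 1 f k
symmetric (suc (suc n)) f = shift 1 (symmetric n f)

symmetric-even : ∀ d f k → symmetric (d ℕ.+ d) f k ≡ shift d f k
symmetric-even zero f k = refl
symmetric-even (suc d) f k rewrite ℕₚ.+-suc d d =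
  trans (shift-cong 1 (symmetric-even d f) k) (shift-shift 1 d f k)

symmetric-odd : ∀ d f k → symmetric (suc (d ℕ.+ d)) f k ≡ shift d (λ k → f k + shift 1 f k) k
symmetric-odd zero f k = refl
symmetric-odd (suc d) f k rewrite ℕₚ.+-suc d d =
  trans (shift-cong 1 (symmetric-odd d f) k) (shift-shift 1 d (λ k → f k + shift 1 f k) k)

symmetric-zero : ∀ n {f} → (∀ k → f k ≡ 0ℤ) → ∀ k → symmetric n f k ≡ 0ℤ
symmetric-zero 0 h k = h k
symmetric-zero 1 h k = cong₂ _+_ (h k) (shift-zero 1 h k)
symmetric-zero (suc (suc n)) h k = shift-zero 1 (symmetric-zero n h) k

-- The degree of `symmetric n δ`, that is n/2 rounded up; this coefficient lies in the range where
-- `span-unique` assumes zero.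
topDegree : ℕ → ℕ
topDegree 0             = 0
topDegree 1             = 1
topDegree (suc (suc n)) = suc (topDegree n)

topDegree-bound : ∀ n → n ≤ topDegree n ℕ.+ topDegree n
topDegree-bound 0 = z≤n
topDegree-bound 1 = s≤s z≤n
topDegree-bound (suc (suc n)) = s≤s (ℕₚ.≤-trans (s≤s (topDegree-bound n))
  (ℕₚ.≤-reflexive (sym (ℕₚ.+-suc (topDegree n) (topDegree n)))))

symmetric-top : ∀ n {f} → (∀ k → f k ≡ δ k) → symmetric n f (topDegree n) ≡ 1ℤ
symmetric-top 0 h = h 0
symmetric-top 1 h = cong₂ _+_ (h 1) (h 0)
symmetric-top (suc (suc n)) h = symmetric-top n h

module RightRecursion (M : Model) (P : Word → Word → Poly) (K : IsKL P) where
  open Model M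
  open Group M
  open Bruhat M
  open KL M P K
  open RightKL M P K

  -- Integers suffice as coefficients: the parity of L - l(y) selects the factor 1 or q^(1/2) +
  -- q^(-1/2) of C_y, and scaling by q^(L/2) clears the fractional powers.
  record InSpan (L : ℕ) (D : G → Poly) : Set where
    constructor _,_
    field
      coefficient : G → ℤ
      combination : ∀ x k → D x k ≡ sum (ball L) (λ y → coefficient y * symmetric (L ∸ len y) (F y x) k)

  span-ext : ∀ {L D D′} → (∀ x k → D x k ≡ D′ x k) → InSpan L D′ → InSpan L D
  span-ext h (n , p) = n , λ x k → trans (h x k) (p x k)

  span-zero : ∀ {L} → InSpan L (λ _ _ → 0ℤ)
  span-zero {L} = (λ _ → 0ℤ) , λ x k → sym (sum-zero (ball L) (λ _ _ → refl))

  span-+ : ∀ {L D D′} → InSpan L D → InSpan L D′ → InSpan L (λ x k → D x k + D′ x k)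
  span-+ {L} (n , p) (n′ , p′) = (λ y → n y + n′ y) , λ x k → trans (cong₂ _+_ (p x k) (p′ x k))
    (trans (sym (sum-+ (ball L) _ _)) (sum-cong (ball L) (λ y → sym (ℤₚ.*-distribʳ-+ (symmetric (L ∸ len y) (F y x) k) (n y) (n′ y)))))

  span-* : ∀ {L D} c → InSpan L D → InSpan L (λ x k → c * D x k)
  span-* {L} c (n , p) = (λ y → c * n y) , λ x k → trans (cong (c *_) (p x k))
    (trans (sym (sum-* (ball L) c (λ y → n y * symmetric (L ∸ len y) (F y x) k))) (sum-cong (ball L) (λ y → sym (ℤₚ.*-assoc c (n y) _))))

  span-minus : ∀ {L D D′} → InSpan L D → InSpan L D′ → InSpan L (λ x k → D x k - D′ x k)
  span-minus {D = D} {D′} p q = span-ext (λ x k → cong (D x k +_) (sym (ℤₚ.-1*i≡-i (D′ x k)))) (span-+ p (span-* (- 1ℤ) q))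

  span-sum : ∀ {L} zs (D : G → G → Poly) → (∀ z → InSpan L (D z)) → InSpan L (λ x k → sum zs (λ z → D z x k))
  span-sum []       D h = span-zero
  span-sum (z ∷ zs) D h = span-+ (h z) (span-sum zs D h)

  span-basis : ∀ {L} y → len y ≤ L → InSpan L (λ x → symmetric (L ∸ len y) (F y x))
  span-basis {L} y le = coefficient , λ x k → sym (trans
    (sum-single (ball-unique L) y (λ z _ ne → cong (_* symmetric (L ∸ len z) (F z x) k) (off z ne)) (inj₁ (ball-complete L le)))
    (trans (cong (_* symmetric (L ∸ len y) (F y x) k) on) (ℤₚ.*-identityˡ _)))
    where
    coefficient : G → ℤ
    coefficient z = if does (z ≟ y) then 1ℤ else 0ℤ
    off : ∀ z → z ≢ y → coefficient z ≡ 0ℤ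
    off z ne with z ≟ y
    ... | yes p = ⊥-elim (ne p)
    ... | no _  = refl
    on : coefficient y ≡ 1ℤ
    on with y ≟ y
    ... | yes _ = refl
    ... | no ne = ⊥-elim (ne refl)

  span-even : ∀ {L} y d → d ℕ.+ d ℕ.+ len y ≡ L → InSpan L (λ x → shift d (F y x))
  span-even y d refl = span-ext (λ x k → trans (sym (symmetric-even d (F y x) k))
      (cong (λ n → symmetric n (F y x) k) (sym (ℕₚ.m+n∸n≡m (d ℕ.+ d) (len y)))))
    (span-basis y (ℕₚ.m≤n+m (len y) (d ℕ.+ d)))

  span-odd : ∀ {L} y d → suc (d ℕ.+ d) ℕ.+ len y ≡ L → InSpan L (λ x → shift d (λ k → F y x k + shift 1 (F y x) k))
  span-odd y d refl = span-ext (λ x k → trans (sym (symmetric-odd d (F y x) k))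
      (cong (λ n → symmetric n (F y x) k) (sym (ℕₚ.m+n∸n≡m (suc (d ℕ.+ d)) (len y)))))
    (span-basis y (ℕₚ.m≤n+m (len y) (suc (d ℕ.+ d))))

  -- A nonzero symmetric combination of the F y attains the top degree at a longest y.
  span-unique : ∀ {L D} → InSpan L D → (∀ x k → L ≤ k ℕ.+ k ℕ.+ len x → D x k ≡ 0ℤ) → ∀ x k → D x k ≡ 0ℤ
  span-unique {L} {D} (n , p) small x k = trans (p x k)
    (sum-zero (ball L) (λ y y∈ → cong (_* symmetric (L ∸ len y) (F y x) k) (vanishing (suc L) y y∈ (s≤s (ℕₚ.m≤m+n L (len y))))))
    where
    -- Downward induction on length: the number `j` exceeds L - l(y), so longer elements of the ball
    -- are settled with a smaller one.
    vanishing : ∀ j y → y ∈ ball L → L < j ℕ.+ len y → n y ≡ 0ℤ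
    vanishing zero y y∈ lt = ⊥-elim (ℕₚ.<⇒≱ lt (ball-sound L y∈))
    vanishing (suc j) y y∈ lt = trans (sym (ℤₚ.*-identityʳ (n y)))
      (trans (cong (n y *_) (sym (symmetric-top (L ∸ len y) (proj₁ (normalised y)))))
      (trans (sym (sum-single (ball-unique L) y others (inj₁ y∈))) (trans (sym (p y c)) (small y c bound))))
      where
      c : ℕ
      c = topDegree (L ∸ len y)
      bound : L ≤ c ℕ.+ c ℕ.+ len y
      bound = ℕₚ.≤-trans (ℕₚ.m≤n+m∸n L (len y)) (ℕₚ.≤-trans (ℕₚ.≤-reflexive (ℕₚ.+-comm (len y) (L ∸ len y)))
                (ℕₚ.+-monoˡ-≤ (len y) (topDegree-bound (L ∸ len y))))
      others : ∀ z → z ∈ ball L → z ≢ y → n z * symmetric (L ∸ len z) (F z y) c ≡ 0ℤ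
      others z z∈ ne with len z ℕₚ.≤? len y
      ... | yes le = *-0 {n z} (symmetric-zero (L ∸ len z) (F-short le (λ q → ne (sym q))) c)
      ... | no ¬le = cong (_* symmetric (L ∸ len z) (F z y) c) (vanishing j z z∈
              (ℕₚ.<-≤-trans lt (ℕₚ.≤-trans (ℕₚ.≤-reflexive (sym (ℕₚ.+-suc j (len y)))) (ℕₚ.+-monoʳ-≤ j (ℕₚ.≰⇒> ¬le)))))

  Recursive : Mirror → G → Set
  Recursive m v = Up m v → ∀ x k → F (σ m v) x k ≡ E m v x k

  span-term : ∀ m v z {L} d → d ℕ.+ d ℕ.+ suc (len v) ≡ L → InSpan L (λ x → shift d (term m v z x))
  span-term m v z {L} d eq with σ-len m z
  ... | inj₁ _ = span-ext (λ x → shift-zero d (λ _ → refl)) span-zero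
  ... | inj₂ _ with μ-view z v
  ...   | inj₁ p = span-ext (λ x → shift-zero d (λ k → cong (_* shift ⌊ suc (len v) ∸ len z /2⌋ (F z x) k) p)) span-zero
  ...   | inj₂ (c , gap) rewrite half-correction c gap = span-ext
            (λ x k → trans (shift-* d (μ z v) _ k) (cong (μ z v *_) (shift-shift d (suc c) (F z x) k)))
            (span-* (μ z v) (span-even z (d ℕ.+ suc c) (trans (arith d c (len z)) (trans (cong (λ n → d ℕ.+ d ℕ.+ suc n) (sym gap)) eq))))
    where
    arith : ∀ d c l → (d ℕ.+ suc c) ℕ.+ (d ℕ.+ suc c) ℕ.+ l ≡ d ℕ.+ d ℕ.+ suc (suc (c ℕ.+ c) ℕ.+ l)
    arith = ℕSolver.solve-∀

  -- The product with C_y is a multiple of C_y by q^(1/2) + q^(-1/2) if the mirror shortens y;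
  -- otherwise the recursion turns it into C_{σy} plus integer multiples of shorter elements.
  span-op : ∀ m y {L} d → Recursive m y → (Down m y → Invariant m y) → d ℕ.+ d ℕ.+ suc (len y) ≡ L →
    InSpan L (λ x → shift d (op m (F y) x))
  span-op m y d rec inv eq = go (σ-len m y)
    where
    go : Up m y ⊎ Down m y → InSpan _ (λ x → shift d (op m (F y) x))
    go (inj₂ dy) = span-ext (λ x → shift-cong d (λ k → op-fixed m (F y) x k (inv dy x)))
      (span-odd y d (trans (sym (ℕₚ.+-suc (d ℕ.+ d) (len y))) eq))
    go (inj₁ uy) = span-ext
      (λ x k → trans (shift-cong d (λ k → add-correction (op m (F y) x k) (corr m y x k) (rec uy x k)) k)
        (trans (shift-+ d (F (σ m y) x) (corr m y x) k)
          (cong (shift d (F (σ m y) x) k +_) (shift-sum d (ball (len y)) (λ z → term m y z x) k))))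
      (span-+ (span-even (σ m y) d (trans (cong (d ℕ.+ d ℕ.+_) uy) eq))
              (span-sum (ball (len y)) (λ z x → shift d (term m y z x)) (λ z → span-term m y z d eq)))

  span-op-term : ∀ m m′ v z {L} → (len z < len v → Recursive m z × (Down m z → Invariant m z)) →
    suc (suc (len v)) ≡ L → InSpan L (op m (term m′ v z))
  span-op-term m m′ v z ih eq with σ-len m′ z
  ... | inj₁ _ = span-ext (λ x → op-zero m (λ _ _ → 0ℤ) x (λ _ → refl) (λ _ → refl)) span-zero
  ... | inj₂ _ with μ-view z v
  ...   | inj₁ p = span-ext (λ x → op-zero m (λ x k → μ z v * shift ⌊ suc (len v) ∸ len z /2⌋ (F z x) k) x (λ k → cong (_* shift ⌊ suc (len v) ∸ len z /2⌋ (F z x) k) p)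
                                  (λ k → cong (_* shift ⌊ suc (len v) ∸ len z /2⌋ (F z (σ m x)) k) p)) span-zero
  ...   | inj₂ (c , gap) rewrite half-correction c gap = span-ext (op-*shift m (μ z v) (suc c) (F z))
            (span-* (μ z v) (span-op m z (suc c) (proj₁ (ih (μ-gap c gap))) (proj₂ (ih (μ-gap c gap)))
              (trans (arith c (len z)) (trans (cong (λ n → suc (suc n)) (sym gap)) eq))))
    where
    arith : ∀ c l → suc c ℕ.+ suc c ℕ.+ suc l ≡ suc (suc (suc (c ℕ.+ c) ℕ.+ l))
    arith = ℕSolver.solve-∀

  left-recursive : ∀ a v → Recursive (left a) v
  left-recursive a v u x k = left-recursion a v u x k

  private
    RightRecursive : G → Set
    RightRecursive v = ∀ b → Recursive (right b) v

    -- Invariance up to length `n` draws on the right recursion only below `n`, so it can serve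
    -- inside the induction that proves this recursion.
    right-invariant-below : ∀ n → (∀ v → len v < n → RightRecursive v) →
      ∀ j w → len w ≤ j → len w ≤ n → ∀ b → Down (right b) w → Invariant (right b) w
    right-invariant-below n rec zero w le le′ b d = ⊥-elim (ℕₚ.1+n≰n (ℕₚ.≤-trans (ℕₚ.≤-trans (s≤s z≤n) (ℕₚ.≤-reflexive (sym d))) le))
    right-invariant-below n rec (suc j) w le le′ b d x k = trans (step (x ∙ gen b) k)
      (trans (E-invariant (right b) v (λ z lt dz → right-invariant-below n rec j z (ℕₚ.≤-trans (ℕₚ.<⇒≤ lt) (ℕₚ.≤-pred (ℕₚ.≤-trans v<w le)))
        (ℕₚ.≤-trans (ℕₚ.<⇒≤ (ℕₚ.<-trans lt v<w)) le′) b dz) x k) (sym (step x k)))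
      where
      v : G
      v = w ∙ gen b
      v<w : len v < len w
      v<w = ℕₚ.≤-reflexive (sym d)
      step : ∀ x k → F w x k ≡ E (right b) v x k
      step x k = trans (cong (λ y → F y x k) (sym (right-invol b w))) (rec v (ℕₚ.<-≤-trans v<w le′) b (up-σ (right b) d) x k)

    -- Multiplying the identity by `b` gives the same on both sides, and P_{x,e} = 0 for x ≠ e
    -- settles the points where b x and x b differ.
    right-recursion-e : RightRecursive e
    right-recursion-e b u x k = trans (cong (λ y → F y x k) (e∙ (gen b)))
      (trans (left-recursion b e (trans (cong len (sym (e∙ (gen b)))) u) x k)
      (cong₂ _-_ (agree x k) (sum-cong (ball (len e)) (λ z → trans (none (left b) z) (sym (none (right b) z))))))
      where
      none : ∀ m z → term m e z x k ≡ 0ℤ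
      none m z = term-elim (_≡ 0ℤ) m e z x k refl (λ d gap _ → ⊥-elim (ℕₚ.0≢1+n (trans (sym len-e) gap)))
      off : ∀ {x} → x ≢ e → ∀ k → F e x k ≡ 0ℤ
      off ne = F-short (ℕₚ.≤-trans (ℕₚ.≤-reflexive len-e) z≤n) ne
      agree : ∀ x k → op (left b) (F e) x k ≡ op (right b) (F e) x k
      agree x k with b · x ≟ x ∙ gen b
      ... | yes p = op-agree p (F e) k
      ... | no ne = trans (op-zero (left b) (F e) x (off x≢e) (off bx≢e) k) (sym (op-zero (right b) (F e) x (off x≢e) (off xb≢e) k))
        where
        x≢e : x ≢ e
        x≢e refl = ne (sym (e∙ (gen b)))
        bx≢e : b · x ≢ e
        bx≢e p = ne (trans p (sym (trans (cong (_∙ gen b) (σ-swap (left b) p)) (gen∙gen b))))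
        xb≢e : x ∙ gen b ≢ e
        xb≢e p = ne (trans (cong (b ·_) (trans (σ-swap (right b) p) (e∙ (gen b)))) (trans (invol b e) (sym p)))

    module _ (a : Gen) (v : G) (ua : Asc a v) (rec : ∀ w → len w < len (a · v) → RightRecursive w) where

      private
        av : G
        av = a · v

        module _ (b : Gen) (ub : Up (right b) av) where
          L : ℕ
          L = suc (len av)

          ρ-inv : ∀ z → len z ≤ len av → Down (right b) z → Invariant (right b) z
          ρ-inv z le = right-invariant-below (len av) rec (len z) z ℕₚ.≤-refl le b

          -- If v b were shorter than v, then a v b would have length at most l(v), although a v b >
          -- a v > v.
          vb-up : Up (right b) v
          vb-up with σ-len (right b) v
          ... | inj₁ u = u
          ... | inj₂ d = ⊥-elim (ℕₚ.<-irrefl refl (ℕₚ.<-≤-trans (ℕₚ.<-trans (ℕₚ.≤-reflexive (sym ua)) (ℕₚ.≤-reflexive (sym ub)))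
                  (ℕₚ.≤-trans (ℕₚ.≤-reflexive (cong len (·-∙ a v (gen b)))) (ℕₚ.≤-trans (len-· a (v ∙ gen b)) (ℕₚ.≤-reflexive (sym d))))))

          av-len : len v < len av
          av-len = ℕₚ.≤-reflexive (sym ua)

          λm ρm : Mirror
          λm = left a
          ρm = right b

          low : ∀ z → len z < len v → len z < len av
          low z lt = ℕₚ.<-trans lt av-len

          -- C_{a v} C_b = C_a (C_v C_b) - …, expanded with the left recursion for a v and the right recursion for v.
          op-span : InSpan L (op ρm (F av))
          op-span = span-ext
            (λ x k → trans (op-cong ρm (left-recursion a v ua) x k)
              (trans (op-minus ρm (op λm (F v)) (corr λm v) x k)
              (cong₂ _-_
                (trans (sym (op-comm a b (F v) x k))
                (trans (op-cong λm (λ x k → add-correction (op ρm (F v) x k) (corr ρm v x k) (rec v av-len b vb-up x k)) x k)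
                (trans (op-+ λm (F (v ∙ gen b)) (corr ρm v) x k)
                  (cong (op λm (F (v ∙ gen b)) x k +_) (op-sum λm (ball (len v)) (term ρm v) x k)))))
                (op-sum ρm (ball (len v)) (term λm v) x k))))
            (span-minus (span-+ (span-op λm (v ∙ gen b) 0 (left-recursive a (v ∙ gen b)) left-invariant (cong suc (trans vb-up (sym ua))))
                            (span-sum (ball (len v)) (λ z → op λm (term ρm v z)) λ z →
                              span-op-term λm ρm v z (λ _ → left-recursive a z , left-invariant) (cong suc (sym ua))))
                    (span-sum (ball (len v)) (λ z → op ρm (term λm v z)) λ z →
                      span-op-term ρm λm v z (λ lt → rec z (low z lt) b , ρ-inv z (ℕₚ.<⇒≤ (low z lt))) (cong suc (sym ua))))

          difference-span : InSpan L (λ x k → E ρm av x k - F (av ∙ gen b) x k)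
          difference-span = span-minus (span-minus op-span (span-sum (ball (len av)) (term ρm av) (λ z → span-term ρm av z 0 refl)))
            (span-even (av ∙ gen b) 0 ub)

          -- Both sides are 1 at `av ∙ gen b` and obey the degree bound elsewhere; hence their
          -- difference obeys the bound everywhere, as `span-unique` demands.
          difference-small : ∀ x k → L ≤ k ℕ.+ k ℕ.+ len x → E ρm av x k - F (av ∙ gen b) x k ≡ 0ℤ
          difference-small x k bound with x ≟ av ∙ gen b | E-normalised ρm av ub (λ w _ → normalised w) (λ z lt → ρ-inv z (ℕₚ.<⇒≤ lt))
          ... | yes refl | top , _ = trans (cong₂ _-_ (top k) (proj₁ (normalised (av ∙ gen b)) k)) (ℤₚ.+-inverseʳ (δ k))
          ... | no ne | _ , deg = cong₂ _-_ (deg x k ne bound) (proj₂ (normalised (av ∙ gen b)) x k ne (ℕₚ.≤-trans (ℕₚ.≤-reflexive ub) bound))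

      right-recursion-step : RightRecursive av
      right-recursion-step b ub x k = sym (ℤₚ.i-j≡0⇒i≡j _ _ (span-unique (difference-span b ub) (difference-small b ub) x k))

    right-recursions : ∀ n v → len v < n → RightRecursive v
    right-recursions (suc n) v (s≤s le) = go (len v) refl
      where
      go : ∀ l → len v ≡ l → RightRecursive v
      go zero eq = subst RightRecursive (sym (len-0 eq)) right-recursion-e
      go (suc l) eq with has-descent v eq
      ... | a , d = subst RightRecursive (invol a v) (right-recursion-step a (a · v) (asc-· d)
              (λ w lt → right-recursions n w (ℕₚ.<-≤-trans (subst (λ y → len w < len y) (invol a v) lt) le)))

  right-recursive : ∀ b v → Recursive (right b) v
  right-recursive b v = right-recursions (suc (len v)) v ℕₚ.≤-refl b

  right-invariant : ∀ {b w} → Down (right b) w → Invariant (right b) w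
  right-invariant {b} {w} = right-invariant-below (len w) (λ v _ b → right-recursive b v) (len w) w ℕₚ.≤-refl ℕₚ.≤-refl b

-- Vanishing of μ and the string relation.

module Strings (M : Model) (P : Word → Word → Poly) (K : IsKL P) where
  open Model M
  open Group M
  open Bruhat M
  open KL M P K
  open RightRecursion M P K

  μ-neighbour : ∀ m {x w} → Invariant m w → Up m x → σ m x ≡ w → μ x w ≡ 1ℤ
  μ-neighbour m {x} inv u refl = trans (μ-odd 0 u) (trans (sym (inv x 0)) (proj₁ (normalised (σ m x)) 0))

  -- By invariance P_{x,w} = P_{σx,w}, and since σ x is longer than x, the degree that defines
  -- μ(x,w) is beyond the bound for σ x.
  μ-far : ∀ m {x w} → Invariant m w → Up m x → σ m x ≢ w → μ x w ≡ 0ℤ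
  μ-far m {x} {w} inv u ne with μ-view x w
  ... | inj₁ p = p
  ... | inj₂ (d , gap) = trans (μ-odd d gap) (trans (sym (inv x d)) (proj₂ (normalised w) (σ m x) d ne
          (ℕₚ.≤-reflexive (trans gap (trans (sym (ℕₚ.+-suc (d ℕ.+ d) (len x))) (cong (d ℕ.+ d ℕ.+_) (sym u)))))))

  record Symmetric (m : Mirror) : Set where
    field
      recursive : ∀ v → Recursive m v
      invariant : ∀ {w} → Down m w → Invariant m w

  left-symmetric : ∀ a → Symmetric (left a)
  left-symmetric a = record { recursive = left-recursive a ; invariant = left-invariant }

  right-symmetric : ∀ b → Symmetric (right b)
  right-symmetric b = record { recursive = right-recursive b ; invariant = right-invariant }

  -- Lusztig's strings x, s x, t s x in a coset of the dihedral group generated by two mirrors with (s t)⁴ = 1.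
  module _ (m-s m-t : Mirror) (sym-s : Symmetric m-s) (sym-t : Symmetric m-t) where
    private
      S T : G → G
      S = σ m-s
      T = σ m-t
      open Symmetric

    -- `T x` is the shortest element of the dihedral coset and S T S x the longest; the string x, S
    -- x, T S x lies strictly between them.
    record StringHead (x : G) : Set where
      field
        down-t   : Down m-t x
        up-s     : Up m-s x
        up-s-t   : Up m-s (T x)
        up-t-s   : Up m-t (S x)
        up-s-t-s : Up m-s (T (S x))

    module _ {x y : G} (hx : StringHead x) (hy : StringHead y) (k : ℕ) (gap : OddGap x y k) where
      private
        module X = StringHead hx
        module Y = StringHead hy

        gap₂ : OddGap (S x) (S y) k
        gap₂ = trans Y.up-s (trans (cong suc gap) (trans (cong suc (sym (ℕₚ.+-suc (k ℕ.+ k) (len x)))) (cong (suc (k ℕ.+ k) ℕ.+_) (sym X.up-s))))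

        len-TSx : len (T (S x)) ≡ suc (suc (len x))
        len-TSx = trans X.up-t-s (cong suc X.up-s)

        Ty-excluded : ∀ {z} → Up m-t z → Down m-s z → T z ≢ y
        Ty-excluded {z} uz dz p = asc∧desc (subst (Up m-s) (sym (σ-swap m-t p)) Y.up-s-t) dz

        -- No `z` with descent s survives. If t is an ascent of z, a nonzero μ(z,y) forces z = T y,
        -- of which s is an ascent. If t is a descent, P_{Sx,z} = P_{TSx,z} is needed beyond its
        -- degree bound, and z ≠ T S x because s is an ascent of T S x.
        middle-corr : corr m-s y (S x) k ≡ 0ℤ
        middle-corr = sum-zero (ball (len y)) λ z _ → term-elim (_≡ 0ℤ) m-s y z (S x) k refl λ d g dz → vanish′ z d g dz (σ-len m-t z)
          where
          vanish′ : ∀ z d → OddGap z y d → Down m-s z → Up m-t z ⊎ Down m-t z → μ z y * shift (suc d) (F z (S x)) k ≡ 0ℤ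
          vanish′ z d g dz (inj₁ uz) = cong (_* shift (suc d) (F z (S x)) k)
            (μ-far m-t (invariant sym-t Y.down-t) uz (Ty-excluded uz dz))
          vanish′ z d g dz (inj₂ dt) = *-0 {μ z y} (shift-elim {_≡ 0ℤ} (suc d) (F z (S x)) k refl λ k′ e →
            trans (sym (invariant sym-t dt (S x) k′)) (proj₂ (normalised z) (T (S x)) k′
              (λ p → asc∧desc X.up-s-t-s (subst (Down m-s) (sym p) dz)) (ℕₚ.≤-reflexive (bound k′ e))))
            where
            arith : ∀ d k l → suc ((suc d ℕ.+ k) ℕ.+ (suc d ℕ.+ k)) ℕ.+ l ≡ suc (d ℕ.+ d) ℕ.+ (k ℕ.+ k ℕ.+ suc (suc l))
            arith = ℕSolver.solve-∀
            bound : ∀ k′ → k ≡ suc d ℕ.+ k′ → len z ≡ k′ ℕ.+ k′ ℕ.+ len (T (S x))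
            bound k′ refl = ℕₚ.+-cancelˡ-≡ (suc (d ℕ.+ d)) (len z) _
              (trans (sym g) (trans gap (trans (arith d k′ (len x)) (cong (λ n → suc (d ℕ.+ d) ℕ.+ (k′ ℕ.+ k′ ℕ.+ n)) (sym len-TSx)))))

        -- Invariance under t replaces S x by T S x, and its two letters more than x match the
        -- degree lowered by one. For k = 0 the element T S x is longer than y, and both sides are
        -- zero.
        middle-shift : ∀ k → OddGap x y k → shift 1 (F y (S x)) k ≡ μ (T (S x)) y
        middle-shift zero g with μ-view (T (S x)) y
        ... | inj₁ p = sym p
        ... | inj₂ (d , g′) = ⊥-elim (ℕₚ.<-irrefl (trans (sym g) g′)
                (s≤s (ℕₚ.≤-trans (ℕₚ.≤-trans (ℕₚ.n≤1+n _) (ℕₚ.≤-reflexive (sym len-TSx))) (ℕₚ.m≤n+m _ (d ℕ.+ d)))))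
        middle-shift (suc k) g = trans (sym (invariant sym-t Y.down-t (S x) k))
          (sym (μ-odd k (trans g (trans (arith k (len x)) (cong (suc (k ℕ.+ k) ℕ.+_) (sym len-TSx))))))
          where
          arith : ∀ k l → suc (suc k ℕ.+ suc k) ℕ.+ l ≡ suc (k ℕ.+ k) ℕ.+ suc (suc l)
          arith = ℕSolver.solve-∀

        middle : μ (S x) (S y) ≡ μ x y + μ (T (S x)) y
        middle = trans (μ-odd k gap₂) (trans (recursive sym-s y Y.up-s (S x) k) (trans
          (cong₂ _-_ (trans (op-down m-s (F y) k (down-σ m-s X.up-s))
              (cong₂ _+_ (trans (cong (λ v → F y v k) (σ-invol m-s x)) (sym (μ-odd k gap))) (middle-shift k gap)))
            middle-corr) (ℤₚ.+-identityʳ _)))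

        y₂ y₃ : G
        y₂ = S y
        y₃ = T (S y)

        len-y₂ : len y₂ ≡ suc (suc (k ℕ.+ k)) ℕ.+ len x
        len-y₂ = trans Y.up-s (cong suc gap)

        -- Only z = y contributes, with μ(y, S y) = 1.
        end-corr : corr m-t y₂ x (suc k) ≡ μ x y
        end-corr = trans (sum-single (ball-unique (len y₂)) y others
            (inj₁ (ball-complete (len y₂) (ℕₚ.≤-trans (ℕₚ.n≤1+n _) (ℕₚ.≤-reflexive (sym Y.up-s))))))
          (trans (pick-down {m = m-t} Y.down-t) (trans (cong₂ (λ c n → c * shift n (F y x) (suc k))
            (μ-neighbour m-s (invariant sym-s (down-σ m-s Y.up-s)) Y.up-s refl) (half-correction 0 Y.up-s))
            (trans (ℤₚ.*-identityˡ (F y x k)) (sym (μ-odd k gap)))))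
          where
          others : ∀ z → z ∈ ball (len y₂) → z ≢ y → term m-t y₂ z x (suc k) ≡ 0ℤ
          others z _ z≢y = term-elim (_≡ 0ℤ) m-t y₂ z x (suc k) refl λ d g dz → vanish′ d g dz (σ-len m-s z)
            where
            vanish′ : ∀ d → OddGap z y₂ d → Down m-t z → Up m-s z ⊎ Down m-s z → μ z y₂ * shift (suc d) (F z x) (suc k) ≡ 0ℤ
            vanish′ d g dz (inj₁ uz) = cong (_* shift (suc d) (F z x) (suc k))
              (μ-far m-s (invariant sym-s (down-σ m-s Y.up-s)) uz (λ p → z≢y (trans (σ-swap m-s p) (σ-invol m-s y))))
            vanish′ d g dz (inj₂ ds) = *-0 {μ z y₂} (shift-elim {_≡ 0ℤ} (suc d) (F z x) (suc k) refl λ k′ e →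
              trans (sym (invariant sym-s ds x k′)) (proj₂ (normalised z) (S x) k′
                (λ p → asc∧desc X.up-t-s (subst (Down m-t) (sym p) dz)) (ℕₚ.≤-reflexive (bound k′ (ℕₚ.suc-injective e)))))
              where
              arith : ∀ d k l → suc (suc ((d ℕ.+ k) ℕ.+ (d ℕ.+ k))) ℕ.+ l ≡ suc (d ℕ.+ d) ℕ.+ (k ℕ.+ k ℕ.+ suc l)
              arith = ℕSolver.solve-∀
              bound : ∀ k′ → k ≡ d ℕ.+ k′ → len z ≡ k′ ℕ.+ k′ ℕ.+ len (S x)
              bound k′ refl = ℕₚ.+-cancelˡ-≡ (suc (d ℕ.+ d)) (len z) _
                (trans (sym g) (trans len-y₂ (trans (arith d k′ (len x)) (cong (λ n → suc (d ℕ.+ d) ℕ.+ (k′ ℕ.+ k′ ℕ.+ n)) (sym X.up-s)))))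

        end : μ x y₃ ≡ μ (S x) y₂ - μ x y
        end = trans (μ-odd (suc k) gap₃) (trans (recursive sym-t y₂ Y.up-t-s x (suc k)) (cong₂ _-_
          (trans (op-down m-t (F y₂) (suc k) X.down-t) (trans (cong₂ _+_ bottom
            (trans (sym (invariant sym-s (down-σ m-s Y.up-s) x k)) (sym (μ-odd k gap₂)))) (ℤₚ.+-identityˡ (μ (S x) y₂)))) end-corr))
          where
          gap₃ : OddGap x y₃ (suc k)
          gap₃ = trans Y.up-t-s (trans (cong suc len-y₂) (cong (λ n → suc (suc n) ℕ.+ len x) (sym (ℕₚ.+-suc k k))))
          len-STx : len (S (T x)) ≡ len x
          len-STx = trans X.up-s-t (sym X.down-t)
          bottom : F y₂ (T x) (suc k) ≡ 0ℤ
          bottom = trans (sym (invariant sym-s (down-σ m-s Y.up-s) (T x) (suc k)))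
            (proj₂ (normalised y₂) (S (T x)) (suc k)
              (λ p → ℕₚ.<-irrefl (trans (sym len-STx) (trans (cong len p) len-y₂)) (s≤s (ℕₚ.≤-trans (ℕₚ.m≤n+m (len x) (k ℕ.+ k)) (ℕₚ.n≤1+n _))))
              (ℕₚ.≤-reflexive (trans len-y₂ (trans (cong (λ n → suc n ℕ.+ len x) (sym (ℕₚ.+-suc k k))) (cong (suc k ℕ.+ suc k ℕ.+_) (sym len-STx))))))

      -- The far corners of the 3 by 3 matrix of μ between the two strings agree: `end` and `middle`
      -- both involve the central entry, and μ(x,y) cancels.
      string-exchange : μ x (T (S y)) ≡ μ (T (S x)) y
      string-exchange = trans end (trans (cong (_- μ x y) middle) (lem (μ x y) (μ (T (S x)) y)))
        where
        lem : ∀ a b → a + b - a ≡ b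
        lem = solve-∀

-- Words of c₂: cores, prefixes, suffixes and their descents.

-- Good g stands for: g lies in the cell c₂ and has left descent set {r, t}.  Every element of c₂ is then g, s g, t s g
-- or r s g for a good g.
record Cell (M : Model) : Set₁ where
  open Model M
  field
    Good      : G → Set
    good-base : ∀ {q} → Suf q → Good (r · t · q ·· e) × len (r · t · q ·· e) ≡ 2 ℕ.+ length q
    good-step : ∀ {g} → Good g → Good (r · t · s · g)
    good-r    : ∀ {g} → Good g → Desc r g
    good-t    : ∀ {g} → Good g → Desc t g
    good-s    : ∀ {g} → Good g → Asc s g
    good-rs   : ∀ {g} → Good g → Asc r (s · g)
    good-ts   : ∀ {g} → Good g → Asc t (s · g)
    good-sts  : ∀ {g} → Good g → Asc s (t · s · g)
    good-rts  : ∀ {g} → Good g → Asc r (t · s · g)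
    good-srs  : ∀ {g} → Good g → Asc s (r · s · g)
    good-trs  : ∀ {g} → Good g → Asc t (r · s · g)
    good-st   : ∀ {g} → Good g → Asc s (t · g)
    good-sr   : ∀ {g} → Good g → Asc s (r · g)

coreWord : ℕ → Word
coreWord m = r ∷ t ∷ rep m (s ∷ r ∷ t ∷ [])

rep-commutes : ∀ m w → rep m w ++ w ≡ w ++ rep m w
rep-commutes zero    w = sym (Listₚ.++-identityʳ w)
rep-commutes (suc m) w = trans (Listₚ.++-assoc w (rep m w) w) (cong (w ++_) (rep-commutes m w))

-- Blocks srt can be split off at either end and r commutes with t, so x_m is an involution.
-- Inverting p x_m q thus only reverses and swaps prefix and suffix, which turns right descents into
-- left ones.
coreWord-reverse : ∀ m → reverse (coreWord m) ≈ coreWord m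
coreWord-reverse zero    = ≈-sym rel-rt
coreWord-reverse (suc m) = ≈-trans (≡⇒≈ (Listₚ.reverse-++ (r ∷ t ∷ s ∷ []) (coreWord m)))
  (≈-trans (≈-cong (coreWord-reverse m) (≈-cong {s ∷ []} ≈-refl (≈-sym rel-rt)))
  (≡⇒≈ (cong (λ w → r ∷ t ∷ w) (rep-commutes m (s ∷ r ∷ t ∷ [])))))

reverse-pre : ∀ {p} → Pre p → Suf (reverse p)
reverse-pre pe  = se
reverse-pre ps  = ss
reverse-pre pts = sst
reverse-pre prs = ssr

reverse-suf : ∀ {q} → Suf q → Pre (reverse q)
reverse-suf se  = pe
reverse-suf ss  = ps
reverse-suf sst = pts
reverse-suf ssr = prs

-- The left descent set of every element of c₂ with prefix `p`.
descents : ∀ {p} → Pre p → Gen → Bool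
descents pe  r = true
descents pe  s = false
descents pe  t = true
descents ps  r = false
descents ps  s = true
descents ps  t = false
descents pts r = false
descents pts s = false
descents pts t = true
descents prs r = true
descents prs s = false
descents prs t = false

descents-injective : ∀ {p p′} (c : Pre p) (c′ : Pre p′) →
  (∀ a → descents c a ≡ true → descents c′ a ≡ true) → (∀ a → descents c′ a ≡ true → descents c a ≡ true) → p ≡ p′
descents-injective pe  pe  f g = refl
descents-injective ps  ps  f g = refl
descents-injective pts pts f g = refl
descents-injective prs prs f g = refl
descents-injective pe  ps  f g with f r refl
... | ()
descents-injective pe  pts f g with f r refl
... | ()
descents-injective pe  prs f g with f t refl
... | ()
descents-injective ps  pe  f g with f s refl
... | ()
descents-injective ps  pts f g with f s refl
... | ()
descents-injective ps  prs f g with f s refl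
... | ()
descents-injective pts pe  f g with g r refl
... | ()
descents-injective pts ps  f g with f t refl
... | ()
descents-injective pts prs f g with f t refl
... | ()
descents-injective prs pe  f g with g t refl
... | ()
descents-injective prs ps  f g with f r refl
... | ()
descents-injective prs pts f g with f r refl
... | ()

-- Left cells, transport of descents, and the two cases of the theorem.

module Assembly (M : Model) (C : Cell M) (P : Word → Word → Poly) (K : IsKL P) where
  open Model M
  open Group M
  open Bruhat M
  open KL M P K
  open RightKL M P K
  open RightRecursion M P K
  open Strings M P K
  open Cell C using (Good; good-base; good-step; good-r; good-t; good-s; good-rs; good-ts; good-sts; good-rts;
    good-srs; good-trs; good-st; good-sr)

  core : ℕ → Word → G
  core m q = coreWord m ·· q ·· e

  elt : Word → ℕ → Word → G
  elt p m q = p ·· core m q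

  elt-eval : ∀ p m q → eval (p ++ coreWord m ++ q) ≡ elt p m q
  elt-eval p m q = trans (++-·· p (coreWord m ++ q) e) (cong (p ··_) (++-·· (coreWord m) q e))

  good-core : ∀ m {q} → Suf q → Good (core m q)
  good-core zero    c = proj₁ (good-base c)
  good-core (suc m) c = good-step (good-core m c)

  step-len : ∀ {g} → Good g → len (r · t · s · g) ≡ suc (suc (suc (len g)))
  step-len h = trans (good-rts h) (cong suc (trans (good-ts h) (cong suc (good-s h))))

  core-len : ∀ m {q} → Suf q → len (core m q) ≡ m ℕ.* 3 ℕ.+ (2 ℕ.+ length q)
  core-len zero    c = proj₂ (good-base c)
  core-len (suc m) c = trans (step-len (good-core m c)) (cong (λ n → suc (suc (suc n))) (core-len m c))

  pre-len : ∀ {p g} → Pre p → Good g → len (p ·· g) ≡ length p ℕ.+ len g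
  pre-len pe  h = refl
  pre-len ps  h = good-s h
  pre-len pts h = trans (good-ts h) (cong suc (good-s h))
  pre-len prs h = trans (good-rs h) (cong suc (good-s h))

  elt-len : ∀ {p} → Pre p → ∀ m {q} → Suf q → len (elt p m q) ≡ length p ℕ.+ (m ℕ.* 3 ℕ.+ (2 ℕ.+ length q))
  elt-len {p} c m d = trans (pre-len c (good-core m d)) (cong (length p ℕ.+_) (core-len m d))

  pre-desc : ∀ {p g} (c : Pre p) → Good g → ∀ a → descents c a ≡ true → Desc a (p ·· g)
  pre-desc pe  h r _ = good-r h
  pre-desc pe  h t _ = good-t h
  pre-desc ps  h s _ = desc-· (good-s h)
  pre-desc pts h t _ = desc-· (good-ts h)
  pre-desc prs h r _ = desc-· (good-rs h)
  pre-desc pe  h s ()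
  pre-desc ps  h r ()
  pre-desc ps  h t ()
  pre-desc pts h r ()
  pre-desc pts h s ()
  pre-desc prs h s ()
  pre-desc prs h t ()

  pre-asc : ∀ {p g} (c : Pre p) → Good g → ∀ a → descents c a ≡ false → Asc a (p ·· g)
  pre-asc pe  h s _ = good-s h
  pre-asc ps  h r _ = good-rs h
  pre-asc ps  h t _ = good-ts h
  pre-asc pts h r _ = good-rts h
  pre-asc pts h s _ = good-sts h
  pre-asc prs h s _ = good-srs h
  pre-asc prs h t _ = good-trs h
  pre-asc pe  h r ()
  pre-asc pe  h t ()
  pre-asc ps  h s ()
  pre-asc pts h t ()
  pre-asc prs h r ()

  pre-desc⁻ : ∀ {p g} (c : Pre p) → Good g → ∀ a → Desc a (p ·· g) → descents c a ≡ true
  pre-desc⁻ c h a d with descents c a in eq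
  ... | true  = refl
  ... | false = ⊥-elim (asc∧desc (pre-asc c h a eq) d)

  elt-inv : ∀ p m q → inv (elt p m q) ≡ elt (reverse q) m (reverse p)
  elt-inv p m q = trans (cong inv (sym (elt-eval p m q))) (trans (sym (eval-reverse (p ++ coreWord m ++ q)))
    (trans (eval-≈ reversed) (elt-eval (reverse q) m (reverse p))))
    where
    reversed : reverse (p ++ coreWord m ++ q) ≈ reverse q ++ coreWord m ++ reverse p
    reversed = ≈-trans (≡⇒≈ (trans (Listₚ.reverse-++ p (coreWord m ++ q))
      (trans (cong (_++ reverse p) (Listₚ.reverse-++ (coreWord m) q)) (Listₚ.++-assoc (reverse q) (reverse (coreWord m)) (reverse p)))))
      (≈-cong (≈-refl {reverse q}) (≈-cong (coreWord-reverse m) (≈-refl {reverse p})))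

  up-inv : ∀ {b x} → Asc b (inv x) → Up (right b) x
  up-inv {b} {x} u = trans (trans (sym (len-inv (x ∙ gen b))) (cong len (inv-∙gen b x))) (trans u (cong suc (len-inv x)))

  down-inv : ∀ {b x} → Desc b (inv x) → Down (right b) x
  down-inv {b} {x} d = trans (sym (len-inv x)) (trans d (cong suc (trans (cong len (sym (inv-∙gen b x))) (len-inv (x ∙ gen b)))))

  inv-down : ∀ {b x} → Down (right b) x → Desc b (inv x)
  inv-down {b} {x} d = trans (len-inv x) (trans d (cong suc (trans (sym (len-inv (x ∙ gen b))) (cong len (inv-∙gen b x)))))

  inv-up : ∀ {b x} → Up (right b) x → Asc b (inv x)
  inv-up {b} {x} u = trans (trans (cong len (sym (inv-∙gen b x))) (len-inv (x ∙ gen b))) (trans u (cong suc (sym (len-inv x))))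

  elt-right-down : ∀ {p} → Pre p → ∀ m {q} (d : Suf q) b → descents (reverse-suf d) b ≡ true → Down (right b) (elt p m q)
  elt-right-down {p} c m {q} d b h = down-inv (subst (Desc b) (sym (elt-inv p m q))
    (pre-desc (reverse-suf d) (good-core m (reverse-pre c)) b h))

  elt-right-up : ∀ {p} → Pre p → ∀ m {q} (d : Suf q) b → descents (reverse-suf d) b ≡ false → Up (right b) (elt p m q)
  elt-right-up {p} c m {q} d b h = up-inv (subst (Asc b) (sym (elt-inv p m q))
    (pre-asc (reverse-suf d) (good-core m (reverse-pre c)) b h))

  elt-right-down⁻ : ∀ {p} → Pre p → ∀ m {q} (d : Suf q) b → Down (right b) (elt p m q) → descents (reverse-suf d) b ≡ true
  elt-right-down⁻ {p} c m {q} d b h = pre-desc⁻ (reverse-suf d) (good-core m (reverse-pre c)) b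
    (subst (Desc b) (elt-inv p m q) (inv-down h))

  elt-∙gen : ∀ p m q b → elt p m q ∙ gen b ≡ elt p m (q ++ b ∷ [])
  elt-∙gen p m q b = trans (··-∙ p (core m q) (gen b)) (cong (p ··_) (trans (··-∙ (coreWord m) (q ·· e) (gen b))
    (cong (coreWord m ··_) (trans (eval-∙ q (gen b)) (sym (++-·· q (b ∷ []) e))))))

  elt-absorb : ∀ p m → elt p m (s ∷ r ∷ t ∷ []) ≡ elt p (suc m) []
  elt-absorb p m = cong (p ··_) (trans (sym (++-·· (coreWord m) (s ∷ r ∷ t ∷ []) e))
    (cong (λ w → r · t · w ·· e) (rep-commutes m (s ∷ r ∷ t ∷ []))))

  good-head : ∀ {g} → Good g → StringHead (left s) (left t) (left-symmetric s) (left-symmetric t) g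
  good-head h = record { down-t = good-t h ; up-s = good-s h ; up-s-t = good-st h ; up-t-s = good-ts h ; up-s-t-s = good-sts h }

  right-head : ∀ {x} a → (a ≡ t ⊎ a ≡ r) → Good (inv x) →
    StringHead (right s) (right a) (right-symmetric s) (right-symmetric a) x
  right-head {x} a which h = record
    { down-t   = down-inv (d which)
    ; up-s     = up-inv (good-s h)
    ; up-s-t   = up-inv (subst (Asc s) (sym (inv-∙gen a x)) (sa which))
    ; up-t-s   = up-inv (subst (Asc a) (sym (inv-∙gen s x)) (as which))
    ; up-s-t-s = up-inv (subst (Asc s) (sym (trans (inv-∙gen a (x ∙ gen s)) (cong (a ·_) (inv-∙gen s x)))) (sas which)) }
    where
    d : a ≡ t ⊎ a ≡ r → Desc a (inv x)
    d (inj₁ refl) = good-t h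
    d (inj₂ refl) = good-r h
    sa : a ≡ t ⊎ a ≡ r → Asc s (a · inv x)
    sa (inj₁ refl) = good-st h
    sa (inj₂ refl) = good-sr h
    as : a ≡ t ⊎ a ≡ r → Asc a (s · inv x)
    as (inj₁ refl) = good-ts h
    as (inj₂ refl) = good-rs h
    sas : a ≡ t ⊎ a ≡ r → Asc s (a · s · inv x)
    sas (inj₁ refl) = good-sts h
    sas (inj₂ refl) = good-srs h

  asc-≼ : ∀ {a x} → Asc a x → x ≼ a · x
  asc-≼ {a} {x} u = subst (λ y → Step y (a · x)) (invol a x) (down-step (desc-· u)) ◅ ε

  _≤L_ : G → G → Set
  x ≤L y = LeqL P (word x) (word y)

  word-<B : ∀ {x y} → x ≼ y → len x < len y → word x <B word y
  word-<B {x} {y} le lt = ≼⇒≤B (··-word x) (··-word y) le ,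
    λ p → ℕₚ.<-irrefl (cong len (trans (sym (··-word x)) (trans (eval-≈ p) (··-word y)))) lt

  word-LDesc : ∀ {a x} → Desc a x → LDesc a (word x)
  word-LDesc {a} {x} d = Desc⇒LDesc (subst (Desc a) (sym (··-word x)) d)

  word-¬LDesc : ∀ {a x} → Asc a x → ¬ LDesc a (word x)
  word-¬LDesc {a} {x} u la = asc∧desc u (subst (Desc a) (··-word x) (LDesc⇒Desc la))

  1≢0 : ∀ {c} → c ≡ 1ℤ → c ≢ 0ℤ
  1≢0 refl ()

  edge-up : ∀ {x y} b → x ≼ y → len x < len y → μ x y ≡ 1ℤ → Desc b x → Asc b y → x ≤L y
  edge-up {x} {y} b le lt m d u = inj₂ (word-reduced x , word-reduced y ,
    inj₁ (word-<B le lt , 1≢0 m) , b , word-LDesc d , word-¬LDesc u) ◅ ε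

  -- Removing a generator is always a step of the left order, that generator being a descent of the
  -- longer element only. Adding one needs another descent `b` that disappears.
  step-up : ∀ {x} a b → Asc a x → Desc b x → Asc b (a · x) → x ≤L (a · x)
  step-up a b u d u′ = edge-up b (asc-≼ u) (ℕₚ.≤-reflexive (sym u)) (μ-neighbour (left a) (left-invariant (desc-· u)) u refl) d u′

  step-down : ∀ {x} a → Asc a x → (a · x) ≤L x
  step-down {x} a u = inj₂ (word-reduced (a · x) , word-reduced x ,
    inj₂ (word-<B (asc-≼ u) (ℕₚ.≤-reflexive (sym u)) , 1≢0 (μ-neighbour (left a) (left-invariant (desc-· u)) u refl)) ,
    a , word-LDesc (desc-· u) , word-¬LDesc u) ◅ ε

  pre-≤L : ∀ {p g} → Pre p → Good g → (p ·· g) ≤L g × g ≤L (p ·· g)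
  pre-≤L pe  h = ε , ε
  pre-≤L ps  h = step-down s (good-s h) , step-up s r (good-s h) (good-r h) (good-rs h)
  pre-≤L pts h = step-down t (good-ts h) ◅◅ step-down s (good-s h) ,
    step-up s r (good-s h) (good-r h) (good-rs h) ◅◅ step-up t s (good-ts h) (desc-· (good-s h)) (good-sts h)
  pre-≤L prs h = step-down r (good-rs h) ◅◅ step-down s (good-s h) ,
    step-up s r (good-s h) (good-r h) (good-rs h) ◅◅ step-up r s (good-rs h) (desc-· (good-s h)) (good-srs h)

  -- No direct step leads from t s g up to g′ = r t s g, since the descent set {t} of the former
  -- lies in {r, t}. The string relation gives a detour: μ(g, t s g′) = μ(t s g, g′) = 1, and r is a
  -- descent of g but not of t s g′.
  next-≤L : ∀ {g} → Good g → (r · t · s · g) ≤L g × g ≤L (r · t · s · g)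
  next-≤L {g} h = step-down r (good-rts h) ◅◅ step-down t (good-ts h) ◅◅ step-down s (good-s h) ,
    edge-up r (g≼g′ ◅◅ asc-≼ (good-s h′) ◅◅ asc-≼ (good-ts h′)) g<
      (trans (string-exchange (left s) (left t) (left-symmetric s) (left-symmetric t) (good-head h) (good-head h′) 1 (step-len h))
             (μ-neighbour (left r) (left-invariant (good-r h′)) (good-rts h) refl))
      (good-r h) (good-rts h′)
    ◅◅ step-down t (good-ts h′) ◅◅ step-down s (good-s h′)
    where
    g′ : G
    g′ = r · t · s · g
    h′ : Good g′
    h′ = good-step h
    g≼g′ : g ≼ g′
    g≼g′ = asc-≼ (good-s h) ◅◅ asc-≼ (good-ts h) ◅◅ asc-≼ (good-rts h)
    g< : len g < len (t · s · g′)
    g< = ℕₚ.≤-trans (s≤s (ℕₚ.≤-trans (≼-len g≼g′) (ℕₚ.≤-trans (ℕₚ.n≤1+n _) (ℕₚ.≤-reflexive (sym (good-s h′))))))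
                    (ℕₚ.≤-reflexive (sym (good-ts h′)))

  core-≤L : ∀ m {q} → Suf q → core m q ≤L core 0 q × core 0 q ≤L core m q
  core-≤L zero    d = ε , ε
  core-≤L (suc m) d with core-≤L m d | next-≤L (good-core m d)
  ... | p , q | p′ , q′ = p′ ◅◅ p , q ◅◅ q′

  same-suffix-≤L : ∀ {p p′} → Pre p → Pre p′ → ∀ n m {q} → Suf q → elt p n q ≤L elt p′ m q
  same-suffix-≤L c c′ n m d = proj₁ (pre-≤L c (good-core n d)) ◅◅ proj₁ (core-≤L n d) ◅◅ proj₂ (core-≤L m d)
    ◅◅ proj₂ (pre-≤L c′ (good-core m d))

  μ-word : ∀ {x y} → IsReduced x → IsReduced y → mu P x y ≡ μ (eval x) (eval y)
  μ-word {x} {y} rx ry = trans (cong₂ (λ m n → if isOdd (n ∸ m) then P x y ⌊ n ∸ m /2⌋ else 0ℤ)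
      (trans (reduced⇒len rx) (sym (len-word (eval x)))) (trans (reduced⇒len ry) (sym (len-word (eval y)))))
    (cong (λ c → if isOdd (length (word (eval y)) ∸ length (word (eval x))) then c else 0ℤ)
      (IsKL.invariant K (≈-sym (word-eval x)) (≈-sym (word-eval y)) _))

  ¬LDesc⇒Asc : ∀ {a y} → ¬ LDesc a y → Asc a (eval y)
  ¬LDesc⇒Asc {a} {y} h with up-down a (eval y)
  ... | inj₁ u = u
  ... | inj₂ d = ⊥-elim (h (Desc⇒LDesc d))

  -- If x < y and `b` is no descent of x, then μ ≠ 0 forces y = x b, and the left descent `a` of x
  -- would persist in y. If y < x, then `a` forces x = a y, where the right descent persists because
  -- a y > y > y b.
  LStep-right : ∀ {x y} → LStep P x y → ∀ {b} → Down (right b) (eval y) → Down (right b) (eval x)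
  LStep-right (inj₁ p) {b} d = subst (Down (right b)) (sym (eval-≈ p)) d
  LStep-right {x} {y} (inj₂ (rx , ry , inj₁ (_ , ne) , a , la , nla)) {b} d with σ-len (right b) (eval x)
  ... | inj₂ d′ = d′
  ... | inj₁ u with eval x ∙ gen b ≟ eval y
  ...   | no far = ⊥-elim (ne (trans (μ-word rx ry) (μ-far (right b) (right-invariant d) u far)))
  ...   | yes p  = ⊥-elim (asc∧desc (¬LDesc⇒Asc nla) (subst (Desc a) p (left-desc-stable
            (λ q → asc∧desc (trans (cong len q) u) (LDesc⇒Desc la)) (LDesc⇒Desc la))))
  LStep-right {x} {y} (inj₂ (rx , ry , inj₂ (_ , ne) , a , la , nla)) {b} d with a · eval y ≟ eval x
  ... | no far = ⊥-elim (ne (trans (μ-word ry rx) (μ-far (left a) (left-invariant (LDesc⇒Desc la)) (¬LDesc⇒Asc nla) far)))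
  ... | yes p = subst (Down (right b)) p (right-down-stable
          (λ q → asc∧desc (¬LDesc⇒Asc nla) (trans d (cong (λ z → suc (len z)) (sym q)))) d)

  LeqL-right : ∀ {x y} → LeqL P x y → ∀ {b} → Down (right b) (eval y) → Down (right b) (eval x)
  LeqL-right ε d = d
  LeqL-right (st ◅ p) d = LStep-right st (LeqL-right p d)

  LeqR-left : ∀ {x y} → LeqR P x y → ∀ {a} → Desc a (eval y) → Desc a (eval x)
  LeqR-left {x} {y} p {a} d = subst (Desc a) (inv-rev x) (inv-down (LeqL-right p (down-inv (subst (Desc a) (sym (inv-rev y)) d))))
    where
    inv-rev : ∀ x → inv (eval (reverse x)) ≡ eval x
    inv-rev x = trans (cong inv (eval-reverse x)) (inv-invol (eval x))

  -- From y = x T comes y⁻¹ = T x⁻¹ = x⁻¹ (x T x⁻¹), and the last factor is again a reflection, with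
  -- `word x` prepended to the conjugating word.
  step-inv : ∀ {x y} → Step x y → Step (inv x) (inv y)
  step-inv {x} {y} (_ , (z , a , refl) , y≡ , lt) = eval (reflWord (word x ++ z) a) , (word x ++ z , a , refl) , product ,
    subst₂ _<_ (sym (len-inv x)) (sym (len-inv y)) lt
    where
    T W : Word
    T = reflWord z a
    W = word x ++ T
    reverse-reflWord : reverse T ≡ T
    reverse-reflWord = trans (Listₚ.reverse-++ z (a ∷ reverse z)) (trans
      (cong (_++ reverse z) (trans (Listₚ.unfold-reverse a (reverse z)) (cong (_++ a ∷ []) (Listₚ.reverse-involutive z))))
      (Listₚ.++-assoc z (a ∷ []) (reverse z)))
    product : inv y ≡ inv x ∙ eval (reflWord (word x ++ z) a)
    product = trans (cong inv (trans y≡ (trans (cong (_∙ eval T) (sym (··-word x))) (trans (eval-∙ (word x) (eval T)) (sym (++-·· (word x) T e))))))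
      (trans (sym (eval-reverse W)) (trans (cong eval (trans (Listₚ.reverse-++ (word x) T) (cong (_++ reverse (word x)) reverse-reflWord)))
      (trans (sym (reverse-·· (word x) (eval (T ++ reverse (word x)))))
      (trans (cong (reverse (word x) ··_) (trans (sym (++-·· (word x) (T ++ reverse (word x)) e)) (cong eval rearrange)))
      (sym (eval-∙ (reverse (word x)) _))))))
      where
      rearrange : word x ++ T ++ reverse (word x) ≡ reflWord (word x ++ z) a
      rearrange = trans (cong (word x ++_) (trans (Listₚ.++-assoc z (a ∷ reverse z) (reverse (word x)))
        (cong (λ v → z ++ a ∷ v) (sym (Listₚ.reverse-++ (word x) z))))) (sym (Listₚ.++-assoc (word x) z _))

  ≼-inv : ∀ {x y} → x ≼ y → inv x ≼ inv y
  ≼-inv ε = ε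
  ≼-inv (st ◅ p) = step-inv st ◅ ≼-inv p

  RDesc⇒Down : ∀ {b x} → RDesc b x → Down (right b) (eval x)
  RDesc⇒Down {b} {x} (le , ne) with σ-len (right b) (eval x)
  ... | inj₂ d = d
  ... | inj₁ u = ⊥-elim (ne (eval-injective (≼-len-≡ (≤B⇒≼ le)
          (ℕₚ.≤-trans (ℕₚ.n≤1+n _) (ℕₚ.≤-reflexive (trans (sym u) (cong len (eval-∙gen x))))))))
    where
    eval-∙gen : ∀ x → eval x ∙ gen b ≡ eval (x ++ b ∷ [])
    eval-∙gen x = trans (eval-∙ x (gen b)) (sym (++-·· x (b ∷ []) e))

  Down⇒RDesc : ∀ {b x} → Down (right b) (eval x) → RDesc b x
  Down⇒RDesc {b} {x} d = ≼⇒≤B eval-∙gen refl (subst₂ _≼_ (trans (cong inv (sym (inv-∙gen b (eval x)))) (inv-invol _)) (inv-invol (eval x))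
      (≼-inv (down-step (inv-down d) ◅ ε))) ,
    λ p → ℕₚ.1+n≢n (trans (sym d) (cong len (trans (sym (eval-≈ p)) eval-∙gen)))
    where
    eval-∙gen : eval (x ++ b ∷ []) ≡ eval x ∙ gen b
    eval-∙gen = trans (++-·· x (b ∷ []) e) (sym (eval-∙ x (gen b)))

  indicator : ℕ → ℕ → ℤ
  indicator n k = if n ≡ᵇ k then 1ℤ else 0ℤ

  indicator-≢ : ∀ {n k} → n ≢ k → indicator n k ≡ 0ℤ
  indicator-≢ {n} {k} ne with n ≡ᵇ k in eq
  ... | false = refl
  ... | true  = ⊥-elim (ne (ℕₚ.≡ᵇ⇒≡ n k (subst Bool.T (sym eq) _)))

  new-descent : ∀ {U W b} → U ≼ W → Down (right b) W → Up (right b) U → μ U W ≡ indicator (len W ∸ len U) 1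
  new-descent {U} {W} {b} le dW uU with U ∙ gen b ≟ W
  ... | yes p = trans (μ-neighbour (right b) (right-invariant dW) uU p)
        (cong (λ n → indicator n 1) (sym (trans (cong (λ w → len w ∸ len U) (sym p)) (trans (cong (_∸ len U) uU) (ℕₚ.m+n∸n≡m 1 (len U))))))
  ... | no ne = trans (μ-far (right b) (right-invariant dW) uU ne) (sym (indicator-≢ gap≢1))
    where
    gap≢1 : len W ∸ len U ≢ 1
    gap≢1 h = ne (trans (cong (_∙ gen b) U≡) (right-invol b W))
      where
      len-W : len W ≡ suc (len U)
      len-W = trans (sym (ℕₚ.m∸n+n≡m (≼-len le))) (cong (ℕ._+ len U) h)
      -- Lifting is stated for left multiplication, hence the inverses: U⁻¹ lies below b W⁻¹ and has
      -- the same length.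
      inv-U≡ : inv U ≡ b · inv W
      inv-U≡ = ≼-len-≡ (lift-asc (≼-inv le) (inv-up uU) (inv-down dW)) (ℕₚ.≤-reflexive
        (ℕₚ.suc-injective (trans (sym (inv-down dW)) (trans (len-inv W) (trans len-W (cong suc (sym (len-inv U))))))))
      U≡ : U ≡ W ∙ gen b
      U≡ = trans (sym (inv-invol U)) (trans (cong inv (trans inv-U≡ (sym (inv-∙gen b W)))) (inv-invol (W ∙ gen b)))

  -- With `d` the difference of the exponents the length gap is 3d + 2, which is 5 exactly for d =
  -- 1. The letter `a` ends the suffix; `a′` is the other one of r, t, and appending it to p x_n s a
  -- completes a block, giving p x_(n+1).
  no-new-descent : ∀ {p} → Pre p → ∀ n d {q} (c : Suf q) a a′ → (a ≡ t × a′ ≡ r ⊎ a ≡ r × a′ ≡ t) → q ≡ s ∷ a ∷ [] →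
    μ (elt p n []) (elt p (d ℕ.+ n) q) ≡ indicator (len (elt p (d ℕ.+ n) q) ∸ len (elt p n [])) 5
  no-new-descent {p} c n d e′ a a′ which refl = trans μ≡ (cong (λ k → indicator k 5) (sym gap≡))
    where
    x y w z : G
    x = elt p n []
    y = elt p (d ℕ.+ n) []
    w = elt p (d ℕ.+ n) (s ∷ a ∷ [])
    z = elt p n (s ∷ a ∷ [])

    len-x : len x ≡ length p ℕ.+ (n ℕ.* 3 ℕ.+ 2)
    len-x = elt-len c n se

    arith : ∀ p n d l → p ℕ.+ ((d ℕ.+ n) ℕ.* 3 ℕ.+ (2 ℕ.+ l)) ≡ (d ℕ.* 3 ℕ.+ l) ℕ.+ (p ℕ.+ (n ℕ.* 3 ℕ.+ 2))
    arith = ℕSolver.solve-∀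

    len-y : len y ≡ d ℕ.* 3 ℕ.+ len x
    len-y = trans (elt-len c (d ℕ.+ n) se) (trans (arith (length p) n d 0)
      (cong₂ ℕ._+_ (ℕₚ.+-identityʳ (d ℕ.* 3)) (sym len-x)))

    len-w : len w ≡ (d ℕ.* 3 ℕ.+ 2) ℕ.+ len x
    len-w = trans (elt-len c (d ℕ.+ n) e′) (trans (arith (length p) n d 2) (cong (d ℕ.* 3 ℕ.+ 2 ℕ.+_) (sym len-x)))

    gap≡ : len w ∸ len x ≡ d ℕ.* 3 ℕ.+ 2
    gap≡ = trans (cong (_∸ len x) len-w) (ℕₚ.m+n∸n≡m (d ℕ.* 3 ℕ.+ 2) (len x))

    good-inverse : ∀ m → Good (inv (elt p m []))
    good-inverse m = subst Good (sym (elt-inv p m [])) (good-core m (reverse-pre c))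

    which₁ : a ≡ t ⊎ a ≡ r
    which₁ = [ (λ h → inj₁ (proj₁ h)) , (λ h → inj₂ (proj₁ h)) ]′ which

    end-of-string : ∀ m → σ (right a) (σ (right s) (elt p m [])) ≡ elt p m (s ∷ a ∷ [])
    end-of-string m = trans (cong (_∙ gen a) (elt-∙gen p m [] s)) (elt-∙gen p m (s ∷ []) a)

    a′-up : Up (right a′) z
    a′-up = elt-right-up c n e′ a′ (not-descent which e′)
      where
      not-descent : ∀ {a} → (a ≡ t × a′ ≡ r ⊎ a ≡ r × a′ ≡ t) → (e′ : Suf (s ∷ a ∷ [])) → descents (reverse-suf e′) a′ ≡ false
      not-descent (inj₁ (refl , refl)) sst = refl
      not-descent (inj₂ (refl , refl)) ssr = refl

    a′-down : Down (right a′) y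
    a′-down = elt-right-down c (d ℕ.+ n) se a′ (is-descent which)
      where
      is-descent : ∀ {a} → (a ≡ t × a′ ≡ r ⊎ a ≡ r × a′ ≡ t) → descents (reverse-suf se) a′ ≡ true
      is-descent (inj₁ (_ , refl)) = refl
      is-descent (inj₂ (_ , refl)) = refl

    z-a′ : z ∙ gen a′ ≡ elt p (suc n) []
    z-a′ = trans (elt-∙gen p n (s ∷ a ∷ []) a′) (trans (cong (λ v → p ·· coreWord n ·· s · v) (order which)) (elt-absorb p n))
      where
      order : ∀ {a} → (a ≡ t × a′ ≡ r ⊎ a ≡ r × a′ ≡ t) → a · a′ · e ≡ r · t · e
      order (inj₁ (refl , refl)) = sym (eval-≈ rel-rt)
      order (inj₂ (refl , refl)) = refl

    adjacent : μ z y ≡ indicator (d ℕ.* 3 ℕ.+ 2) 5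
    adjacent with d ℕₚ.≟ 1
    ... | yes refl = μ-neighbour (right a′) (right-invariant a′-down) a′-up z-a′
    ... | no d≢1 = trans (μ-far (right a′) (right-invariant a′-down) a′-up λ h →
            d≢1 (ℕₚ.*-cancelʳ-≡ d 1 3 (ℕₚ.+-cancelʳ-≡ (len x) (d ℕ.* 3) 3 (trans (sym len-y)
              (trans (cong len (trans (sym h) z-a′)) (trans (elt-len c (suc n) se) (trans (arith (length p) n 1 0) (cong (3 ℕ.+_) (sym len-x)))))))))
          (sym (indicator-≢ λ h → d≢1 (ℕₚ.*-cancelʳ-≡ d 1 3 (ℕₚ.+-cancelʳ-≡ 2 (d ℕ.* 3) 3 h))))

    μ≡ : μ x w ≡ indicator (d ℕ.* 3 ℕ.+ 2) 5
    μ≡ = by-parity (d ℕ.* 3) refl (parity (d ℕ.* 3))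
      where
      -- The string relation wants an odd gap 3d between the heads of the strings. For even 3d the
      -- gap 3d + 2 is even as well, so μ = 0 and the gap is not 5.
      by-parity : ∀ k → d ℕ.* 3 ≡ k → Parity k → μ x w ≡ indicator (d ℕ.* 3 ℕ.+ 2) 5
      by-parity _ eq (odd k) = trans (cong (μ x) (sym (end-of-string (d ℕ.+ n))))
        (trans (string-exchange (right s) (right a) (right-symmetric s) (right-symmetric a)
            (right-head a which₁ (good-inverse n)) (right-head a which₁ (good-inverse (d ℕ.+ n))) k (trans len-y (cong (ℕ._+ len x) eq)))
        (trans (cong (λ v → μ v y) (end-of-string n)) adjacent))
      by-parity _ eq (even k) = trans (μ-def x w) (trans (cong (λ n → if isOdd n then F w x ⌊ n /2⌋ else 0ℤ) (trans gap≡ even-gap))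
        (trans (cong (λ b → if b then F w x ⌊ suc k ℕ.+ suc k /2⌋ else 0ℤ) (isOdd-double (suc k)))
        (sym (indicator-≢ {d ℕ.* 3 ℕ.+ 2} {5} λ h → true≢false (trans (sym (cong isOdd h)) (trans (cong isOdd even-gap) (isOdd-double (suc k))))))))
        where
        even-gap : d ℕ.* 3 ℕ.+ 2 ≡ suc k ℕ.+ suc k
        even-gap = trans (cong (ℕ._+ 2) eq) (trans (ℕₚ.+-comm (k ℕ.+ k) 2) (cong suc (sym (ℕₚ.+-suc k k))))
        true≢false : true ≢ false
        true≢false ()

  theorem : ∀ u w → IsReduced u → IsReduced w → InC2 u → InC2 w →
    u ≤B w → SimR P u w → ¬ SimL P u w →
    ((¬ RSub w u) → mu P u w ≡ (if (length w ∸ length u) ≡ᵇ 1 then 1ℤ else 0ℤ)) ×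
    (RSub w u → mu P u w ≡ (if (length w ∸ length u) ≡ᵇ 5 then 1ℤ else 0ℤ))
  theorem u w ru rw (p , q , n , cp , cq , u≈) (p′ , q′ , m , cp′ , cq′ , w≈) u≤w (u≤Rw , w≤Ru) u≁Lw = part₁ , part₂
    where
    U W : G
    U = elt p n q
    W = elt p′ m q′
    u≡ : eval u ≡ U
    u≡ = trans (eval-≈ u≈) (elt-eval p n q)
    w≡ : eval w ≡ W
    w≡ = trans (eval-≈ w≈) (elt-eval p′ m q′)
    U≼W : U ≼ W
    U≼W = subst₂ _≼_ u≡ w≡ (≤B⇒≼ u≤w)

    reduce : ∀ k → μ U W ≡ indicator (len W ∸ len U) k → mu P u w ≡ indicator (length w ∸ length u) k
    reduce k h = trans (μ-word ru rw) (trans (cong₂ μ u≡ w≡) (trans h (cong₂ (λ a b → indicator (a ∸ b) k)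
      (trans (cong len (sym w≡)) (sym (reduced⇒len rw))) (trans (cong len (sym u≡)) (sym (reduced⇒len ru))))))

    p≡p′ : p ≡ p′
    p≡p′ = descents-injective cp cp′
      (λ a h → pre-desc⁻ cp′ (good-core m cq′) a (subst (Desc a) w≡ (LeqR-left {w} {u} w≤Ru (subst (Desc a) (sym u≡) (pre-desc cp (good-core n cq) a h)))))
      (λ a h → pre-desc⁻ cp (good-core n cq) a (subst (Desc a) u≡ (LeqR-left {u} {w} u≤Rw (subst (Desc a) (sym w≡) (pre-desc cp′ (good-core m cq′) a h)))))

    q≢q′ : q ≢ q′
    q≢q′ refl = u≁Lw (leq u≡ w≡ (same-suffix-≤L cp cp′ n m cq) , leq w≡ u≡ (same-suffix-≤L cp′ cp m n cq))
      where
      leq : ∀ {x y v v′} → eval v ≡ x → eval v′ ≡ y → x ≤L y → LeqL P v v′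
      leq {x} {y} {v} {v′} refl refl h = inj₁ (≈-sym (word-eval v)) ◅ h ◅◅ (inj₁ (word-eval v′) ◅ ε)

    part₁ : ¬ RSub w u → mu P u w ≡ indicator (length w ∸ length u) 1
    part₁ ¬sub = reduce 1 (go (try r) (try s) (try t))
      where
      Witness : Gen → Set
      Witness b = Down (right b) W × Up (right b) U
      Contained : Gen → Set
      Contained b = RDesc b w → RDesc b u
      try : ∀ b → Witness b ⊎ Contained b
      try b with σ-len (right b) W | σ-len (right b) U
      ... | inj₂ dW | inj₁ uU = inj₁ (dW , uU)
      ... | inj₁ uW | _ = inj₂ (λ rd → ⊥-elim (asc∧desc uW (subst (Down (right b)) w≡ (RDesc⇒Down rd))))
      ... | inj₂ _  | inj₂ dU = inj₂ (λ _ → Down⇒RDesc (subst (Down (right b)) (sym u≡) dU))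
      go : Witness r ⊎ Contained r → Witness s ⊎ Contained s → Witness t ⊎ Contained t →
        μ U W ≡ indicator (len W ∸ len U) 1
      go (inj₁ (d , u)) _ _ = new-descent U≼W d u
      go _ (inj₁ (d , u)) _ = new-descent U≼W d u
      go _ _ (inj₁ (d , u)) = new-descent U≼W d u
      go (inj₂ cr) (inj₂ cs) (inj₂ ct) = ⊥-elim (¬sub λ { r → cr ; s → cs ; t → ct })

    part₂ : RSub w u → mu P u w ≡ indicator (length w ∸ length u) 5
    part₂ sub = reduce 5 (go cq cq′ q≢q′ included p≡p′ n≤m refl refl)
      where
      included : ∀ b → descents (reverse-suf cq′) b ≡ true → descents (reverse-suf cq) b ≡ true
      included b h = elt-right-down⁻ cp n cq b (subst (Down (right b)) u≡ (RDesc⇒Down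
        (sub b (Down⇒RDesc (subst (Down (right b)) (sym w≡) (elt-right-down cp′ m cq′ b h))))))

      -- The suffix of w has at most two letters more than that of u, so comparing lengths gives 3n
      -- ≤ 3m + 2.
      n≤m : p ≡ p′ → length q′ ≤ 2 ℕ.+ length q → n ≤ m
      n≤m refl q′≤ = ℕₚ.≮⇒≥ λ m<n → ℕₚ.<⇒≱ (ℕₚ.≤-<-trans (ℕₚ.+-monoʳ-≤ (m ℕ.* 3) (s≤s (s≤s q′≤)))
          (ℕₚ.<-≤-trans (ℕₚ.≤-reflexive (arith m (length q))) (ℕₚ.+-monoˡ-≤ (2 ℕ.+ length q) (ℕₚ.*-monoˡ-≤ 3 m<n))))
        (ℕₚ.+-cancelˡ-≤ (length p) _ _ (subst₂ _≤_ (elt-len cp n cq) (elt-len cp′ m cq′) (≼-len U≼W)))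
        where
        arith : ∀ m l → suc (m ℕ.* 3 ℕ.+ (4 ℕ.+ l)) ≡ (suc m) ℕ.* 3 ℕ.+ (2 ℕ.+ l)
        arith = ℕSolver.solve-∀

      string : ∀ {q″} (c : Suf q″) a a′ → (a ≡ t × a′ ≡ r ⊎ a ≡ r × a′ ≡ t) → q″ ≡ s ∷ a ∷ [] → p ≡ p′ → n ≤ m →
        μ (elt p n []) (elt p′ m q″) ≡ indicator (len (elt p′ m q″) ∸ len (elt p n [])) 5
      string {q″} c a a′ which e refl le = subst (λ k → μ (elt p n []) (elt p k q″) ≡ indicator (len (elt p k q″) ∸ len (elt p n [])) 5)
        (ℕₚ.m∸n+n≡m le) (no-new-descent cp n (m ∸ n) c a a′ which e)

      go : ∀ {q₁ q₂} (c₁ : Suf q₁) (c₂ : Suf q₂) → q₁ ≢ q₂ →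
        (∀ b → descents (reverse-suf c₂) b ≡ true → descents (reverse-suf c₁) b ≡ true) → p ≡ p′ →
        (p ≡ p′ → length q₂ ≤ 2 ℕ.+ length q₁ → n ≤ m) → q ≡ q₁ → q′ ≡ q₂ →
        μ (elt p n q₁) (elt p′ m q₂) ≡ indicator (len (elt p′ m q₂) ∸ len (elt p n q₁)) 5
      go se sst ne inc pp le _ _ = string sst t r (inj₁ (refl , refl)) refl pp (le pp (s≤s (s≤s z≤n)))
      go se ssr ne inc pp le _ _ = string ssr r t (inj₂ (refl , refl)) refl pp (le pp (s≤s (s≤s z≤n)))
      go se  se  ne = ⊥-elim (ne refl)
      go ss  ss  ne = ⊥-elim (ne refl)
      go sst sst ne = ⊥-elim (ne refl)
      go ssr ssr ne = ⊥-elim (ne refl)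
      go se  ss  ne inc with inc s refl
      ... | ()
      go ss  se  ne inc with inc r refl
      ... | ()
      go ss  sst ne inc with inc t refl
      ... | ()
      go ss  ssr ne inc with inc r refl
      ... | ()
      go sst se  ne inc with inc r refl
      ... | ()
      go sst ss  ne inc with inc s refl
      ... | ()
      go sst ssr ne inc with inc r refl
      ... | ()
      go ssr se  ne inc with inc t refl
      ... | ()
      go ssr ss  ne inc with inc s refl
      ... | ()
      go ssr sst ne inc with inc t refl
      ... | ()

-- The alcove model of type B̃₂.

module Alcoves where
  open import Data.Integer using (+_; -[1+_]; ∣_∣)

  -- The walls are the lines on which x, y, x + y or y - x is an integer. The coordinates are i =
  -- floor x and j = floor y; with the carries `β` and `γ` they give `kx` = floor (x + y) and `ky` =
  -- floor (y - x). The fundamental alcove is 0 < x < y < 1 - x.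
  record Alcove : Set where
    constructor alc
    field
      i j : ℤ
      β γ : Bool

  open Alcove public

  bit : Bool → ℤ
  bit true  = 1ℤ
  bit false = 0ℤ

  kx ky : Alcove → ℤ
  kx (alc i j β γ) = i ℤ.+ j ℤ.+ bit β
  ky (alc i j β γ) = j ℤ.- i ℤ.- bit γ

  -- Effect on strip numbers of the reflection in the wall at 0; `flip₁` belongs to the wall at 1.
  flip₀ : ℤ → ℤ
  flip₀ (+ n)    = -[1+ n ]
  flip₀ -[1+ n ] = + n

  flip₁ : ℤ → ℤ
  flip₁ (+ 0)             = + 1
  flip₁ (+ 1)             = + 0
  flip₁ (+ suc (suc n))   = -[1+ n ]
  flip₁ -[1+ n ]          = + suc (suc n)

  infixr 6 _▹_ _▹*_

  -- The reflections in x + y = 1, x = 0 and x = y, the walls of the fundamental alcove.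
  _▹_ : Gen → Alcove → Alcove
  r ▹ alc i j β γ = alc (ℤ.- j) (ℤ.- i) (not β) γ
  s ▹ alc i j β γ = alc (flip₀ i) j (not γ) (not β)
  t ▹ alc i j β γ = alc j i β (not γ)

  _▹*_ : Word → Alcove → Alcove
  w ▹* g = foldr _▹_ g w

  𝟏 : Alcove
  𝟏 = alc 0ℤ 0ℤ false false

  ℓ : Alcove → ℕ
  ℓ g = ∣ kx g ∣ ℕ.+ ∣ ky g ∣ ℕ.+ (∣ i g ∣ ℕ.+ ∣ j g ∣)

  flip₀-def : ∀ k → flip₀ k ≡ ℤ.- 1ℤ ℤ.- k
  flip₀-def (+ 0)       = refl
  flip₀-def (+ suc n)   = refl
  flip₀-def -[1+ n ] = refl

  flip₁-def : ∀ k → flip₁ k ≡ 1ℤ ℤ.- k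
  flip₁-def (+ 0)             = refl
  flip₁-def (+ 1)             = refl
  flip₁-def (+ suc (suc n))   = refl
  flip₁-def -[1+ n ]          = refl

  bit-not : ∀ b → bit (not b) ≡ 1ℤ ℤ.- bit b
  bit-not true  = refl
  bit-not false = refl

  kx-r : ∀ g → kx (r ▹ g) ≡ flip₁ (kx g)
  kx-r (alc i j β γ) = trans (cong (λ b → ℤ.- j ℤ.+ ℤ.- i ℤ.+ b) (bit-not β))
    (trans (lem i j (bit β)) (sym (flip₁-def _)))
    where
    lem : ∀ i j e → ℤ.- j ℤ.+ ℤ.- i ℤ.+ (1ℤ ℤ.- e) ≡ 1ℤ ℤ.- (i ℤ.+ j ℤ.+ e)
    lem = solve-∀

  ky-r : ∀ g → ky (r ▹ g) ≡ ky g
  ky-r (alc i j β γ) = lem i j (bit γ)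
    where
    lem : ∀ i j d → ℤ.- i ℤ.- (ℤ.- j) ℤ.- d ≡ j ℤ.- i ℤ.- d
    lem = solve-∀

  kx-t : ∀ g → kx (t ▹ g) ≡ kx g
  kx-t (alc i j β γ) = cong (ℤ._+ bit β) (ℤₚ.+-comm j i)

  ky-t : ∀ g → ky (t ▹ g) ≡ flip₀ (ky g)
  ky-t (alc i j β γ) = trans (cong (λ b → i ℤ.- j ℤ.- b) (bit-not γ))
    (trans (lem i j (bit γ)) (sym (flip₀-def _)))
    where
    lem : ∀ i j d → i ℤ.- j ℤ.- (1ℤ ℤ.- d) ≡ ℤ.- 1ℤ ℤ.- (j ℤ.- i ℤ.- d)
    lem = solve-∀

  kx-s : ∀ g → kx (s ▹ g) ≡ ky g
  kx-s (alc i j β γ) = trans (cong₂ (λ f b → f ℤ.+ j ℤ.+ b) (flip₀-def i) (bit-not γ)) (lem i j (bit γ))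
    where
    lem : ∀ i j d → (ℤ.- 1ℤ ℤ.- i) ℤ.+ j ℤ.+ (1ℤ ℤ.- d) ≡ j ℤ.- i ℤ.- d
    lem = solve-∀

  ky-s : ∀ g → ky (s ▹ g) ≡ kx g
  ky-s (alc i j β γ) = trans (cong₂ (λ f b → j ℤ.- f ℤ.- b) (flip₀-def i) (bit-not β)) (lem i j (bit β))
    where
    lem : ∀ i j e → j ℤ.- (ℤ.- 1ℤ ℤ.- i) ℤ.- (1ℤ ℤ.- e) ≡ i ℤ.+ j ℤ.+ e
    lem = solve-∀

  flip₀-invol : ∀ k → flip₀ (flip₀ k) ≡ k
  flip₀-invol (+ n)    = refl
  flip₀-invol -[1+ n ] = refl

  not-invol : ∀ b → not (not b) ≡ b
  not-invol true  = refl
  not-invol false = refl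

  alc≡ : ∀ {i i′ j j′ β β′ γ γ′} → i ≡ i′ → j ≡ j′ → β ≡ β′ → γ ≡ γ′ → alc i j β γ ≡ alc i′ j′ β′ γ′
  alc≡ refl refl refl refl = refl

  ▹-invol : ∀ a g → a ▹ a ▹ g ≡ g
  ▹-invol r (alc i j β γ) = alc≡ (ℤₚ.neg-involutive i) (ℤₚ.neg-involutive j) (not-invol β) refl
  ▹-invol s (alc i j β γ) = alc≡ (flip₀-invol i) refl (not-invol β) (not-invol γ)
  ▹-invol t (alc i j β γ) = alc≡ refl refl refl (not-invol γ)

  braid-st : ∀ g → s ▹ t ▹ s ▹ t ▹ g ≡ t ▹ s ▹ t ▹ s ▹ g
  braid-st g = refl

  braid-rs : ∀ g → r ▹ s ▹ r ▹ s ▹ g ≡ s ▹ r ▹ s ▹ r ▹ g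
  braid-rs (alc i j β γ) = alc≡ (lem i) refl refl refl
    where
    lem : ∀ i → ℤ.- (ℤ.- flip₀ i) ≡ flip₀ (ℤ.- (ℤ.- i))
    lem i = trans (ℤₚ.neg-involutive (flip₀ i)) (cong flip₀ (sym (ℤₚ.neg-involutive i)))

  -- The strip number across the wall of `a`, oriented so that `a` acts by `flip₀`: it is negative
  -- exactly when that wall separates the alcove from `𝟏`. The sign for `r` turns its wall at 1 into
  -- one at 0.
  height : Gen → Alcove → ℤ
  height r g = ℤ.- kx g
  height s g = i g
  height t g = ky g

  flip₁-neg : ∀ k → ℤ.- flip₁ k ≡ flip₀ (ℤ.- k)
  flip₁-neg (+ 0)           = refl
  flip₁-neg (+ 1)           = refl
  flip₁-neg (+ suc (suc n)) = refl
  flip₁-neg -[1+ n ]        = refl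

  height-▹ : ∀ a g → height a (a ▹ g) ≡ flip₀ (height a g)
  height-▹ r g = trans (cong ℤ.-_ (kx-r g)) (flip₁-neg (kx g))
  height-▹ s g = refl
  height-▹ t g = ky-t g

  -- The counts in the three directions other than that of `a`, which the reflection merely
  -- permutes; the length changes in the fourth direction alone.
  otherWalls : Gen → Alcove → ℕ
  otherWalls r g = ∣ ky g ∣ ℕ.+ (∣ i g ∣ ℕ.+ ∣ j g ∣)
  otherWalls s g = ∣ kx g ∣ ℕ.+ ∣ ky g ∣ ℕ.+ ∣ j g ∣
  otherWalls t g = ∣ kx g ∣ ℕ.+ (∣ i g ∣ ℕ.+ ∣ j g ∣)

  otherWalls-▹ : ∀ a g → otherWalls a (a ▹ g) ≡ otherWalls a g
  otherWalls-▹ r g rewrite ky-r g | ℤₚ.∣-i∣≡∣i∣ (i g) | ℤₚ.∣-i∣≡∣i∣ (j g) =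
    cong (∣ ky g ∣ ℕ.+_) (ℕₚ.+-comm (∣ j g ∣) (∣ i g ∣))
  otherWalls-▹ s g rewrite kx-s g | ky-s g = cong (ℕ._+ ∣ j g ∣) (ℕₚ.+-comm (∣ ky g ∣) (∣ kx g ∣))
  otherWalls-▹ t g rewrite kx-t g = cong (∣ kx g ∣ ℕ.+_) (ℕₚ.+-comm (∣ j g ∣) (∣ i g ∣))

  ℓ-split : ∀ a g → ℓ g ≡ ∣ height a g ∣ ℕ.+ otherWalls a g
  ℓ-split r g rewrite ℤₚ.∣-i∣≡∣i∣ (kx g) = ℕₚ.+-assoc (∣ kx g ∣) (∣ ky g ∣) _
  ℓ-split s g = lem (∣ kx g ∣) (∣ ky g ∣) (∣ i g ∣) (∣ j g ∣)
    where
    lem : ∀ a b c d → a ℕ.+ b ℕ.+ (c ℕ.+ d) ≡ c ℕ.+ (a ℕ.+ b ℕ.+ d)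
    lem = ℕSolver.solve-∀
  ℓ-split t g = lem (∣ kx g ∣) (∣ ky g ∣) (∣ i g ∣ ℕ.+ ∣ j g ∣)
    where
    lem : ∀ a b c → a ℕ.+ b ℕ.+ c ≡ b ℕ.+ (a ℕ.+ c)
    lem = ℕSolver.solve-∀

  ℓ-▹ : ∀ a g → ℓ (a ▹ g) ≡ ∣ flip₀ (height a g) ∣ ℕ.+ otherWalls a g
  ℓ-▹ a g = trans (ℓ-split a (a ▹ g)) (cong₂ (λ h o → ∣ h ∣ ℕ.+ o) (height-▹ a g) (otherWalls-▹ a g))

  height≥0⇒up : ∀ a g → 0ℤ ℤ.≤ height a g → ℓ (a ▹ g) ≡ suc (ℓ g)
  height≥0⇒up a g h with height a g | ℓ-split a g | ℓ-▹ a g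
  ... | + n | e | e′ = trans e′ (cong suc (sym e))

  height<0⇒down : ∀ a g → height a g ℤ.< 0ℤ → ℓ g ≡ suc (ℓ (a ▹ g))
  height<0⇒down a g h with height a g | ℓ-split a g | ℓ-▹ a g
  ... | -[1+ n ] | e | e′ = trans e (cong suc (sym e′))
  ... | + n | e | e′ = ⊥-elim (ℤₚ.<⇒≱ h (ℤ.+≤+ z≤n))

  Desc : Gen → Alcove → Set
  Desc a g = ℓ g ≡ suc (ℓ (a ▹ g))

  sign : ∀ a g → 0ℤ ℤ.≤ height a g ⊎ height a g ℤ.< 0ℤ
  sign a g with 0ℤ ℤₚ.≤? height a g
  ... | yes p = inj₁ p
  ... | no ¬p = inj₂ (ℤₚ.≰⇒> ¬p)

  up⊎down : ∀ a g → ℓ (a ▹ g) ≡ suc (ℓ g) ⊎ Desc a g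
  up⊎down a g with sign a g
  ... | inj₁ h = inj₁ (height≥0⇒up a g h)
  ... | inj₂ h = inj₂ (height<0⇒down a g h)

  up⇒¬down : ∀ {m n} → m ≡ suc n → n ≡ suc m → ⊥
  up⇒¬down refl ()

  Desc⇒height<0 : ∀ a g → Desc a g → height a g ℤ.< 0ℤ
  Desc⇒height<0 a g d with sign a g
  ... | inj₁ h = ⊥-elim (up⇒¬down (height≥0⇒up a g h) d)
  ... | inj₂ h = h

  -- From x < 0 and y < x follow y < 0 and x + y < 0: the alcove is behind all four walls through
  -- the origin, so the whole dihedral subgroup can be descended.
  corner-st : ∀ g → Desc s g → Desc t g → kx g ℤ.< 0ℤ × j g ℤ.< 0ℤ
  corner-st g ds dt = go g (Desc⇒height<0 s g ds) (Desc⇒height<0 t g dt)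
    where
    go : ∀ g → i g ℤ.< 0ℤ → ky g ℤ.< 0ℤ → kx g ℤ.< 0ℤ × j g ℤ.< 0ℤ
    go (alc (+ a) j β γ) (ℤ.+<+ ()) _
    go (alc -[1+ a ] (+ b) β true) _ h rewrite ℕₚ.+-suc b a with h
    ... | ℤ.+<+ ()
    go (alc -[1+ a ] (+ b) β false) _ h rewrite ℕₚ.+-suc b a with h
    ... | ℤ.+<+ ()
    go (alc -[1+ a ] -[1+ b ] true γ) _ _ = ℤ.-<+ , ℤ.-<+
    go (alc -[1+ a ] -[1+ b ] false γ) _ _ = ℤ.-<+ , ℤ.-<+

  -- The same at the vertex (0, 1): from x < 0 and x + y > 1 follow y > 1 and y - x > 1.
  corner-rs : ∀ g → Desc r g → Desc s g → 0ℤ ℤ.< j g × 0ℤ ℤ.< ky g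
  corner-rs g dr ds = go g (Desc⇒height<0 s g ds) (Desc⇒height<0 r g dr)
    where
    go : ∀ g → i g ℤ.< 0ℤ → ℤ.- kx g ℤ.< 0ℤ → 0ℤ ℤ.< j g × 0ℤ ℤ.< ky g
    go (alc (+ a) j β γ) (ℤ.+<+ ()) _
    go (alc -[1+ a ] -[1+ b ] true γ) _ (ℤ.+<+ ())
    go (alc -[1+ a ] -[1+ b ] false γ) _ (ℤ.+<+ ())
    go (alc -[1+ 0 ] (+ 0) true γ) _ (ℤ.+<+ ())
    go (alc -[1+ suc a ] (+ 0) true γ) _ (ℤ.+<+ ())
    go (alc -[1+ a ] (+ 0) false γ) _ (ℤ.+<+ ())
    go (alc -[1+ a ] (+ suc b) β true) _ _ rewrite ℕₚ.+-suc b a = ℤ.+<+ (s≤s z≤n) , ℤ.+<+ (s≤s z≤n)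
    go (alc -[1+ a ] (+ suc b) β false) _ _ = ℤ.+<+ (s≤s z≤n) , ℤ.+<+ (s≤s z≤n)

  noDesc⇒𝟏 : ∀ g → (∀ a → 0ℤ ℤ.≤ height a g) → g ≡ 𝟏
  noDesc⇒𝟏 g h = go g (h s) (h t) (h r)
    where
    go : ∀ g → 0ℤ ℤ.≤ i g → 0ℤ ℤ.≤ ky g → 0ℤ ℤ.≤ ℤ.- kx g → g ≡ 𝟏
    go (alc (+ zero) (+ zero) false false) _ _ _ = refl
    go (alc (+ zero) (+ suc b) true γ) _ _ ()
    go (alc (+ zero) (+ suc b) false γ) _ _ ()
    go (alc (+ suc a) (+ b) true γ) _ _ ()
    go (alc (+ suc a) (+ b) false γ) _ _ ()
    go (alc (+ zero) -[1+ b ] β true) _ () _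
    go (alc (+ zero) -[1+ b ] β false) _ () _
    go (alc (+ suc a) -[1+ b ] β true) _ () _
    go (alc (+ suc a) -[1+ b ] β false) _ () _
    go (alc (+ zero) (+ zero) true γ) _ _ ()
    go (alc (+ zero) (+ zero) false true) _ () _

  descent? : ∀ g → g ≡ 𝟏 ⊎ ∃ λ a → Desc a g
  descent? g with sign r g | sign s g | sign t g
  ... | inj₂ d | _ | _ = inj₂ (r , height<0⇒down r g d)
  ... | inj₁ _ | inj₂ d | _ = inj₂ (s , height<0⇒down s g d)
  ... | inj₁ _ | inj₁ _ | inj₂ d = inj₂ (t , height<0⇒down t g d)
  ... | inj₁ p | inj₁ q | inj₁ o = inj₁ (noDesc⇒𝟏 g λ { r → p ; s → q ; t → o })

  nfF : ℕ → Alcove → Word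
  nfF zero    g = []
  nfF (suc n) g with descent? g
  ... | inj₁ _       = []
  ... | inj₂ (a , _) = a ∷ nfF n (a ▹ g)

  nf : Alcove → Word
  nf g = nfF (ℓ g) g

  corner-r-t : ∀ g → Desc r g → Desc t g → Desc t (r ▹ g) × Desc r (t ▹ g)
  corner-r-t g dr dt =
    height<0⇒down t (r ▹ g) (subst (ℤ._< 0ℤ) (sym (ky-r g)) (Desc⇒height<0 t g dt)) ,
    height<0⇒down r (t ▹ g) (subst (ℤ._< 0ℤ) (cong ℤ.-_ (sym (kx-t g))) (Desc⇒height<0 r g dr))

  Down4 : Gen → Gen → Alcove → Set
  Down4 a b g = Desc b (a ▹ g) × Desc a (b ▹ a ▹ g) × Desc b (a ▹ b ▹ a ▹ g)

  corner-s-t : ∀ g → Desc s g → Desc t g → Down4 s t g × Down4 t s g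
  corner-s-t g ds dt with corner-st g ds dt
  ... | kx<0 , j<0 =
    ( down t (s ▹ g) (ky-s g) kx<0
    , down s (t ▹ s ▹ g) refl j<0
    , down t (s ▹ t ▹ s ▹ g) (trans (ky-s (t ▹ s ▹ g)) (trans (kx-t (s ▹ g)) (kx-s g))) (Desc⇒height<0 t g dt)) ,
    ( down s (t ▹ g) refl j<0
    , down t (s ▹ t ▹ g) (trans (ky-s (t ▹ g)) (kx-t g)) kx<0
    , down s (t ▹ s ▹ t ▹ g) refl (Desc⇒height<0 s g ds))
    where
    down : ∀ a g {h} → height a g ≡ h → h ℤ.< 0ℤ → Desc a g
    down a g refl = height<0⇒down a g

  corner-r-s : ∀ g → Desc r g → Desc s g → Down4 r s g × Down4 s r g
  corner-r-s g dr ds with corner-rs g dr ds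
  ... | j>0 , ky>0 =
    ( down s (r ▹ g) refl (ℤₚ.neg-mono-< j>0)
    , down r (s ▹ r ▹ g) (cong ℤ.-_ (trans (kx-s (r ▹ g)) (ky-r g))) (ℤₚ.neg-mono-< ky>0)
    , down s (r ▹ s ▹ r ▹ g) (ℤₚ.neg-involutive (i g)) (Desc⇒height<0 s g ds)) ,
    ( down r (s ▹ g) (cong ℤ.-_ (kx-s g)) (ℤₚ.neg-mono-< ky>0)
    , down s (r ▹ s ▹ g) refl (ℤₚ.neg-mono-< j>0)
    , down r (s ▹ r ▹ s ▹ g) (cong ℤ.-_ (trans (kx-s (r ▹ s ▹ g)) (trans (ky-r (s ▹ g)) (ky-s g)))) (Desc⇒height<0 r g dr))
    where
    down : ∀ a g {h} → height a g ≡ h → h ℤ.< 0ℤ → Desc a g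
    down a g refl = height<0⇒down a g

  nfF-step : ∀ n g c d → descent? g ≡ inj₂ (c , d) → nfF (suc n) g ≡ c ∷ nfF n (c ▹ g)
  nfF-step n g c d e with descent? g
  nfF-step n g c d refl | _ = refl

  nf-step : ∀ g c d → descent? g ≡ inj₂ (c , d) → nf g ≡ c ∷ nf (c ▹ g)
  nf-step g c d e = trans (cong (λ n → nfF n g) d) (nfF-step _ g c d e)

  -- The argument behind Matsumoto's theorem. An alcove with two descents lies behind all walls of
  -- their dihedral subgroup, so both ways down meet at the bottom of the coset, and the two words
  -- differ by one braid or commutation relation. This makes the model faithful.
  nf-desc-< : ∀ n g → ℓ g < n → ∀ a → Desc a g → nf g ≈ a ∷ nf (a ▹ g)
  nf-desc-< (suc n) g (s≤s g≤n) a da = go (descent? g) refl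
    where
    path : ∀ c → Desc c g → ∀ b → Desc b (c ▹ g) → nf (c ▹ g) ≈ b ∷ nf (b ▹ c ▹ g)
    path c dc b = nf-desc-< n (c ▹ g) (ℕₚ.<-≤-trans (ℕₚ.≤-reflexive (sym dc)) g≤n) b

    path₄ : ∀ c b → Desc c g → Down4 c b g → nf (c ▹ g) ≈ b ∷ c ∷ b ∷ nf (b ▹ c ▹ b ▹ c ▹ g)
    path₄ c b d₁ (d₂ , d₃ , d₄) = ≈-trans (path c d₁ b d₂) (∷-cong b
      (≈-trans (nf-desc-< n (b ▹ c ▹ g) lt₂ c d₃) (∷-cong c
        (nf-desc-< n (c ▹ b ▹ c ▹ g) (ℕₚ.<-trans (ℕₚ.≤-reflexive (sym d₃)) lt₂) b d₄))))
      where
      lt₁ : ℓ (c ▹ g) < n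
      lt₁ = ℕₚ.<-≤-trans (ℕₚ.≤-reflexive (sym d₁)) g≤n
      lt₂ : ℓ (b ▹ c ▹ g) < n
      lt₂ = ℕₚ.<-trans (ℕₚ.≤-reflexive (sym d₂)) lt₁

    compare : ∀ c → Desc c g → c ∷ nf (c ▹ g) ≈ a ∷ nf (a ▹ g)
    compare c dc = cmp c a dc da
      where
      cmp : ∀ c a → Desc c g → Desc a g → c ∷ nf (c ▹ g) ≈ a ∷ nf (a ▹ g)
      rt-case : Desc r g → Desc t g → r ∷ nf (r ▹ g) ≈ t ∷ nf (t ▹ g)
      rt-case dr dt with corner-r-t g dr dt
      ... | d , d′ = ≈-trans (∷-cong r (path r dr t d)) (≈-trans swap-rt (≈-sym (∷-cong t (path t dt r d′))))
      st-case : Desc s g → Desc t g → s ∷ nf (s ▹ g) ≈ t ∷ nf (t ▹ g)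
      st-case ds dt with corner-s-t g ds dt
      ... | d , d′ = ≈-trans (∷-cong s (path₄ s t ds d)) (≈-trans (braid s t rel-st)
                       (≈-sym (∷-cong t (path₄ t s dt d′))))
      rs-case : Desc r g → Desc s g → r ∷ nf (r ▹ g) ≈ s ∷ nf (s ▹ g)
      rs-case dr ds with corner-r-s g dr ds
      ... | d , d′ = ≈-trans (∷-cong r (path₄ r s dr d)) (≈-trans (braid r s rel-rs)
                       (≈-trans (≡⇒≈ (cong (λ h → s ∷ r ∷ s ∷ r ∷ nf h) (sym (braid-rs g))))
                       (≈-sym (∷-cong s (path₄ s r ds d′)))))
      cmp r r _ _ = ≈-refl
      cmp s s _ _ = ≈-refl
      cmp t t _ _ = ≈-refl
      cmp r t p q = rt-case p q
      cmp t r p q = ≈-sym (rt-case q p)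
      cmp s t p q = st-case p q
      cmp t s p q = ≈-sym (st-case q p)
      cmp r s p q = rs-case p q
      cmp s r p q = ≈-sym (rs-case q p)

    go : ∀ x → descent? g ≡ x → nf g ≈ a ∷ nf (a ▹ g)
    go (inj₁ refl) _ = ⊥-elim (ℕₚ.0≢1+n da)
    go (inj₂ (c , dc)) e = ≈-trans (≡⇒≈ (nf-step g c dc e)) (compare c dc)

  nf-▹ : ∀ a g → nf (a ▹ g) ≈ a ∷ nf g
  nf-▹ a g with up⊎down a g
  ... | inj₂ d = ≈-sym (≈-trans (∷-cong a (nf-desc-< _ g ℕₚ.≤-refl a d)) (cancel a _))
  ... | inj₁ u = subst (λ h → nf (a ▹ g) ≈ a ∷ nf h) (▹-invol a g)
                   (nf-desc-< _ (a ▹ g) ℕₚ.≤-refl a (trans u (cong (λ h → suc (ℓ h)) (sym (▹-invol a g)))))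

  act-++ : ∀ u v g → (u ++ v) ▹* g ≡ u ▹* v ▹* g
  act-++ []      v g = refl
  act-++ (a ∷ u) v g = cong (a ▹_) (act-++ u v g)

  cancel₄ : ∀ a b g → a ▹ b ▹ a ▹ b ▹ b ▹ a ▹ b ▹ a ▹ g ≡ g
  cancel₄ a b g rewrite ▹-invol b (a ▹ b ▹ a ▹ g) | ▹-invol a (b ▹ a ▹ g) | ▹-invol b (a ▹ g) = ▹-invol a g

  act-≈ : ∀ {u v} → u ≈ v → ∀ g → u ▹* g ≡ v ▹* g
  act-≈ ≈-refl g = refl
  act-≈ (≈-sym p) g = sym (act-≈ p g)
  act-≈ (≈-trans p q) g = trans (act-≈ p g) (act-≈ q g)
  act-≈ (≈-cong {a} {b} {c} {d} p q) g =
    trans (act-++ a c g) (trans (act-≈ p (c ▹* g)) (trans (cong (b ▹*_) (act-≈ q g)) (sym (act-++ b d g))))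
  act-≈ (rel-sq x) g = ▹-invol x g
  act-≈ rel-rt g = refl
  act-≈ rel-rs g = trans (braid-rs _) (cancel₄ s r g)
  act-≈ rel-st g = trans (braid-st _) (cancel₄ t s g)

  nf-spec : ∀ n g → ℓ g ≡ n → nfF n g ▹* 𝟏 ≡ g × length (nfF n g) ≡ n
  nf-spec zero g e with descent? g
  ... | inj₁ refl = refl , refl
  ... | inj₂ (a , d) with trans (sym e) d
  ...   | ()
  nf-spec (suc n) g e with descent? g
  ... | inj₁ refl with e
  ...   | ()
  nf-spec (suc n) g e | inj₂ (a , d) with nf-spec n (a ▹ g) (ℕₚ.suc-injective (trans (sym d) e))
  ... | p , q = trans (cong (a ▹_) p) (▹-invol a g) , cong suc q

  _≟ᴬ_ : (g h : Alcove) → Dec (g ≡ h)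
  alc i j β γ ≟ᴬ alc i′ j′ β′ γ′ with i ℤₚ.≟ i′ | j ℤₚ.≟ j′ | β Bool.≟ β′ | γ Bool.≟ γ′
  ... | yes refl | yes refl | yes refl | yes refl = yes refl
  ... | no p | _ | _ | _ = no λ { refl → p refl }
  ... | _ | no p | _ | _ = no λ { refl → p refl }
  ... | _ | _ | no p | _ = no λ { refl → p refl }
  ... | _ | _ | _ | no p = no λ { refl → p refl }

  alcoves : Model
  alcoves = record
    { G = Alcove ; _≟_ = _≟ᴬ_ ; _·_ = _▹_ ; e = 𝟏 ; len = ℓ ; word = nf
    ; len-e = refl ; invol = ▹-invol ; up-down = up⊎down ; ··-≈ = act-≈ ; word-· = nf-▹ ; word-e = refl
    ; ··-word = λ g → proj₁ (nf-spec (ℓ g) g refl) ; len-word = λ g → proj₂ (nf-spec (ℓ g) g refl) }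

  -- The half-strip 0 < y < 1, x + y > 1, y < x, which the alcoves x_m q fill.
  record Good (g : Alcove) : Set where
    field
      kx>0 : 0ℤ ℤ.< kx g
      ky<0 : ky g ℤ.< 0ℤ
      i≥0  : 0ℤ ℤ.≤ i g
      j≡0  : j g ≡ 0ℤ

  open Good

  good-base : ∀ {q} → Suf q → Good (r ▹ t ▹ q ▹* 𝟏) × ℓ (r ▹ t ▹ q ▹* 𝟏) ≡ 2 ℕ.+ length q
  good-base se  = record { kx>0 = ℤ.+<+ (s≤s z≤n) ; ky<0 = ℤ.-<+ ; i≥0 = ℤ.+≤+ z≤n ; j≡0 = refl } , refl
  good-base ss  = record { kx>0 = ℤ.+<+ (s≤s z≤n) ; ky<0 = ℤ.-<+ ; i≥0 = ℤ.+≤+ z≤n ; j≡0 = refl } , refl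
  good-base sst = record { kx>0 = ℤ.+<+ (s≤s z≤n) ; ky<0 = ℤ.-<+ ; i≥0 = ℤ.+≤+ z≤n ; j≡0 = refl } , refl
  good-base ssr = record { kx>0 = ℤ.+<+ (s≤s z≤n) ; ky<0 = ℤ.-<+ ; i≥0 = ℤ.+≤+ z≤n ; j≡0 = refl } , refl

  -- The product r t s is the glide reflection taking (x, y) to (x + 1, 1 - y), which moves the
  -- half-strip along itself.
  good-step : ∀ {g} → Good g → Good (r ▹ t ▹ s ▹ g)
  good-step {g} h = record
    { kx>0 = subst (0ℤ ℤ.<_) (sym (trans (kx-r (t ▹ s ▹ g)) (cong flip₁ (trans (kx-t (s ▹ g)) (kx-s g))))) (flip₁-pos (ky<0 h))
    ; ky<0 = subst (ℤ._< 0ℤ) (sym (trans (ky-r (t ▹ s ▹ g)) (trans (ky-t (s ▹ g)) (cong flip₀ (ky-s g))))) (flip₀-neg (kx>0 h))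
    ; i≥0  = neg-flip₀ (i≥0 h)
    ; j≡0  = cong ℤ.-_ (j≡0 h) }
    where
    flip₁-pos : ∀ {k} → k ℤ.< 0ℤ → 0ℤ ℤ.< flip₁ k
    flip₁-pos {+ n} (ℤ.+<+ ())
    flip₁-pos { -[1+ n ]} _ = ℤ.+<+ (s≤s z≤n)
    flip₀-neg : ∀ {k} → 0ℤ ℤ.< k → flip₀ k ℤ.< 0ℤ
    flip₀-neg {+ n} _ = ℤ.-<+
    neg-flip₀ : ∀ {k} → 0ℤ ℤ.≤ k → 0ℤ ℤ.≤ ℤ.- flip₀ k
    neg-flip₀ {+ n} _ = ℤ.+≤+ z≤n

  module _ {g : Alcove} (h : Good g) where
    private
      up : ∀ a x {k} → height a x ≡ k → 0ℤ ℤ.≤ k → ℓ (a ▹ x) ≡ suc (ℓ x)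
      up a x refl = height≥0⇒up a x
      -ky≥0 : 0ℤ ℤ.≤ ℤ.- ky g
      -ky≥0 = ℤₚ.<⇒≤ (ℤₚ.neg-mono-< (ky<0 h))
      kx≥0 : 0ℤ ℤ.≤ kx g
      kx≥0 = ℤₚ.<⇒≤ (kx>0 h)

    good-r : Desc r g
    good-r = height<0⇒down r g (ℤₚ.neg-mono-< (kx>0 h))
    good-t : Desc t g
    good-t = height<0⇒down t g (ky<0 h)
    good-s : ℓ (s ▹ g) ≡ suc (ℓ g)
    good-s = height≥0⇒up s g (i≥0 h)
    good-rs : ℓ (r ▹ s ▹ g) ≡ suc (ℓ (s ▹ g))
    good-rs = up r (s ▹ g) (cong ℤ.-_ (kx-s g)) -ky≥0
    good-ts : ℓ (t ▹ s ▹ g) ≡ suc (ℓ (s ▹ g))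
    good-ts = up t (s ▹ g) (ky-s g) kx≥0
    good-sts : ℓ (s ▹ t ▹ s ▹ g) ≡ suc (ℓ (t ▹ s ▹ g))
    good-sts = up s (t ▹ s ▹ g) (j≡0 h) (ℤ.+≤+ z≤n)
    good-rts : ℓ (r ▹ t ▹ s ▹ g) ≡ suc (ℓ (t ▹ s ▹ g))
    good-rts = up r (t ▹ s ▹ g) (cong ℤ.-_ (trans (kx-t (s ▹ g)) (kx-s g))) -ky≥0
    good-srs : ℓ (s ▹ r ▹ s ▹ g) ≡ suc (ℓ (r ▹ s ▹ g))
    good-srs = up s (r ▹ s ▹ g) (cong ℤ.-_ (j≡0 h)) (ℤ.+≤+ z≤n)
    good-trs : ℓ (t ▹ r ▹ s ▹ g) ≡ suc (ℓ (r ▹ s ▹ g))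
    good-trs = up t (r ▹ s ▹ g) (trans (ky-r (s ▹ g)) (ky-s g)) kx≥0
    good-st : ℓ (s ▹ t ▹ g) ≡ suc (ℓ (t ▹ g))
    good-st = up s (t ▹ g) (j≡0 h) (ℤ.+≤+ z≤n)
    good-sr : ℓ (s ▹ r ▹ g) ≡ suc (ℓ (r ▹ g))
    good-sr = up s (r ▹ g) (cong ℤ.-_ (j≡0 h)) (ℤ.+≤+ z≤n)

  cell : Cell alcoves
  cell = record
    { Good = Good ; good-base = good-base ; good-step = good-step ; good-r = good-r ; good-t = good-t ; good-s = good-s
    ; good-rs = good-rs ; good-ts = good-ts ; good-sts = good-sts ; good-rts = good-rts ; good-srs = good-srs
    ; good-trs = good-trs ; good-st = good-st ; good-sr = good-sr }

theorem5p9 : ∀ (P : Word → Word → Poly) → IsKL P →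
    ∀ u w → IsReduced u → IsReduced w → InC2 u → InC2 w →
    u ≤B w → SimR P u w → ¬ SimL P u w →
    ((¬ RSub w u) → mu P u w ≡ (if (length w ∸ length u) ≡ᵇ 1 then 1ℤ else 0ℤ)) ×
    (RSub w u → mu P u w ≡ (if (length w ∸ length u) ≡ᵇ 5 then 1ℤ else 0ℤ))
theorem5p9 P K = Assembly.theorem Alcoves.alcoves Alcoves.cell P K
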